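{- There is a large enough constant $C>0$ such that the following holds. Fix $\varepsilon\in(0,1)$, $0<t<1$, and a local property $\mathcal{P}$ of sequences $f:[n]\to\mathbb{R}$, where $n\ge\frac{C\left(\log\frac1\varepsilon+\log\frac1{1-t}\right)^2}{\varepsilon^2(1-t)}$. There exists a one-sided error $\varepsilon$-tester for $\mathcal{P}$ that works in the presence of a $t$-online erasure fixed-rate adversary and has query complexity $O\left(\frac{\log(\varepsilon n)}{\varepsilon(1-t)}\right)$. For a corruption adversary, the same is true without the one-sided error guarantee.
   Context: $\log$ is base 2; $[n]=\{1,\dots,n\}$. A property $\mathcal{P}$ of sequences $f:[n]\to\mathbb{R}$ is local if there is a family $\mathcal{F}\subseteq\mathbb{R}^2$ of forbidden pairs such that $f\in\mathcal{P}$ iff $(f(i),f(i+1))\notin\mathcal{F}$ for all $i\in[n-1]$. Online model. Access to the input $f$ is via a sequence of oracles $\mathcal{O}_1,\mathcal{O}_2,\dots$, where $\mathcal{O}_i$ answers the $i$-th query (batch size 1) and $\mathcal{O}_1=f$. After each query the adversary chooses the next oracle; its strategy may depend on the input, the tester's description, and all queries made so far, but not on the tester's future coin tosses. Let $\mathrm{Dist}$ denote Hamming distance (number of points with different answers). A $t$-online fixed-rate adversary must satisfy $\mathrm{Dist}(\mathcal{O}_i,\mathcal{O}_{i+1})\le\lfloor(i+1)t\rfloor-\lfloor it\rfloor$ for all $i\in\mathbb{N}$. An erasure adversary must satisfy $\mathcal{O}_{i+1}(x)\in\{\mathcal{O}_i(x),\perp\}$ for all $x$ ($\perp$ is the erasure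 symbol); a corruption adversary may change values arbitrarily within the range. $f$ is $\varepsilon$-far from $\mathcal{P}$ if at least an $\varepsilon$ fraction of the values of $f$ must be changed to obtain a sequence in $\mathcal{P}$. An (online) $\varepsilon$-tester for $\mathcal{P}$ working in the presence of a given type of adversary is a randomized algorithm that, for every adversarial strategy of that type, accepts with probability at least $2/3$ if $f\in\mathcal{P}$ and rejects with probability at least $2/3$ if $f$ is $\varepsilon$-far from $\mathcal{P}$. It has one-sided error if it always accepts every $f\in\mathcal{P}$. -}

module Defs where

open import Algebra.Bundles using (CommutativeRing; Semiring)
open import Data.Bool.Base using (Bool; true; false; if_then_else_)
import Data.Bool.Properties as Bool
open import Data.Fin.Base using (Fin; toℕ)
open import Data.Integer.Base as ℤ using (ℤ; -[1+_])
open import Data.List.Base using (List; []; _∷_; length)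
open import Data.Maybe.Base using (Maybe; just; nothing)
open import Data.Maybe.Relation.Binary.Pointwise as Maybe using ()
open import Data.Nat.Base as ℕ using (ℕ; suc; NonZero)
open import Data.Product.Base using (_×_; ∃-syntax; Σ-syntax)
open import Data.Rational.Unnormalised.Base as ℚᵘ using (ℚᵘ)
open import Data.Sum.Base using (_⊎_)
open import Data.Vec.Base as Vec using ()
open import Function.Bundles using (_⇔_)
open import Level using (0ℓ) renaming (suc to lsuc)
open import Relation.Binary.Bundles using (DecSetoid)
open import Relation.Binary.Core using (Rel)
open import Relation.Binary.Definitions using (_Respects₂_)
open import Relation.Binary.PropositionalEquality.Core using (_≡_)
open import Relation.Binary.Structures using (IsStrictTotalOrder)
import Relation.Binary.Construct.StrictToNonStrict as ToNonStrict
open import Relation.Nullary.Decidable.Core using (does; ¬?)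
open import Relation.Nullary.Negation.Core using (¬_)
open import Relation.Unary using (Pred; Decidable; Satisfiable)

countFin : ∀ {n} {P : Pred (Fin n) 0ℓ} → Decidable P → ℕ
countFin {n} P? = Vec.count P? (Vec.allFin n)

-- The real numbers, given up to isomorphism as a Dedekind-complete ordered
-- field.  As in classical analysis the order is total (and decidable).  Two
-- operations are total with unspecified junk values: the inverse at 0#, and
-- the supremum of an empty or unbounded set.

record RealNumbers : Set₁ where
  field
    commutativeRing : CommutativeRing 0ℓ 0ℓ

  open CommutativeRing commutativeRing public

  infix  4 _<_
  infix  8 _⁻¹

  field
    _<_                : Rel Carrier 0ℓ
    isStrictTotalOrder : IsStrictTotalOrder _≈_ _<_
    0<1                : 0# < 1#
    +-monoʳ-<          : ∀ x {y z} → y < z → x + y < x + z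
    *-pos              : ∀ {x y} → 0# < x → 0# < y → 0# < x * y
    _⁻¹                : Carrier → Carrier
    ⁻¹-inverseʳ        : ∀ x → ¬ (x ≈ 0#) → x * x ⁻¹ ≈ 1#

  open ToNonStrict _≈_ _<_ public using (_≤_)

  UpperBound : Pred Carrier 0ℓ → Pred Carrier 0ℓ
  UpperBound S b = ∀ x → S x → x ≤ b

  IsLub : Pred Carrier 0ℓ → Pred Carrier 0ℓ
  IsLub S s = UpperBound S s × (∀ b → UpperBound S b → s ≤ b)

  field
    sup       : Pred Carrier 0ℓ → Carrier
    sup-isLub : ∀ S → Satisfiable S → Satisfiable (UpperBound S) → IsLub S (sup S)

  open IsStrictTotalOrder isStrictTotalOrder public using (_≟_; _<?_)
  open import Algebra.Definitions.RawSemiring (Semiring.rawSemiring semiring) public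
    using (_^_) renaming (_×_ to _·_)

  infixl 7 _/_
  _/_ : Carrier → Carrier → Carrier
  x / y = x * y ⁻¹

  ∣_∣ : Carrier → Carrier
  ∣ x ∣ = if does (x <? 0#) then - x else x

  fromℕ : ℕ → Carrier
  fromℕ n = n · 1#

  fromℤ : ℤ → Carrier
  fromℤ (ℤ.+ n)  = fromℕ n
  fromℤ -[1+ n ] = - fromℕ (suc n)

  infixr 8 _^ℤ_
  _^ℤ_ : Carrier → ℤ → Carrier
  x ^ℤ (ℤ.+ n)  = x ^ n
  x ^ℤ -[1+ n ] = (x ^ suc n) ⁻¹

  2# : Carrier
  2# = 1# + 1#

  -- The largest integer ≤ x, as a real number.
  ⌊_⌋ : Carrier → Carrier
  ⌊ x ⌋ = sup (λ r → ∃[ z ] (r ≈ fromℤ z) × (fromℤ z ≤ x))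

  -- For x > 0, the supremum of the rationals r = p / (q + 1) with 2 ^ r ≤ x,
  -- the latter condition being stated as 2 ^ p ≤ x ^ (q + 1).
  log₂ : Carrier → Carrier
  log₂ x = sup (λ r → Σ[ p ∈ ℤ ] Σ[ q ∈ ℕ ]
                        (r * fromℕ (suc q) ≈ fromℤ p) × (2# ^ℤ p ≤ x ^ suc q))

  realDecSetoid : DecSetoid 0ℓ 0ℓ
  realDecSetoid = record { isDecEquivalence = IsStrictTotalOrder.isDecEquivalence isStrictTotalOrder }

-- Oracles for a domain of size n with answers in A.

module OnlineModel (A : DecSetoid 0ℓ 0ℓ) (n : ℕ) where
  open DecSetoid A renaming (Carrier to Answer)

  Oracle : Set
  Oracle = Fin n → Answer

  Dist : Oracle → Oracle → ℕ
  Dist f g = countFin (λ x → ¬? (f x ≟ g x))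

  -- A deterministic adaptive algorithm making at most q queries on every
  -- sequence of answers; it outputs true to accept and false to reject.
  data DecisionTree : ℕ → Set where
    output : ∀ {q} → Bool → DecisionTree q
    query  : ∀ {q} → Fin n → (Answer → DecisionTree q) → DecisionTree (suc q)

  -- T ≋ T says that T depends on the answers only up to ≈.
  data _≋_ : ∀ {q} → Rel (DecisionTree q) 0ℓ where
    output : ∀ {q} b → output {q} b ≋ output b
    query  : ∀ {q} x {k l : Answer → DecisionTree q} →
             (∀ {a b} → a ≈ b → k a ≋ l b) → query x k ≋ query x l

  -- A randomized algorithm with worst-case query complexity at most q: all
  -- coins form a seed, uniformly distributed in Fin seeds.
  record RandomizedAlgorithm (q : ℕ) : Set where
    field
      seeds       : ℕ
      {{nonZero}} : NonZero seeds
      tree        : Fin seeds → DecisionTree q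
      extensional : ∀ s → tree s ≋ tree s

  -- The current oracle as a function of the queries made so far, the most
  -- recent one first: after i queries the oracle is the (i+1)-st one.  The
  -- input and the algorithm are fixed before a strategy is chosen, but the
  -- seed is visible to the strategy only through the queries.
  Strategy : Set
  Strategy = List (Fin n) → Oracle

  run : ∀ {q} → DecisionTree q → Strategy → List (Fin n) → Bool
  run (output b)  S h = b
  run (query x k) S h = run (k (S h x)) S (x ∷ h)

  module _ {q} (T : RandomizedAlgorithm q) (S : Strategy) where
    open RandomizedAlgorithm T

    outcome : Fin seeds → Bool
    outcome s = run (tree s) S []

    Pr[outcome≡_] : Bool → ℚᵘ
    Pr[outcome≡ b ] = ℤ.+ countFin (λ s → outcome s Bool.≟ b) ℚᵘ./ seeds

  StartsWith : Oracle → Strategy → Set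
  StartsWith f S = ∀ x → S [] x ≈ f x

module PropertyTesting (ℝ : RealNumbers) where
  open RealNumbers ℝ

  Sequence : ℕ → Set
  Sequence n = Fin n → Carrier

  Property : ℕ → Set₁
  Property n = Pred (Sequence n) 0ℓ

  IsLocal : ∀ {n} → Property n → Set₁
  IsLocal {n} P =
    Σ[ F ∈ Rel Carrier 0ℓ ] (F Respects₂ _≈_) ×
      (∀ f → P f ⇔ (∀ (i j : Fin n) → toℕ j ≡ suc (toℕ i) → ¬ F (f i) (f j)))

  Far : ∀ {n} → Carrier → Property n → Sequence n → Set
  Far {n} ε P f = ∀ g → P g → ε * fromℕ n ≤ fromℕ (Dist f g)
    where open OnlineModel realDecSetoid n

  module _ (A : DecSetoid 0ℓ 0ℓ) {n : ℕ} where
    open OnlineModel A n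

    -- With i = length h + 1, the oracles 𝒪ᵢ and 𝒪ᵢ₊₁ are S h and S (x ∷ h).
    FixedRate : Carrier → Strategy → Set
    FixedRate t S = ∀ h x → let i = suc (length h) in
      fromℕ (Dist (S h) (S (x ∷ h))) ≤ ⌊ fromℕ (suc i) * t ⌋ - ⌊ fromℕ i * t ⌋

  -- A type of adversary for inputs of length n: what oracles answer, and which
  -- strategies are allowed on each input.
  record AdversaryType (n : ℕ) : Set₁ where
    field
      answers : DecSetoid 0ℓ 0ℓ
      Allowed : Sequence n → Pred (OnlineModel.Strategy answers n) 0ℓ

  erasable : DecSetoid 0ℓ 0ℓ
  erasable = Maybe.decSetoid realDecSetoid

  -- The value nothing is the erasure symbol ⊥.
  fixedRateErasure : Carrier → (n : ℕ) → AdversaryType n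
  fixedRateErasure t n = record
    { answers = erasable
    ; Allowed = λ f S → StartsWith (λ x → just (f x)) S
                      × FixedRate erasable t S
                      × (∀ h x y → (S (x ∷ h) y ≈ᴹ S h y) ⊎ (S (x ∷ h) y ≈ᴹ nothing))
    }
    where
    open OnlineModel erasable n
    open DecSetoid erasable using () renaming (_≈_ to _≈ᴹ_)

  fixedRateCorruption : Carrier → (n : ℕ) → AdversaryType n
  fixedRateCorruption t n = record
    { answers = realDecSetoid
    ; Allowed = λ f S → StartsWith f S × FixedRate realDecSetoid t S
    }
    where open OnlineModel realDecSetoid n

  module _ {n : ℕ} (𝒜 : AdversaryType n) where
    open AdversaryType 𝒜
    open OnlineModel answers n

    Algorithm : ℕ → Set
    Algorithm = RandomizedAlgorithm

    private
      2/3 : ℚᵘ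
      2/3 = ℤ.+ 2 ℚᵘ./ 3

    IsTester : Carrier → Property n → ∀ {q} → Algorithm q → Set
    IsTester ε P T = ∀ f S → Allowed f S →
      (P f       → 2/3 ℚᵘ.≤ Pr[outcome≡_] T S true) ×
      (Far ε P f → 2/3 ℚᵘ.≤ Pr[outcome≡_] T S false)

    OneSided : Property n → ∀ {q} → Algorithm q → Set
    OneSided P T = ∀ f S → Allowed f S → P f → ∀ s → outcome T S s ≡ true

{-# OPTIONS --safe #-}

-- Call a pair of positions bad for f if no sequence with the property agrees with f at both.  Since
-- the property is local, such sequences can be spliced at a common value; repairing f along a shifted
-- dyadic subdivision then costs at most twice the total length of the bad dyadic intervals.  Averaging
-- over the shifts, a far f has at least 2^L bad pairs (x , x + 2^l) with l ≤ L, where 2^L is about εn.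
-- The tester picks x and l at random.  As t < 1, among any 1/(1-t) consecutive steps there is one at
-- which ⌊it⌋ does not increase, so the tester waits for it and queries both positions of the pair
-- without any change of the oracle in between.  Each position is almost uniformly distributed and n
-- is large, so the positions manipulated before spoil only a small fraction of the pairs.

module Submission where

open import Defs
open import Axiom.ExcludedMiddle using (ExcludedMiddle)
open import Data.Nat.Base using (ℕ)
open import Data.Product.Base using (_×_; Σ-syntax)
open import Level using (0ℓ)

open import Data.Bool.Base using (Bool; true; false; if_then_else_; not)
import Data.Bool.Properties as Bool
open import Data.Fin.Base using (Fin; zero; suc; toℕ; fromℕ<; combine; remQuot; _↑ˡ_; _↑ʳ_)
open import Data.Fin.Properties using (toℕ<n; toℕ-injective; toℕ-fromℕ<; remQuot-combine)
open import Data.Integer.Base as ℤ using (ℤ; -[1+_])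
open import Data.Integer.Properties using (pos-*)
open import Data.List.Base using (List; []; _∷_; length)
open import Data.Maybe.Base using (just; nothing)
open import Data.Maybe.Relation.Binary.Pointwise using (just)
open import Data.Nat.Base as ℕ using (zero; suc; z≤n; s≤s; NonZero)
open import Data.Nat.DivMod using (_mod_; m<n⇒m%n≡m)
import Data.Nat.Properties as ℕ
open import Data.Nat.Tactic.RingSolver using (solve-∀)
open import Data.Product.Base using (_,_; proj₁; proj₂; ∃-syntax)
import Data.Rational.Unnormalised.Base as ℚᵘ
open import Data.Sum.Base using (_⊎_; inj₁; inj₂)
open import Data.Unit.Base using (⊤; tt)
open import Data.Vec.Base as Vec using (Vec; []; _∷_)
open import Data.Vec.Membership.Propositional.Properties using (∈-allFin⁺)
open import Data.Vec.Relation.Unary.All as All using (All; []; _∷_)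
open import Function.Base using (_∘_; id)
open import Function.Bundles using (_⇔_; mk⇔; Equivalence)
open import Relation.Binary.Bundles using (DecSetoid; StrictTotalOrder)
import Relation.Binary.Construct.StrictToNonStrict as ToNonStrict
open import Relation.Binary.Core using (Rel)
open import Relation.Binary.Definitions using (_Respects₂_; tri<; tri≈; tri>)
open import Relation.Binary.PropositionalEquality as ≡ using (_≡_)
open import Relation.Binary.Structures using (IsDecEquivalence)
open import Relation.Nullary using (¬_; Dec; yes; no; does; ¬?; contradiction)
open import Relation.Nullary.Decidable using (dec-true; dec-false; does-⇔)
open import Relation.Unary using (Pred; Decidable)

-- The error analysis needs n above a constant times log²(εn)/(ε²(1-t)): there are about log(εn)/ε
-- rounds, and in each of them a position manipulated earlier may spoil the pair. The hypothesis
-- offers only log(1/ε) and log(1/(1-t)). If n is about 2^d/(ε²(1-t)), then log(εn) is at most these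
-- two logarithms plus d, up to a constant, and 2^d outgrows d². This breaks down only for d below a
-- constant; but then the hypothesis makes both logarithms small, so ε is near 1, t is near 0, n is
-- bounded, and the tester can read everything.
--
-- The waiting times depend only on the number of queries made. Hence the test moments are the same
-- for all coins, and given the history the next pair is still uniform, so an adaptive adversary can
-- be handled round by round. Probabilities are kept as numbers of seeds. Pairs may wrap around the
-- end of the sequence: this makes the second position exactly uniform, and it is harmless because
-- the test asks for a sequence with the property that fits both answers.

-- Finite sums of natural numbers and Bernoulli's inequality.

module Sums where
  open import Data.Nat.Base
  open import Data.Nat.DivMod using ([m+n]%n≡m%n)
  open import Data.Nat.Properties hiding (_≟_)
  open import Relation.Binary.PropositionalEquality
  open import Algebra.Properties.CommutativeMonoid.Sum +-0-commutativeMonoid public using (sum; sum-syntax; sum-cong-≗; ∑-distrib-+)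

  𝟙 : Bool → ℕ
  𝟙 b = if b then 1 else 0

  𝟙≤1 : ∀ b → 𝟙 b ≤ 1
  𝟙≤1 false = z≤n
  𝟙≤1 true  = ≤-refl

  𝟙-yes : ∀ {a} {A : Set a} (A? : Dec A) → A → 𝟙 (does A?) ≡ 1
  𝟙-yes (yes _) _ = refl
  𝟙-yes (no ¬a) a = contradiction a ¬a

  𝟙-no : ∀ {a} {A : Set a} (A? : Dec A) → ¬ A → 𝟙 (does A?) ≡ 0
  𝟙-no (yes a) ¬a = contradiction a ¬a
  𝟙-no (no _) _   = refl

  countFin≡∑ : ∀ {n} {P : Pred (Fin n) 0ℓ} (P? : Decidable P) →
               countFin P? ≡ ∑[ i < n ] 𝟙 (does (P? i))
  countFin≡∑ P? = count-tabulate P? id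
    where
    count-tabulate : ∀ {k n} {P : Pred (Fin k) 0ℓ} (P? : Decidable P) (f : Fin n → Fin k) →
                     Vec.count P? (Vec.tabulate f) ≡ ∑[ i < n ] 𝟙 (does (P? (f i)))
    count-tabulate {n = zero}  P? f = refl
    count-tabulate {n = suc n} P? f with does (P? (f zero))
    ... | true  = cong suc (count-tabulate P? (f ∘ suc))
    ... | false = count-tabulate P? (f ∘ suc)

  ∑-mono : ∀ {n} {f g : Fin n → ℕ} → (∀ i → f i ≤ g i) → sum f ≤ sum g
  ∑-mono {zero}  _   = z≤n
  ∑-mono {suc n} f≤g = +-mono-≤ (f≤g zero) (∑-mono (f≤g ∘ suc))

  ∑-const : ∀ n c → ∑[ i < n ] c ≡ n * c
  ∑-const zero    c = refl
  ∑-const (suc n) c = cong (c +_) (∑-const n c)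

  ∑-≤-const : ∀ {n} {f : Fin n → ℕ} {c} → (∀ i → f i ≤ c) → sum f ≤ n * c
  ∑-≤-const {n} {c = c} f≤c = ≤-trans (∑-mono f≤c) (≤-reflexive (∑-const n c))

  ≤-∑ : ∀ {n} (f : Fin n → ℕ) i → f i ≤ sum f
  ≤-∑ f zero    = m≤m+n _ _
  ≤-∑ f (suc i) = m≤n⇒m≤o+n (f zero) (≤-∑ (f ∘ suc) i)

  ∑-split-Fin : ∀ m n (f : Fin (m + n) → ℕ) →
                sum f ≡ ∑[ i < m ] f (i ↑ˡ n) + ∑[ j < n ] f (m ↑ʳ j)
  ∑-split-Fin zero    n f = refl
  ∑-split-Fin (suc m) n f rewrite ∑-split-Fin m n (f ∘ suc) = sym (+-assoc (f zero) _ _)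

  ∑-combine : ∀ m n (f : Fin (m * n) → ℕ) →
              sum f ≡ ∑[ i < m ] ∑[ j < n ] f (combine i j)
  ∑-combine zero    n f = refl
  ∑-combine (suc m) n f = begin
    sum f
      ≡⟨ ∑-split-Fin n (m * n) f ⟩
    ∑[ j < n ] f (j ↑ˡ (m * n)) + ∑[ k < m * n ] f (n ↑ʳ k)
      ≡⟨ cong (∑[ j < n ] f (j ↑ˡ (m * n)) +_) (∑-combine m n (λ k → f (n ↑ʳ k))) ⟩
    ∑[ j < n ] f (combine {suc m} zero j) + ∑[ i < m ] ∑[ j < n ] f (combine (suc i) j) ∎
    where open ≡-Reasoning

  ∑-remQuot : ∀ m n (g : Fin m × Fin n → ℕ) →
              ∑[ k < m * n ] g (remQuot n k) ≡ ∑[ i < m ] ∑[ j < n ] g (i , j)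
  ∑-remQuot m n g = trans (∑-combine m n (g ∘ remQuot n))
    (sum-cong-≗ λ i → sum-cong-≗ λ j → cong g (remQuot-combine i j))

  ∑-+ : ∀ m n (g : ℕ → ℕ) →
        ∑[ i < m + n ] g (toℕ i) ≡ ∑[ i < m ] g (toℕ i) + ∑[ j < n ] g (m + toℕ j)
  ∑-+ zero    n g = refl
  ∑-+ (suc m) n g rewrite ∑-+ m n (g ∘ suc) = sym (+-assoc (g 0) _ _)

  ∑-suc : ∀ n (g : ℕ → ℕ) → ∑[ i < suc n ] g (toℕ i) ≡ ∑[ i < n ] g (toℕ i) + g n
  ∑-suc n g = begin
    ∑[ i < suc n ] g (toℕ i)               ≡⟨ cong (λ k → ∑[ i < k ] g (toℕ i)) (+-comm 1 n) ⟩
    ∑[ i < n + 1 ] g (toℕ i)               ≡⟨ ∑-+ n 1 g ⟩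
    ∑[ i < n ] g (toℕ i) + (g (n + 0) + 0) ≡⟨ cong (∑[ i < n ] g (toℕ i) +_)
                                                (trans (+-identityʳ _) (cong g (+-identityʳ n))) ⟩
    ∑[ i < n ] g (toℕ i) + g n             ∎
    where open ≡-Reasoning

  ∑-range-mono : ∀ {m n} (g : ℕ → ℕ) → m ≤ n → ∑[ i < m ] g (toℕ i) ≤ ∑[ i < n ] g (toℕ i)
  ∑-range-mono {m} {n} g m≤n = subst (λ k → ∑[ i < m ] g (toℕ i) ≤ ∑[ i < k ] g (toℕ i)) (m+[n∸m]≡n m≤n)
    (≤-trans (m≤m+n _ _) (≤-reflexive (sym (∑-+ m (n ∸ m) g))))

  -- Positions are grouped by residue modulo `n`. With `n` as the block length, a sum over all
  -- positions becomes a sum over all shifts of a chain of blocks.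
  ∑-* : ∀ m n (g : ℕ → ℕ) →
        ∑[ x < m * n ] g (toℕ x) ≡ ∑[ s < n ] ∑[ j < m ] g (toℕ s + toℕ j * n)
  ∑-* zero    n g = sym (trans (∑-const n 0) (*-zeroʳ n))
  ∑-* (suc m) n g = begin
    ∑[ x < n + m * n ] g (toℕ x)
      ≡⟨ ∑-+ n (m * n) g ⟩
    ∑[ s < n ] g (toℕ s) + ∑[ x < m * n ] g (n + toℕ x)
      ≡⟨ cong₂ _+_ (sum-cong-≗ {n} λ s → cong g (sym (+-identityʳ (toℕ s)))) (∑-* m n (g ∘ (n +_))) ⟩
    ∑[ s < n ] g (toℕ s + 0) + ∑[ s < n ] ∑[ j < m ] g (n + (toℕ s + toℕ j * n))
      ≡⟨ ∑-distrib-+ {n} _ _ ⟨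
    ∑[ s < n ] (g (toℕ s + 0) + ∑[ j < m ] g (n + (toℕ s + toℕ j * n)))
      ≡⟨ sum-cong-≗ {n} (λ s → cong (g (toℕ s + 0) +_) (sum-cong-≗ {m} λ j →
           cong g (lemma n (toℕ s) (toℕ j * n)))) ⟩
    ∑[ s < n ] ∑[ j < suc m ] g (toℕ s + toℕ j * n) ∎
    where
    open ≡-Reasoning
    lemma : ∀ a b c → a + (b + c) ≡ b + (a + c)
    lemma = solve-∀

  pigeonhole : ∀ n (g : ℕ → ℕ) c → ∑[ i < n ] g (toℕ i) < n * c → ∃[ i ] i < n × g i < c
  pigeonhole (suc n) g c ∑<nc with g 0 <? c
  ... | yes g0<c = 0 , z<s , g0<c
  ... | no  g0≮c with pigeonhole n (g ∘ suc) c
                        (+-cancelˡ-< c _ _ (≤-<-trans (+-monoˡ-≤ _ (≮⇒≥ g0≮c)) ∑<nc))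
  ...   | i , i<n , gi<c = suc i , s<s i<n , gi<c

  toℕ-mod : ∀ {n} .{{_ : NonZero n}} (i : Fin n) → toℕ i mod n ≡ i
  toℕ-mod {n} i = toℕ-injective (trans (toℕ-fromℕ< _) (m<n⇒m%n≡m (toℕ<n i)))

  mod-periodic : ∀ m n .{{_ : NonZero n}} → (m + n) mod n ≡ m mod n
  mod-periodic m n = toℕ-injective (trans (toℕ-fromℕ< _) (trans ([m+n]%n≡m%n m n) (sym (toℕ-fromℕ< _))))

  -- A cyclic shift permutes the positions; the proof cuts the range where the shift wraps around
  -- and swaps the two pieces.
  ∑-shift : ∀ {n} .{{_ : NonZero n}} (f : Fin n → ℕ) {k} → k ≤ n →
            ∑[ x < n ] f ((toℕ x + k) mod n) ≡ sum f
  ∑-shift {n} f {k} k≤n = begin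
    ∑[ x < n ] g (toℕ x + k)
      ≡⟨ cong (λ N → ∑[ x < N ] g (toℕ x + k)) (sym n≡) ⟩
    ∑[ x < d + k ] g (toℕ x + k)
      ≡⟨ ∑-+ d k (λ x → g (x + k)) ⟩
    ∑[ x < d ] g (toℕ x + k) + ∑[ x < k ] g (d + toℕ x + k)
      ≡⟨ cong₂ _+_ (sum-cong-≗ {d} λ x → cong g (+-comm (toℕ x) k)) (sum-cong-≗ {k} λ x → wrap (toℕ x)) ⟩
    ∑[ x < d ] g (k + toℕ x) + ∑[ x < k ] g (toℕ x)
      ≡⟨ +-comm (∑[ x < d ] g (k + toℕ x)) _ ⟩
    ∑[ x < k ] g (toℕ x) + ∑[ x < d ] g (k + toℕ x)
      ≡⟨ ∑-+ k d g ⟨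
    ∑[ x < k + d ] g (toℕ x)
      ≡⟨ cong (λ N → ∑[ x < N ] g (toℕ x)) (m+[n∸m]≡n k≤n) ⟩
    ∑[ x < n ] g (toℕ x)
      ≡⟨ sum-cong-≗ {n} (λ x → cong f (toℕ-mod x)) ⟩
    sum f ∎
    where
    open ≡-Reasoning
    d = n ∸ k
    n≡ : d + k ≡ n
    n≡ = m∸n+n≡m k≤n
    g : ℕ → ℕ
    g i = f (i mod n)
    rearrange : ∀ d x k → d + x + k ≡ x + (d + k)
    rearrange = solve-∀
    wrap : ∀ x → g (d + x + k) ≡ g x
    wrap x = trans (cong g (trans (rearrange d x k) (cong (x +_) n≡))) (cong f (mod-periodic x n))

  -- This is (1 + δ/γ)^m ≥ 1 + mδ/γ multiplied by γ^(m+1).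
  bernoulli : ∀ γ δ m → (γ + m * δ) * γ ^ m ≤ γ * (γ + δ) ^ m
  bernoulli γ δ zero    = ≤-reflexive (lemma γ)
    where
    lemma : ∀ γ → (γ + 0) * 1 ≡ γ * 1
    lemma = solve-∀
  bernoulli γ δ (suc m) = begin
    (γ + suc m * δ) * (γ * γ ^ m)                  ≤⟨ m≤m+n _ (m * δ * δ * γ ^ m) ⟩
    (γ + suc m * δ) * (γ * γ ^ m) + m * δ * δ * γ ^ m ≡⟨ lemma γ δ m (γ ^ m) ⟩
    (γ + δ) * ((γ + m * δ) * γ ^ m)                ≤⟨ *-monoʳ-≤ (γ + δ) (bernoulli γ δ m) ⟩
    (γ + δ) * (γ * (γ + δ) ^ m)                    ≡⟨ swap (γ + δ) γ ((γ + δ) ^ m) ⟩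
    γ * ((γ + δ) * (γ + δ) ^ m)                    ∎
    where
    open ≤-Reasoning
    lemma : ∀ γ δ m p → (γ + (δ + m * δ)) * (γ * p) + m * δ * δ * p ≡ (γ + δ) * ((γ + m * δ) * p)
    lemma = solve-∀
    swap : ∀ a b c → a * (b * c) ≡ b * (a * c)
    swap = solve-∀

  -- If at most `γ` of `γ + δ` choices survive each round, at most a third of all seeds survive `m`
  -- rounds. The condition `1 ≤ m` serves `γ = 0`, where `0 ^ 0` would be 1.
  3γ^m≤[γ+δ]^m : ∀ γ δ m → 1 ≤ m → 2 * γ ≤ m * δ → 3 * γ ^ m ≤ (γ + δ) ^ m
  3γ^m≤[γ+δ]^m zero        δ (suc m) _ _       = z≤n
  3γ^m≤[γ+δ]^m γ@(suc _) δ m         _ 2γ≤mδ = *-cancelˡ-≤ γ (begin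
    γ * (3 * γ ^ m)         ≡⟨ lemma γ (γ ^ m) ⟩
    (γ + 2 * γ) * γ ^ m     ≤⟨ *-monoˡ-≤ (γ ^ m) (+-monoʳ-≤ γ 2γ≤mδ) ⟩
    (γ + m * δ) * γ ^ m     ≤⟨ bernoulli γ δ m ⟩
    γ * (γ + δ) ^ m         ∎)
    where
    open ≤-Reasoning
    lemma : ∀ γ p → γ * (3 * p) ≡ (γ + 2 * γ) * p
    lemma = solve-∀

-- Repairing a sequence along a shifted dyadic subdivision.

module Repairs where
  open import Data.Nat.Base
  open import Data.Nat.DivMod using (_%_; _/_; m%n<n; m≡m%n+[m/n]*n)
  open import Data.Nat.Properties hiding (_≟_)
  open import Relation.Binary.PropositionalEquality
  open import Algebra.Properties.Semiring.Sum +-*-semiring using (*-distribˡ-sum)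
  open Sums

  -- One of the `J + 2` blocks is the room for the shift, so at least one whole block remains after
  -- every shift below `H`.
  blocks : ∀ H .{{_ : NonZero H}} {n} → 2 * H ≤ n → ∃[ J ] ∃[ r ] r < H × n ≡ r + suc (suc J) * H
  blocks H {n} 2H≤n = d / H , d % H , m%n<n d H , (begin
    n                          ≡⟨ m∸n+n≡m 2H≤n ⟨
    d + 2 * H                  ≡⟨ cong (_+ 2 * H) (m≡m%n+[m/n]*n d H) ⟩
    d % H + d / H * H + 2 * H  ≡⟨ lemma (d % H) (d / H) H ⟩
    d % H + suc (suc (d / H)) * H ∎)
    where
    open ≡-Reasoning
    d = n ∸ 2 * H
    lemma : ∀ r j h → r + j * h + 2 * h ≡ r + (h + (h + j * h))
    lemma = solve-∀

  module Repair (em : ExcludedMiddle 0ℓ) {V : Set} {_≈_ : Rel V 0ℓ} (isDecEq : IsDecEquivalence _≈_)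
                (R : Rel V 0ℓ) (R-resp : R Respects₂ _≈_) (last : ℕ) (f : ℕ → V) where

    open IsDecEquivalence isDecEq using (_≟_) renaming (refl to ≈-refl; sym to ≈-sym; trans to ≈-trans)

    Valid : ℕ → ℕ → (ℕ → V) → Set
    Valid a b g = ∀ i → a ≤ i → i < b → R (g i) (g (suc i))

    -- The witness is valid on the whole sequence and not only between `x` and `y`. This matches the
    -- consistency test, and it lets a witness also fill the ends of the sequence.
    Good : ℕ → ℕ → Set
    Good x y = ∃[ g ] Valid 0 last g × g x ≈ f x × g y ≈ f y

    -- The interval is half-open, so that the costs of two intervals with a common endpoint add up.
    cost : ℕ → ℕ → (ℕ → V) → ℕ
    cost a k g = ∑[ i < k ] 𝟙 (does (¬? (f (a + toℕ i) ≟ g (a + toℕ i))))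

    cost-≤ : ∀ a k g → cost a k g ≤ k
    cost-≤ a k g = subst (cost a k g ≤_) (*-identityʳ k) (∑-≤-const {k} λ i → 𝟙≤1 _)

    cost-+ : ∀ a k k′ g → cost a (k + k′) g ≡ cost a k g + cost (a + k) k′ g
    cost-+ a k k′ g = trans (∑-+ k k′ (mismatch ∘ (a +_)))
      (cong (cost a k g +_) (sum-cong-≗ {k′} λ i → cong mismatch (sym (+-assoc a k (toℕ i)))))
      where
      mismatch : ℕ → ℕ
      mismatch i = 𝟙 (does (¬? (f i ≟ g i)))

    cost-cong : ∀ a k {g h} → (∀ i → a ≤ i → i < a + k → g i ≡ h i) → cost a k g ≡ cost a k h
    cost-cong a k g≡h = sum-cong-≗ {k} λ i → cong (λ v → 𝟙 (does (¬? (f (a + toℕ i) ≟ v))))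
      (g≡h (a + toℕ i) (m≤m+n a _) (+-monoʳ-< a (toℕ<n i)))

    splice : ℕ → (ℕ → V) → (ℕ → V) → ℕ → V
    splice p g h i = if does (i <? p) then g i else h i

    splice-< : ∀ {p i} g h → i < p → splice p g h i ≡ g i
    splice-< {p} {i} g h i<p rewrite dec-true (i <? p) i<p = refl

    splice-≥ : ∀ {p i} g h → p ≤ i → splice p g h i ≡ h i
    splice-≥ {p} {i} g h p≤i rewrite dec-false (i <? p) (≤⇒≯ p≤i) = refl

    -- Only the pair ending at `p` involves both sequences. It is allowed for `g`, and its second
    -- entry is replaced by the equal `h p`.
    splice-valid : ∀ {a p b} g h → Valid a p g → Valid p b h → g p ≈ h p → Valid a b (splice p g h)
    splice-valid {a} {p} {b} g h vg vh gp≈hp i a≤i i<b with <-cmp (suc i) p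
    ... | tri< si<p _ _ rewrite splice-< g h si<p | splice-< g h (<-trans (n<1+n i) si<p) =
      vg i a≤i (<-trans (n<1+n i) si<p)
    ... | tri≈ _ refl _ rewrite splice-< g h (n<1+n i) | splice-≥ g h (≤-refl {suc i}) =
      proj₁ R-resp gp≈hp (vg i a≤i (n<1+n i))
    ... | tri> _ _ p<si rewrite splice-≥ g h (<⇒≤ p<si) | splice-≥ g h (≤-pred p<si) =
      vh i (≤-pred p<si) i<b

    cost-splice : ∀ a k k′ g h → cost a (k + k′) (splice (a + k) g h) ≡ cost a k g + cost (a + k) k′ h
    cost-splice a k k′ g h = trans (cost-+ a k k′ (splice (a + k) g h)) (cong₂ _+_
      (cost-cong a k λ i _ i<a+k → splice-< g h i<a+k)
      (cost-cong (a + k) k′ λ i a+k≤i _ → splice-≥ g h a+k≤i))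

    Repairable : ℕ → ℕ → ℕ → Set
    Repairable a k c = ∃[ g ] Valid a (a + k) g × g a ≈ f a × g (a + k) ≈ f (a + k) × cost a k g ≤ c

    -- The left part has positive length so that `a` lies before the splice point and keeps the
    -- value of `g`, which agrees with `f` there.
    concatenate : ∀ {a k k′ c c′} → Repairable a (suc k) c → Repairable (a + suc k) k′ c′ →
                  Repairable a (suc k + k′) (c + c′)
    concatenate {a} {k} {k′} (g , vg , ga , gp , cg) (h , vh , hp , hb , ch) =
      splice p g h ,
      subst (λ b → Valid a b (splice p g h)) (+-assoc a (suc k) k′)
        (splice-valid g h vg vh (≈-trans gp (≈-sym hp))) ,
      subst (_≈ f a) (sym (splice-< g h (m<m+n a z<s))) ga ,
      subst (λ b → splice p g h b ≈ f b) (+-assoc a (suc k) k′)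
        (subst (_≈ f (p + k′)) (sym (splice-≥ g h (m≤m+n p k′))) hb) ,
      ≤-trans (≤-reflexive (cost-splice a (suc k) k′ g h)) (+-mono-≤ cg ch)
      where p = a + suc k

    concatenate-2^ : ∀ l {a k c c′} → Repairable a (2 ^ l) c → Repairable (a + 2 ^ l) k c′ →
                     Repairable a (2 ^ l + k) (c + c′)
    concatenate-2^ l with 2 ^ l | m^n>0 2 l
    ... | suc _ | _ = concatenate

    Good⇒Repairable : ∀ {a k} → a + k ≤ last → Good a (a + k) → Repairable a k k
    Good⇒Repairable {a} {k} ≤last (g , vg , ga , gb) =
      g , (λ i _ i<b → vg i z≤n (<-≤-trans i<b ≤last)) , ga , gb , cost-≤ a k g

    -- The only position that counts is `a`, where the witness agrees with `f`.
    Good⇒Repairable₁ : ∀ {a} → a + 1 ≤ last → Good a (a + 1) → Repairable a 1 0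
    Good⇒Repairable₁ {a} ≤last good with Good⇒Repairable ≤last good
    ... | g , vg , ga , gb , _ = g , vg , ga , gb , ≤-reflexive (trans (+-identityʳ _)
      (𝟙-no (¬? (f (a + 0) ≟ g (a + 0)))
            (λ ne → ne (subst (λ i → f i ≈ g i) (sym (+-identityʳ a)) (≈-sym ga)))))

    -- Intervals reaching beyond `last` count as 0, so starting points may range over any initial
    -- segment of the naturals.
    defect : ℕ → ℕ → ℕ
    defect l a = 𝟙 (does (em {a + 2 ^ l ≤ last × ¬ Good a (a + 2 ^ l)}))

    -- The total length of the defective intervals in the dyadic subdivision of [a , a + 2 ^ l].
    weight : ℕ → ℕ → ℕ
    weight zero    a = defect 0 a
    weight (suc l) a = 2 ^ suc l * defect (suc l) a + (weight l a + weight l (a + 2 ^ l))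

    defect≤weight : ∀ l a → 2 ^ l * defect l a ≤ weight l a
    defect≤weight zero    a = ≤-reflexive (*-identityˡ _)
    defect≤weight (suc l) a = m≤m+n _ _

    bad⇒weight : ∀ l {a} → a + 2 ^ l ≤ last → ¬ Good a (a + 2 ^ l) → 2 ^ l ≤ weight l a
    bad⇒weight l {a} ≤last bad = begin
      2 ^ l              ≡⟨ *-identityʳ _ ⟨
      2 ^ l * 1          ≡⟨ cong (2 ^ l *_) (𝟙-yes em (≤last , bad)) ⟨
      2 ^ l * defect l a ≤⟨ defect≤weight l a ⟩
      weight l a         ∎
      where open ≤-Reasoning

    2^suc : ∀ l → 2 ^ suc l ≡ 2 ^ l + 2 ^ l
    2^suc l = cong (2 ^ l +_) (+-identityʳ _)

    -- If both halves are good, their repairs are glued. Otherwise a bad half contributes at least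
    -- its length `H` to the weight, while replacing the whole interval by its witness costs at most
    -- `2 * H`; hence the factor 2.
    dyadic-repair : ∀ l a → a + 2 ^ l ≤ last → Good a (a + 2 ^ l) →
                    Repairable a (2 ^ l) (2 * weight l a)
    dyadic-repair zero a ≤last good with Good⇒Repairable₁ ≤last good
    ... | g , vg , ga , gb , cg = g , vg , ga , gb , ≤-trans cg z≤n
    dyadic-repair (suc l) a ≤last good = cases em em
      where
      open ≤-Reasoning
      H = 2 ^ l

      right≤last : (a + H) + H ≤ last
      right≤last = subst (_≤ last) (trans (cong (a +_) (2^suc l)) (sym (+-assoc a H H))) ≤last

      left≤last : a + H ≤ last
      left≤last = ≤-trans (m≤m+n (a + H) H) right≤last

      children≤weight : weight l a + weight l (a + H) ≤ weight (suc l) a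
      children≤weight = m≤n+m _ (2 ^ suc l * defect (suc l) a)

      weaken : ∀ {c} → c ≤ 2 * weight (suc l) a → Repairable a (2 ^ suc l) c →
               Repairable a (2 ^ suc l) (2 * weight (suc l) a)
      weaken c≤ (g , vg , ga , gb , cg) = g , vg , ga , gb , ≤-trans cg c≤

      replace : H ≤ weight l a + weight l (a + H) → Repairable a (2 ^ suc l) (2 * weight (suc l) a)
      replace H≤ = weaken (*-monoʳ-≤ 2 (≤-trans H≤ children≤weight)) (Good⇒Repairable ≤last good)

      cases : Dec (Good a (a + H)) → Dec (Good (a + H) (a + H + H)) →
              Repairable a (2 ^ suc l) (2 * weight (suc l) a)
      cases (no bad) _ = replace (≤-trans (bad⇒weight l left≤last bad) (m≤m+n _ _))
      cases (yes _) (no bad) = replace (≤-trans (bad⇒weight l right≤last bad) (m≤n+m _ (weight l a)))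
      cases (yes good₁) (yes good₂) =
        weaken (≤-trans (≤-reflexive (sym (*-distribˡ-+ 2 (weight l a) _))) (*-monoʳ-≤ 2 children≤weight))
          (subst (λ k → Repairable a k (2 * weight l a + 2 * weight l (a + H))) (sym (2^suc l))
            (concatenate-2^ l (dyadic-repair l a left≤last good₁)
                              (dyadic-repair l (a + H) right≤last good₂)))

    defects : ℕ → ℕ
    defects l = ∑[ x < suc last ] defect l (toℕ x)

    ∑-defect≤ : ∀ l m → ∑[ x < m ] defect l (toℕ x) ≤ defects l
    ∑-defect≤ l m = begin
      ∑[ x < m ] defect l (toℕ x)              ≤⟨ ∑-range-mono (defect l) (m≤n+m m (suc last)) ⟩
      ∑[ x < suc last + m ] defect l (toℕ x)   ≡⟨ ∑-+ (suc last) m (defect l) ⟩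
      defects l + ∑[ x < m ] defect l (suc last + toℕ x)
        ≡⟨ cong (defects l +_) (sum-cong-≗ {m} λ x → 𝟙-no em (λ (≤last , _) →
             <⇒≱ (≤-trans (s≤s (m≤m+n last (toℕ x))) (m≤m+n _ (2 ^ l))) ≤last)) ⟩
      defects l + ∑[ x < m ] 0                 ≡⟨ cong (defects l +_) (trans (∑-const m 0) (*-zeroʳ m)) ⟩
      defects l + 0                            ≡⟨ +-identityʳ _ ⟩
      defects l                                ∎
      where open ≤-Reasoning

    -- A defective interval of length 2^j appears in the subdivisions for at most 2^(l-j) starting
    -- points and weighs 2^j in each. The bound is free of `m`, so in the induction the shift of the
    -- right half by `H` is absorbed by enlarging `m`.
    ∑-weight≤ : ∀ l m → ∑[ x < m ] weight l (toℕ x) ≤ 2 ^ l * ∑[ j < suc l ] defects (toℕ j)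
    ∑-weight≤ zero    m = ≤-trans (∑-defect≤ 0 m) (≤-reflexive (lemma (defects 0)))
      where
      lemma : ∀ x → x ≡ 1 * (x + 0)
      lemma = solve-∀
    ∑-weight≤ (suc l) m = begin
      ∑[ x < m ] weight (suc l) (toℕ x)
        ≡⟨ ∑-distrib-+ {m} _ _ ⟩
      ∑[ x < m ] (2 ^ suc l * defect (suc l) (toℕ x)) + ∑[ x < m ] (weight l (toℕ x) + weight l (toℕ x + H))
        ≡⟨ cong₂ _+_ (sym (*-distribˡ-sum {m} (2 ^ suc l) _)) (∑-distrib-+ {m} _ _) ⟩
      2 ^ suc l * ∑[ x < m ] defect (suc l) (toℕ x) +
        (∑[ x < m ] weight l (toℕ x) + ∑[ x < m ] weight l (toℕ x + H))
        ≤⟨ +-mono-≤ (*-monoʳ-≤ (2 ^ suc l) (∑-defect≤ (suc l) m)) (+-mono-≤ (∑-weight≤ l m) right) ⟩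
      2 ^ suc l * defects (suc l) + (H * W + H * W)
        ≡⟨ lemma H (defects (suc l)) W ⟩
      2 ^ suc l * (W + defects (suc l))
        ≡⟨ cong (2 ^ suc l *_) (∑-suc (suc l) defects) ⟨
      2 ^ suc l * ∑[ j < suc (suc l) ] defects (toℕ j) ∎
      where
      open ≤-Reasoning
      H = 2 ^ l
      W = ∑[ j < suc l ] defects (toℕ j)
      right : ∑[ x < m ] weight l (toℕ x + H) ≤ H * W
      right = begin
        ∑[ x < m ] weight l (toℕ x + H)     ≡⟨ sum-cong-≗ {m} (λ x → cong (weight l) (+-comm (toℕ x) H)) ⟩
        ∑[ x < m ] weight l (H + toℕ x)     ≤⟨ m≤n+m _ (∑[ x < H ] weight l (toℕ x)) ⟩
        ∑[ x < H ] weight l (toℕ x) + ∑[ x < m ] weight l (H + toℕ x)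
                                             ≡⟨ ∑-+ H m (weight l) ⟨
        ∑[ x < H + m ] weight l (toℕ x)     ≤⟨ ∑-weight≤ l (H + m) ⟩
        H * W                                ∎
      lemma : ∀ h d w → (h + (h + 0)) * d + (h * w + h * w) ≡ (h + (h + 0)) * (w + d)
      lemma = solve-∀

    chain-repair : ∀ l J a → a + J * 2 ^ l ≤ last →
                   (∀ j → j < J → Good (a + j * 2 ^ l) (a + suc j * 2 ^ l)) →
                   Repairable a (J * 2 ^ l) (2 * ∑[ j < J ] weight l (a + toℕ j * 2 ^ l))
    chain-repair l zero    a _ _ =
      f , (λ i a≤i i<a+0 → contradiction (subst (i <_) (+-identityʳ a) i<a+0) (≤⇒≯ a≤i)) ,
      ≈-refl , ≈-refl , z≤n
    chain-repair l (suc J) a ≤last good =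
      subst (Repairable a (suc J * H)) cost≡ (concatenate-2^ l
        (dyadic-repair l a (≤-trans (+-monoʳ-≤ a (m≤m+n H _)) ≤last)
          (subst₂ Good (+-identityʳ a) (cong (a +_) (+-identityʳ H)) (good 0 z<s)))
        (chain-repair l J (a + H) (subst (_≤ last) (sym (+-assoc a H _)) ≤last)
          λ j j<J → subst₂ Good (sym (+-assoc a H _)) (sym (+-assoc a H _)) (good (suc j) (s<s j<J))))
      where
      H = 2 ^ l
      cost≡ : 2 * weight l a + 2 * ∑[ j < J ] weight l (a + H + toℕ j * H) ≡
              2 * (weight l (a + 0) + ∑[ j < J ] weight l (a + (H + toℕ j * H)))
      cost≡ = trans (sym (*-distribˡ-+ 2 (weight l a) _)) (cong (2 *_) (cong₂ _+_
        (cong (weight l) (sym (+-identityʳ a)))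
        (sum-cong-≗ {J} λ j → cong (weight l) (+-assoc a H _))))

    -- A witness that agrees with `f` at an end of the repaired interval continues the repair beyond
    -- that end, wherever its other point is. Every position outside is charged.
    extend : ∀ {a k c x y} → a + k ≤ last → Repairable a k c → Good x a → Good (a + k) y →
             ∃[ g ] Valid 0 last g × cost 0 (suc last) g ≤ a + (c + (suc last ∸ (a + k)))
    extend {a} {k} {c} ≤last (g , vg , ga , gb , cg) (g₀ , v₀ , _ , g₀a) (g₁ , v₁ , g₁b , _) =
      splice a g₀ h ,
      splice-valid g₀ h (λ i z i<a → v₀ i z (<-≤-trans i<a (≤-trans (m≤m+n a k) ≤last)))
        (splice-valid g g₁ vg (λ i _ i<last → v₁ i z≤n i<last) (≈-trans gb (≈-sym g₁b))) join₀ ,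
      (begin
        cost 0 (suc last) (splice a g₀ h)       ≡⟨ cong (λ m → cost 0 m (splice a g₀ h)) length≡ ⟨
        cost 0 (a + (k + r)) (splice a g₀ h)    ≡⟨ cost-splice 0 a (k + r) g₀ h ⟩
        cost 0 a g₀ + cost a (k + r) h          ≡⟨ cong (cost 0 a g₀ +_) (cost-splice a k r g g₁) ⟩
        cost 0 a g₀ + (cost a k g + cost (a + k) r g₁)
          ≤⟨ +-mono-≤ (cost-≤ 0 a g₀) (+-mono-≤ cg (cost-≤ (a + k) r g₁)) ⟩
        a + (c + r)                             ∎)
      where
      open ≤-Reasoning
      r = suc last ∸ (a + k)
      h = splice (a + k) g g₁
      length≡ : a + (k + r) ≡ suc last
      length≡ = trans (sym (+-assoc a k r)) (m+[n∸m]≡n (≤-trans ≤last (n≤1+n last)))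
      ha : h a ≈ f a
      ha with a <? a + k
      ... | yes a<a+k = subst (_≈ f a) (sym (splice-< g g₁ a<a+k)) ga
      -- The repaired interval is empty, and the value at `a` already comes from `g₁`.
      ... | no a≮a+k rewrite splice-≥ {a + k} g g₁ (≮⇒≥ a≮a+k) with refl ← n≤0⇒n≡0 (+-cancelˡ-≤ a k 0 (subst (a + k ≤_) (sym (+-identityʳ a)) (≮⇒≥ a≮a+k)))
          = subst (λ i → g₁ i ≈ f i) (+-identityʳ a) g₁b
      join₀ : g₀ a ≈ h a
      join₀ = ≈-trans g₀a (≈-sym ha)

    -- Over the `H` shifts the weights of the chains sum to less than `H * H`, so some chain has
    -- weight `W < H`. None of its blocks is bad, as a bad block alone weighs `H`. The chain costs
    -- at most `2 * W`, and the `r + H` positions outside it are fewer than `2 * H`.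
    repair : ∀ L → 2 * 2 ^ L ≤ suc last → ∑[ l < suc L ] defects (toℕ l) < 2 ^ L →
             ∃[ g ] Valid 0 last g × cost 0 (suc last) g < 4 * 2 ^ L
    repair L 2H≤n few = let
        J , r , r<H , n≡ = blocks H {{m^n≢0 2 L}} 2H≤n
        s , s<H , light  = pigeonhole H (λ s → ∑[ j < suc J ] weight L (s + toℕ j * H)) H (begin-strict
          ∑[ s < H ] ∑[ j < suc J ] weight L (toℕ s + toℕ j * H) ≡⟨ ∑-* (suc J) H (weight L) ⟨
          ∑[ x < suc J * H ] weight L (toℕ x)                    ≤⟨ ∑-weight≤ L (suc J * H) ⟩
          H * ∑[ l < suc L ] defects (toℕ l)                     <⟨ *-monoʳ-< H {{m^n≢0 2 L}} few ⟩
          H * H                                                  ∎)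
      in finish J r r<H n≡ s s<H light
      where
      open ≤-Reasoning
      H = 2 ^ L
      finish : ∀ J r → r < H → suc last ≡ r + suc (suc J) * H → ∀ s → s < H →
               ∑[ j < suc J ] weight L (s + toℕ j * H) < H →
               ∃[ g ] Valid 0 last g × cost 0 (suc last) g < 4 * H
      finish J r r<H n≡ s s<H light =
        let g , vg , cg = extend end≤last (chain-repair L (suc J) s end≤last good)
                                 (subst (Good (s + 1 * H)) (+-identityʳ s) (good-end (good 0 z<s))) (good-end (good J ≤-refl))
        in g , vg , (begin-strict
          cost 0 (suc last) g            ≤⟨ cg ⟩
          s + (2 * W + (suc last ∸ (s + k))) ≡⟨ lemma₁ s (2 * W) (suc last ∸ (s + k)) ⟩
          2 * W + (s + (suc last ∸ (s + k))) ≡⟨ cong (λ m → 2 * W + (s + m)) (∸-+-assoc′) ⟩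
          2 * W + (s + (suc last ∸ k ∸ s))   ≡⟨ cong (2 * W +_) (m+[n∸m]≡n s≤) ⟩
          2 * W + (suc last ∸ k)         ≡⟨ cong (2 * W +_) rest ⟩
          2 * W + (r + H)                <⟨ +-mono-<-≤ (*-monoʳ-< 2 light) (+-monoˡ-≤ H (<⇒≤ r<H)) ⟩
          2 * H + (H + H)                ≡⟨ lemma₂ H ⟩
          4 * H                          ∎)
        where
        k = suc J * H
        W = ∑[ j < suc J ] weight L (s + toℕ j * H)
        lemma₁ : ∀ a b c → a + (b + c) ≡ b + (a + c)
        lemma₁ = solve-∀
        lemma₂ : ∀ h → 2 * h + (h + h) ≡ 4 * h
        lemma₂ = solve-∀
        lemma₃ : ∀ r h k → r + (h + k) ≡ (r + h) + k
        lemma₃ = solve-∀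
        rest : suc last ∸ k ≡ r + H
        rest = trans (cong (_∸ k) (trans n≡ (lemma₃ r H k))) (m+n∸n≡m (r + H) k)
        s≤ : s ≤ suc last ∸ k
        s≤ = subst (s ≤_) (sym rest) (≤-trans (<⇒≤ s<H) (m≤n+m H r))
        ∸-+-assoc′ : suc last ∸ (s + k) ≡ suc last ∸ k ∸ s
        ∸-+-assoc′ = trans (cong (suc last ∸_) (+-comm s k)) (sym (∸-+-assoc (suc last) k s))
        -- The right end of the last block must itself be a position, which uses that `s < H` is
        -- strict.
        end≤last : s + suc J * H ≤ last
        end≤last = ≤-pred (begin
          suc s + suc J * H       ≤⟨ +-monoˡ-≤ (suc J * H) s<H ⟩
          suc (suc J) * H         ≤⟨ m≤n+m _ r ⟩
          r + suc (suc J) * H     ≡⟨ n≡ ⟨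
          suc last                ∎)
        block≡ : ∀ s j h → s + j * h + h ≡ s + (h + j * h)
        block≡ = solve-∀
        block≤last : ∀ j → j < suc J → s + j * H + H ≤ last
        block≤last j j<J = ≤-trans (≤-reflexive (block≡ s j H)) (≤-trans (+-monoʳ-≤ s (*-monoˡ-≤ H j<J)) end≤last)
        good : ∀ j → j < suc J → Good (s + j * H) (s + suc j * H)
        good j j<J with em {Good (s + j * H) (s + suc j * H)}
        ... | yes g  = g
        ... | no bad = contradiction
          (≤-trans (bad⇒weight L (block≤last j j<J) (bad ∘ subst (Good (s + j * H)) (block≡ s j H)))
            (subst (λ i → weight L (s + i * H) ≤ W) (toℕ-fromℕ< j<J)
              (≤-∑ {suc J} (λ i → weight L (s + toℕ i * H)) (fromℕ< j<J))))
          (<⇒≱ light)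
        good-end : ∀ {x y} → Good x y → Good y x
        good-end (g , vg , gx , gy) = g , vg , gy , gx

-- The testers as decision trees, for an arbitrary kind of answers.

module Algorithms where
  open import Data.Nat.Base
  open import Data.Nat.Properties hiding (_≟_)
  open import Relation.Binary.PropositionalEquality
  open import Algebra.Properties.Semiring.Sum +-*-semiring using (*-distribˡ-sum; *-distribʳ-sum)
  open Sums

  -- v ~ a says that the answer a does not exclude that the queried value is v.
  record Reading (V A : DecSetoid 0ℓ 0ℓ) : Set₁ where
    open DecSetoid V using () renaming (Carrier to Value; _≈_ to _≈ᵥ_)
    open DecSetoid A using () renaming (Carrier to Answer; _≈_ to _≈ₐ_)
    field
      ι       : Value → Answer
      _~_     : Value → Answer → Set
      ~-respʳ : ∀ {v a b} → a ≈ₐ b → v ~ a → v ~ b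
      ~-ι     : ∀ v → v ~ ι v
      ~ι⇒≈    : ∀ {v w} → v ~ ι w → v ≈ᵥ w

  module Testers (em : ExcludedMiddle 0ℓ) {V A : DecSetoid 0ℓ 0ℓ} (reading : Reading V A)
                 {n : ℕ} .{{n≢0 : NonZero n}} (P : Pred (Fin n → DecSetoid.Carrier V) 0ℓ) where

    open Reading reading
    open DecSetoid V using () renaming (Carrier to Value; _≈_ to _≈ᵥ_)
    open DecSetoid A using (_≈_; _≟_) renaming (Carrier to Answer; refl to ≈-refl; sym to ≈-sym; trans to ≈-trans)
    open OnlineModel A n

    ~-⇔ : ∀ {v a b} → a ≈ b → (v ~ a) ⇔ (v ~ b)
    ~-⇔ a≈b = mk⇔ (~-respʳ a≈b) (~-respʳ (≈-sym a≈b))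

    does-em : ∀ {X Y : Set} → X ⇔ Y → does (em {X}) ≡ does (em {Y})
    does-em X⇔Y = does-⇔ X⇔Y em em

    -- `Q` accumulates what the answers reveal about the input; excluded middle then decides whether
    -- some sequence with the property fits.
    exhaust : ∀ {k} → Vec (Fin n) k → Pred (Fin n → Value) 0ℓ → DecisionTree k
    exhaust []       Q = output (does (em {∃[ g ] P g × Q g}))
    exhaust (x ∷ xs) Q = query x λ a → exhaust xs λ g → Q g × g x ~ a

    exhaust-≋ : ∀ {k} (xs : Vec (Fin n) k) {Q Q′ : Pred (Fin n → Value) 0ℓ} → (∀ g → Q g ⇔ Q′ g) →
                exhaust xs Q ≋ exhaust xs Q′
    exhaust-≋ [] {Q} {Q′} Q⇔Q′ = subst (λ b → exhaust [] Q ≋ output b)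
      (does-em {∃[ g ] P g × Q g} {∃[ g ] P g × Q′ g} (mk⇔
        (λ (g , p , q) → g , p , Equivalence.to (Q⇔Q′ g) q)
        (λ (g , p , q) → g , p , Equivalence.from (Q⇔Q′ g) q)))
      (output _)
    exhaust-≋ (x ∷ xs) Q⇔Q′ = query x λ a≈b → exhaust-≋ xs λ g → mk⇔
      (λ (q , r) → Equivalence.to (Q⇔Q′ g) q , Equivalence.to (~-⇔ a≈b) r)
      (λ (q , r) → Equivalence.from (Q⇔Q′ g) q , Equivalence.from (~-⇔ a≈b) r)

    exhaust-complete : ∀ S {f : Fin n → Value} → P f → (∀ h x → length h < n → f x ~ S h x) →
                       ∀ {k} (xs : Vec (Fin n) k) {Q} h → length h + k ≤ n → Q f →
                       run (exhaust xs Q) S h ≡ true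
    exhaust-complete S {f} pf f~S [] h _ qf = dec-true em (f , pf , qf)
    exhaust-complete S {f} pf f~S {suc k} (x ∷ xs) h ≤n qf =
      exhaust-complete S pf f~S xs (x ∷ h) (subst (_≤ n) (+-suc (length h) k) ≤n)
        (qf , f~S h x (<-≤-trans (m<m+n _ z<s) ≤n))

    exhaust-sound : ∀ S {f : Fin n → Value} → (∀ h x {v} → length h < n → v ~ S h x → v ≈ᵥ f x) →
                    ∀ {k} (xs : Vec (Fin n) k) {Q} h → length h + k ≤ n →
                    run (exhaust xs Q) S h ≡ true → ∃[ g ] P g × Q g × All (λ x → g x ≈ᵥ f x) xs
    exhaust-sound S S⇒f [] {Q} h _ accepted with em {∃[ g ] P g × Q g}
    ... | yes (g , pg , qg) = g , pg , qg , []
    exhaust-sound S S⇒f {suc k} (x ∷ xs) h ≤n accepted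
      with exhaust-sound S S⇒f xs (x ∷ h) (subst (_≤ n) (+-suc (length h) k) ≤n) accepted
    ... | g , pg , (qg , gx~a) , gxs =
      g , pg , qg , S⇒f h x (<-≤-trans (m<m+n _ z<s) ≤n) gx~a ∷ gxs

    Consistent : Fin n → Fin n → Answer → Answer → Set
    Consistent x y a b = ∃[ g ] P g × g x ~ a × g y ~ b

    -- The round-based tester and the counting of its seeds.

    module Rounds (levels : ℕ) (w : ℕ → ℕ) where

      N : ℕ
      N = levels * n

      -- Wrapping around makes this a permutation at each level. A wrapped pair corresponds to no
      -- interval, but testing its consistency is still legitimate.
      partner : ℕ → Fin n → Fin n
      partner l x = (toℕ x + 2 ^ l) mod n

      pair : Fin levels × Fin n → Fin n × Fin n
      pair (l , x) = x , partner (toℕ l) x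

      -- Dummy queries let the adversary's clock advance; their answers are ignored.
      wait : ∀ {q} k → DecisionTree q → DecisionTree (k + q)
      wait zero    T = T
      wait (suc k) T = query (0 mod n) λ _ → wait k T

      test : ∀ {q} → Fin n × Fin n → DecisionTree q → DecisionTree (2 + q)
      test (x , y) T = query x λ a → query y λ b →
        if does (em {Consistent x y a b}) then T else output false

      -- The offset `i` is needed because the waits depend on how many queries came before. They
      -- depend on neither coins nor answers, so this number is fixed in advance.
      queries : ℕ → ℕ → ℕ
      queries zero    i = 0
      queries (suc m) i = w i + (2 + queries m (2 + (w i + i)))

      -- m rounds, after i earlier queries; each round consumes one digit of the seed.
      rounds : ∀ m i → Fin (N ^ m) → DecisionTree (queries m i)
      rounds zero    i s = output true
      rounds (suc m) i s = let c , s′ = remQuot (N ^ m) s in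
        wait (w i) (test (pair (remQuot n c)) (rounds m _ s′))

      wait-≋ : ∀ {q} k {T T′ : DecisionTree q} → T ≋ T′ → wait k T ≋ wait k T′
      wait-≋ zero    T≋T′ = T≋T′
      wait-≋ (suc k) T≋T′ = query _ λ _ → wait-≋ k T≋T′

      test-≋ : ∀ {q} p {T : DecisionTree q} → T ≋ T → test p T ≋ test p T
      test-≋ (x , y) {T} T≋T = query x λ {a} {a′} a≈a′ → query y λ {b} {b′} b≈b′ →
        subst (λ c → (if does (em {Consistent x y a b}) then T else output false) ≋
                     (if c then T else output false))
              (does-em {Consistent x y a b} {Consistent x y a′ b′} (mk⇔
                (λ (g , p , r , r′) → g , p , ~-respʳ a≈a′ r , ~-respʳ b≈b′ r′)
                (λ (g , p , r , r′) → g , p , ~-respʳ (≈-sym a≈a′) r , ~-respʳ (≈-sym b≈b′) r′)))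
              (branch (does (em {Consistent x y a b})))
        where
        branch : ∀ c → (if c then T else output false) ≋ (if c then T else output false)
        branch true  = T≋T
        branch false = output false

      rounds-≋ : ∀ m i s → rounds m i s ≋ rounds m i s
      rounds-≋ zero    i s = output true
      rounds-≋ (suc m) i s = wait-≋ (w i) (test-≋ _ (rounds-≋ m _ _))

      queries≤ : ∀ r → (∀ i → w i < r) → ∀ m i → queries m i ≤ m * suc r
      queries≤ r w<r zero    i = z≤n
      queries≤ r w<r (suc m) i = begin
        w i + (2 + queries m _)     ≡⟨ lemma (w i) (queries m _) ⟩
        suc (suc (w i)) + queries m _ ≤⟨ +-mono-≤ (s≤s (w<r i)) (queries≤ r w<r m _) ⟩
        suc r + m * suc r           ∎
        where
        open ≤-Reasoning
        lemma : ∀ a b → a + (2 + b) ≡ 2 + a + b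
        lemma = solve-∀

      module _ (S : Strategy) where

        waited : ℕ → List (Fin n) → List (Fin n)
        waited zero    h = h
        waited (suc k) h = waited k (0 mod n ∷ h)

        length-waited : ∀ k h → length (waited k h) ≡ k + length h
        length-waited zero    h = refl
        length-waited (suc k) h = trans (length-waited k _) (+-suc k (length h))

        run-wait : ∀ {q} k (T : DecisionTree q) h → run (wait k T) S h ≡ run T S (waited k h)
        run-wait zero    T h = refl
        run-wait (suc k) T h = run-wait k T _

        Passes : List (Fin n) → Fin n × Fin n → Set
        Passes h (x , y) = Consistent x y (S h x) (S (x ∷ h) y)

        passes : List (Fin n) → Fin n × Fin n → Bool
        passes h p = does (em {Passes h p})

        after : Fin n × Fin n → List (Fin n) → List (Fin n)
        after (x , y) h = y ∷ x ∷ h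

        run-test : ∀ {q} p (T : DecisionTree q) h →
                   run (test p T) S h ≡ (if passes h p then run T S (after p h) else false)
        run-test (x , y) T h with em {Passes h (x , y)}
        ... | yes _ = refl
        ... | no  _ = refl

        count : ∀ m i → List (Fin n) → Bool → ℕ
        count m i h b = ∑[ s < N ^ m ] 𝟙 (does (run (rounds m i s) S h Bool.≟ b))

        count-suc : ∀ m i h b → let h′ = waited (w i) h in
          count (suc m) i h b ≡ ∑[ l < levels ] ∑[ x < n ] ∑[ s < N ^ m ]
            𝟙 (does ((if passes h′ (pair (l , x)) then run (rounds m _ s) S (after (pair (l , x)) h′) else false)
                     Bool.≟ b))
        count-suc m i h b = begin
          count (suc m) i h b
            ≡⟨ sum-cong-≗ (λ s → cong (λ r → 𝟙 (does (r Bool.≟ b)))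
                 (trans (run-wait (w i) _ h) (run-test _ (rounds m _ (proj₂ (remQuot {N} (N ^ m) s))) _))) ⟩
          ∑[ s < N * N ^ m ] G (remQuot (N ^ m) s)
            ≡⟨ ∑-remQuot N (N ^ m) G ⟩
          ∑[ c < N ] ∑[ s < N ^ m ] G (c , s)
            ≡⟨ ∑-remQuot levels n (λ p → ∑[ s < N ^ m ] F p s) ⟩
          ∑[ l < levels ] ∑[ x < n ] ∑[ s < N ^ m ] F (l , x) s ∎
          where
          open ≡-Reasoning
          F : Fin levels × Fin n → Fin (N ^ m) → ℕ
          F p s = 𝟙 (does ((if passes (waited (w i) h) (pair p)
                            then run (rounds m _ s) S (after (pair p) (waited (w i) h)) else false) Bool.≟ b))
          G : Fin N × Fin (N ^ m) → ℕ
          G (c , s) = F (remQuot n c) s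

        -- The histories after which the two queries of a round are made.
        TestTime : ℕ → List (Fin n) → Set
        TestTime q h = (∃[ i ] length h ≡ w i + i) × length h ≤ q

        passing : List (Fin n) → ℕ
        passing h = ∑[ l < levels ] ∑[ x < n ] 𝟙 (passes h (pair (l , x)))

        failing : List (Fin n) → ℕ
        failing h = ∑[ l < levels ] ∑[ x < n ] 𝟙 (not (passes h (pair (l , x))))

        testTime : ∀ {q} m i h → length h ≡ i → queries (suc m) i + i ≤ q → TestTime q (waited (w i) h)
        testTime {q} m i h refl ≤q = (i , length-waited (w i) h) , (begin
          length (waited (w i) h)       ≡⟨ length-waited (w i) h ⟩
          w i + i                       ≤⟨ +-monoˡ-≤ i (m≤m+n (w i) _) ⟩
          queries (suc m) i + i         ≤⟨ ≤q ⟩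
          q                             ∎)
          where open ≤-Reasoning

        later : ∀ m i {q} → queries (suc m) i + i ≤ q →
                queries m (2 + (w i + i)) + (2 + (w i + i)) ≤ q
        later m i {q} = subst (_≤ q) (lemma (w i) (queries m (2 + (w i + i))) i)
          where
          lemma : ∀ a b i → a + (2 + b) + i ≡ b + (2 + (a + i))
          lemma = solve-∀

        -- The history is arbitrary in the induction: the adversary may react to earlier pairs, but
        -- the digit of the next round is independent of the history. A seed survives the round for
        -- at most `γ` pairs, whatever the oracle has become.
        accepting≤ : ∀ {q γ} → (∀ h → TestTime q h → passing h ≤ γ) →
                     ∀ m i h → length h ≡ i → queries m i + i ≤ q → count m i h true ≤ γ ^ m
        accepting≤ passing≤ zero i h _ _ = ≤-refl
        accepting≤ {γ = γ} passing≤ (suc m) i h h≡i ≤q = begin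
          count (suc m) i h true
            ≡⟨ count-suc m i h true ⟩
          ∑[ l < levels ] ∑[ x < n ] ∑[ s < N ^ m ] _
            ≤⟨ ∑-mono {levels} (λ l → ∑-mono {n} λ x → bound (pair (l , x))) ⟩
          ∑[ l < levels ] ∑[ x < n ] (𝟙 (passes h′ (pair (l , x))) * γ ^ m)
            ≡⟨ sum-cong-≗ {levels} (λ l → *-distribʳ-sum {n} (γ ^ m) _) ⟨
          ∑[ l < levels ] (∑[ x < n ] 𝟙 (passes h′ (pair (l , x))) * γ ^ m)
            ≡⟨ *-distribʳ-sum {levels} (γ ^ m) _ ⟨
          passing h′ * γ ^ m
            ≤⟨ *-monoˡ-≤ (γ ^ m) (passing≤ h′ (testTime m i h h≡i ≤q)) ⟩
          γ * γ ^ m ∎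
          where
          open ≤-Reasoning
          h′ = waited (w i) h
          bound : ∀ p → ∑[ s < N ^ m ] 𝟙 (does ((if passes h′ p then run (rounds m _ s) S (after p h′) else false)
                                                Bool.≟ true)) ≤ 𝟙 (passes h′ p) * γ ^ m
          bound p with passes h′ p
          ... | true  = ≤-trans
            (accepting≤ passing≤ m _ (after p h′)
              (cong (2 +_) (trans (length-waited (w i) h) (cong (w i +_) h≡i))) (later m i ≤q))
            (≤-reflexive (sym (+-identityʳ _)))
          ... | false = ≤-reflexive (trans (∑-const (N ^ m) 0) (*-zeroʳ (N ^ m)))

        -- A union bound: each of the `m` rounds rejects with probability at most κ/N. The factor
        -- `N` on the left clears the denominator.
        rejecting≤ : ∀ {q κ} → (∀ h → TestTime q h → failing h ≤ κ) →
                     ∀ m i h → length h ≡ i → queries m i + i ≤ q → N * count m i h false ≤ m * κ * N ^ m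
        rejecting≤ failing≤ zero i h _ _ = ≤-reflexive (*-zeroʳ N)
        rejecting≤ {κ = κ} failing≤ (suc m) i h h≡i ≤q = begin
          N * count (suc m) i h false
            ≡⟨ cong (N *_) (count-suc m i h false) ⟩
          N * ∑[ l < levels ] ∑[ x < n ] ∑[ s < N ^ m ] _
            ≡⟨ *-distribˡ-sum {levels} N _ ⟩
          ∑[ l < levels ] (N * ∑[ x < n ] ∑[ s < N ^ m ] _)
            ≡⟨ sum-cong-≗ {levels} (λ l → *-distribˡ-sum {n} N _) ⟩
          ∑[ l < levels ] ∑[ x < n ] (N * ∑[ s < N ^ m ] _)
            ≤⟨ ∑-mono {levels} (λ l → ∑-mono {n} λ x → bound (pair (l , x))) ⟩
          ∑[ l < levels ] ∑[ x < n ] (𝟙 (not (passes h′ (pair (l , x)))) * (N * N ^ m) + m * κ * N ^ m)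
            ≡⟨ sum-cong-≗ {levels} (λ l → trans (∑-distrib-+ {n} _ _)
                 (cong₂ _+_ (sym (*-distribʳ-sum {n} (N * N ^ m) _)) (∑-const n _))) ⟩
          ∑[ l < levels ] (∑[ x < n ] 𝟙 (not (passes h′ (pair (l , x)))) * (N * N ^ m) + n * (m * κ * N ^ m))
            ≡⟨ trans (∑-distrib-+ {levels} _ _)
                 (cong₂ _+_ (sym (*-distribʳ-sum {levels} (N * N ^ m) _)) (∑-const levels _)) ⟩
          failing h′ * (N * N ^ m) + levels * (n * (m * κ * N ^ m))
            ≤⟨ +-monoˡ-≤ _ (*-monoˡ-≤ (N * N ^ m) (failing≤ h′ (testTime m i h h≡i ≤q))) ⟩
          κ * (N * N ^ m) + levels * (n * (m * κ * N ^ m))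
            ≡⟨ lemma κ levels n m (N ^ m) ⟩
          suc m * κ * (N * N ^ m) ∎
          where
          open ≤-Reasoning
          h′ = waited (w i) h
          lemma : ∀ κ l n m p → κ * (l * n * p) + l * (n * (m * κ * p)) ≡ (κ + m * κ) * (l * n * p)
          lemma = solve-∀
          bound : ∀ p → N * ∑[ s < N ^ m ] 𝟙 (does ((if passes h′ p then run (rounds m _ s) S (after p h′) else false)
                                                    Bool.≟ false)) ≤ 𝟙 (not (passes h′ p)) * (N * N ^ m) + m * κ * N ^ m
          bound p with passes h′ p
          ... | true  = rejecting≤ failing≤ m _ (after p h′)
              (cong (2 +_) (trans (length-waited (w i) h) (cong (w i +_) h≡i))) (later m i ≤q)
          ... | false = ≤-trans
            (≤-reflexive (cong (N *_) (trans (∑-const (N ^ m) 1) (*-identityʳ (N ^ m)))))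
            (≤-trans (≤-reflexive (sym (+-identityʳ (N * N ^ m)))) (m≤m+n (1 * (N * N ^ m)) _))

        run-rounds-true : ∀ {f : Fin n → Value} → P f → (∀ h x → f x ~ S h x) → ∀ m i s h → run (rounds m i s) S h ≡ true
        run-rounds-true pf f~S zero    i s h = refl
        run-rounds-true {f} pf f~S (suc m) i s h = let c , s′ = remQuot (N ^ m) s
                                                       p = pair (remQuot n c)
                                                       h′ = waited (w i) h in
          trans (run-wait (w i) _ h) (trans (run-test p (rounds m _ s′) h′)
            (trans (cong (if_then run (rounds m _ s′) S (after p h′) else false)
                         (dec-true em (f , pf , f~S h′ _ , f~S _ _)))
                   (run-rounds-true pf f~S m _ s′ (after p h′))))

    Dist≡0⇒≈ : ∀ {g g′} → Dist g g′ ≡ 0 → ∀ x → g x ≈ g′ x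
    Dist≡0⇒≈ {g} {g′} d≡0 x with g x ≟ g′ x in eq
    ... | yes gx≈g′x = gx≈g′x
    ... | no  gx≉g′x = contradiction
      (subst₂ _≤_ (𝟙-yes (¬? (g x ≟ g′ x)) gx≉g′x) (trans (sym (countFin≡∑ (λ x → ¬? (g x ≟ g′ x)))) d≡0)
        (≤-∑ (λ x → 𝟙 (does (¬? (g x ≟ g′ x)))) x)) λ ()

    Dist-triangle : ∀ f g h → Dist f h ≤ Dist f g + Dist g h
    Dist-triangle f g h = begin
      Dist f h                   ≡⟨ countFin≡∑ (λ x → ¬? (f x ≟ h x)) ⟩
      ∑[ x < n ] 𝟙 (does (¬? (f x ≟ h x)))
        ≤⟨ ∑-mono {n} (λ x → pointwise (f x ≟ g x) (g x ≟ h x) (f x ≟ h x)) ⟩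
      ∑[ x < n ] (𝟙 (does (¬? (f x ≟ g x))) + 𝟙 (does (¬? (g x ≟ h x))))
                                 ≡⟨ ∑-distrib-+ {n} _ _ ⟩
      ∑[ x < n ] 𝟙 (does (¬? (f x ≟ g x))) + ∑[ x < n ] 𝟙 (does (¬? (g x ≟ h x)))
                                 ≡⟨ cong₂ _+_ (countFin≡∑ (λ x → ¬? (f x ≟ g x))) (countFin≡∑ (λ x → ¬? (g x ≟ h x))) ⟨
      Dist f g + Dist g h        ∎
      where
      open ≤-Reasoning
      pointwise : ∀ {a b c} (ab : Dec (a ≈ b)) (bc : Dec (b ≈ c)) (ac : Dec (a ≈ c)) →
                  𝟙 (does (¬? ac)) ≤ 𝟙 (does (¬? ab)) + 𝟙 (does (¬? bc))
      pointwise _         _         (yes _)  = z≤n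
      pointwise (yes a≈b) (yes b≈c) (no a≉c) = contradiction (≈-trans a≈b b≈c) a≉c
      pointwise (yes _)   (no _)    (no _)   = ≤-refl
      pointwise (no _)    _         (no _)   = s≤s z≤n

    -- For `t < 1` consecutive floors of multiples of `t` differ by at most 1, so the number of
    -- wrong positions is at most the number of queries.
    record Slow (f : Fin n → Value) (S : Strategy) : Set where
      field
        start : ∀ x → S [] x ≈ ι (f x)
        step  : ∀ h x → Dist (S h) (S (x ∷ h)) ≤ 1

      corrupted : List (Fin n) → ℕ
      corrupted h = Dist (S h) (ι ∘ f)

      corrupted≤length : ∀ h → corrupted h ≤ length h
      corrupted≤length []      = ≤-reflexive (trans (countFin≡∑ (λ x → ¬? (S [] x ≟ ι (f x))))
        (trans (sum-cong-≗ {n} λ x → 𝟙-no (¬? (S [] x ≟ ι (f x))) (λ ne → ne (start x)))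
               (trans (∑-const n 0) (*-zeroʳ n))))
      corrupted≤length (x ∷ h) = begin
        corrupted (x ∷ h)                    ≤⟨ Dist-triangle (S (x ∷ h)) (S h) (ι ∘ f) ⟩
        Dist (S (x ∷ h)) (S h) + corrupted h ≡⟨ cong (_+ corrupted h) Dist-sym ⟩
        Dist (S h) (S (x ∷ h)) + corrupted h ≤⟨ +-mono-≤ (step h x) (corrupted≤length h) ⟩
        suc (length h)                       ∎
        where
        open ≤-Reasoning
        Dist-sym : Dist (S (x ∷ h)) (S h) ≡ Dist (S h) (S (x ∷ h))
        Dist-sym = trans (countFin≡∑ (λ y → ¬? (S (x ∷ h) y ≟ S h y)))
          (trans (sum-cong-≗ {n} λ y → cong (𝟙 ∘ not) (does-⇔ (mk⇔ ≈-sym ≈-sym) (S (x ∷ h) y ≟ S h y) (S h y ≟ S (x ∷ h) y)))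
                 (sym (countFin≡∑ (λ y → ¬? (S h y ≟ S (x ∷ h) y)))))

    2/3≤ : ∀ N .{{_ : NonZero N}} {a b} → a + b ≡ N → 3 * b ≤ N → (ℤ.+ 2 ℚᵘ./ 3) ℚᵘ.≤ (ℤ.+ a ℚᵘ./ N)
    2/3≤ N@(suc _) {a} {b} a+b≡N 3b≤N = ℚᵘ.*≤* (subst₂ ℤ._≤_ (pos-* 2 N) (pos-* a 3)
      (ℤ.+≤+ (+-cancelʳ-≤ (3 * b) (2 * N) (a * 3) (begin
        2 * N + 3 * b         ≤⟨ +-monoʳ-≤ (2 * N) 3b≤N ⟩
        2 * N + N             ≡⟨ cong (λ m → 2 * m + m) a+b≡N ⟨
        2 * (a + b) + (a + b) ≡⟨ lemma a b ⟩
        a * 3 + 3 * b         ∎))))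
      where
      open ≤-Reasoning
      lemma : ∀ a b → 2 * (a + b) + (a + b) ≡ a * 3 + 3 * b
      lemma = solve-∀

    -- Error bounds against a slow adversary that is still at the test moments.

    module RoundsAnalysis (levels : ℕ) (w : ℕ → ℕ) (2^≤n : ∀ {l} → l < levels → 2 ^ l ≤ n)
                          {f : Fin n → Value} {S : Strategy} (slow : Slow f S)
                          (still : ∀ i h x → length h ≡ w i + i → Dist (S h) (S (x ∷ h)) ≡ 0) where

      open Rounds levels w
      open Slow slow

      Bad : ℕ → Fin n → Set
      Bad l x = ¬ (∃[ g ] P g × g x ≈ᵥ f x × g (partner l x) ≈ᵥ f (partner l x))

      badPairs : ℕ
      badPairs = ∑[ l < levels ] ∑[ x < n ] 𝟙 (does (em {Bad (toℕ l) x}))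

      wrong : List (Fin n) → Fin n → ℕ
      wrong h x = 𝟙 (does (¬? (S h x ≟ ι (f x))))

      -- At each level a manipulated position belongs to two pairs, once as the first and once as
      -- the second position, because taking partners is a cyclic shift.
      wrong-pairs≤ : ∀ h → ∑[ l < levels ] ∑[ x < n ] (wrong h x + wrong h (partner (toℕ l) x)) ≤ levels * (2 * length h)
      wrong-pairs≤ h = ∑-≤-const {levels} λ l → begin
        ∑[ x < n ] (wrong h x + wrong h (partner (toℕ l) x))
          ≡⟨ ∑-distrib-+ {n} _ _ ⟩
        ∑[ x < n ] wrong h x + ∑[ x < n ] wrong h (partner (toℕ l) x)
          ≡⟨ cong (∑[ x < n ] wrong h x +_) (∑-shift (wrong h) (2^≤n (toℕ<n l))) ⟩
        ∑[ x < n ] wrong h x + ∑[ x < n ] wrong h x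
          ≡⟨ cong₂ _+_ (sym (countFin≡∑ (λ x → ¬? (S h x ≟ ι (f x))))) (sym (countFin≡∑ (λ x → ¬? (S h x ≟ ι (f x))))) ⟩
        corrupted h + corrupted h
          ≤⟨ +-mono-≤ (corrupted≤length h) (corrupted≤length h) ⟩
        length h + length h
          ≡⟨ cong (length h +_) (+-identityʳ (length h)) ⟨
        2 * length h ∎
        where open ≤-Reasoning

      -- The second query of a pair meets the next oracle. At a test moment `still` makes it agree
      -- with the current one, so one history accounts for both answers.
      answers-correct : ∀ {q h} → TestTime S q h → ∀ {x y} → S h y ≈ ι (f y) →
                        S (x ∷ h) y ≈ ι (f y)
      answers-correct {h = h} ((i , h≡) , _) {x} {y} Shy≈ =
        ≈-trans (≈-sym (Dist≡0⇒≈ (still i h x h≡) y)) Shy≈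

      failing≤ : P f → ∀ {q} h → TestTime S q h → failing S h ≤ levels * (2 * q)
      failing≤ pf {q} h time@(_ , h≤q) = begin
        failing S h
          ≤⟨ ∑-mono {levels} (λ l → ∑-mono {n} λ x → bound x (partner (toℕ l) x)) ⟩
        ∑[ l < levels ] ∑[ x < n ] (wrong h x + wrong h (partner (toℕ l) x))
          ≤⟨ wrong-pairs≤ h ⟩
        levels * (2 * length h)
          ≤⟨ *-monoʳ-≤ levels (*-monoʳ-≤ 2 h≤q) ⟩
        levels * (2 * q) ∎
        where
        open ≤-Reasoning
        bound : ∀ x y → 𝟙 (not (passes S h (x , y))) ≤ wrong h x + wrong h y
        bound x y with S h x ≟ ι (f x) | S h y ≟ ι (f y) | em {Passes S h (x , y)}
        ... | _      | _      | yes _  = z≤n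
        ... | no _   | _      | no _   = s≤s z≤n
        ... | yes _  | no _   | no _   = s≤s z≤n
        ... | yes px | yes py | no ¬passes = contradiction
          (f , pf , ~-respʳ (≈-sym px) (~-ι (f x)) , ~-respʳ (≈-sym (answers-correct time py)) (~-ι (f y))) ¬passes

      -- A pair that is bad and nevertheless passes has a wrong position, since two correct answers
      -- would turn the sequence found by the test into a witness that the pair is not bad.
      passing≤ : ∀ {q} h → TestTime S q h → passing S h + badPairs ≤ N + levels * (2 * q)
      passing≤ {q} h time@(_ , h≤q) = begin
        passing S h + badPairs
          ≡⟨ ∑∑-+ (λ l x → 𝟙 (passes S h (pair (l , x)))) (λ l x → 𝟙 (does (em {Bad (toℕ l) x}))) ⟨
        ∑[ l < levels ] ∑[ x < n ] (𝟙 (passes S h (pair (l , x))) + 𝟙 (does (em {Bad (toℕ l) x})))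
          ≤⟨ ∑-mono {levels} (λ l → ∑-mono {n} λ x → bound (toℕ l) x) ⟩
        ∑[ l < levels ] ∑[ x < n ] (1 + (wrong h x + wrong h (partner (toℕ l) x)))
          ≡⟨ ∑∑-+ (λ _ _ → 1) (λ l x → wrong h x + wrong h (partner (toℕ l) x)) ⟩
        ∑[ l < levels ] ∑[ x < n ] 1 + ∑[ l < levels ] ∑[ x < n ] (wrong h x + wrong h (partner (toℕ l) x))
          ≤⟨ +-mono-≤ (≤-reflexive ones) (≤-trans (wrong-pairs≤ h) (*-monoʳ-≤ levels (*-monoʳ-≤ 2 h≤q))) ⟩
        N + levels * (2 * q) ∎
        where
        open ≤-Reasoning
        ones : ∑[ l < levels ] ∑[ x < n ] 1 ≡ N
        ones = trans (∑-const levels _) (cong (levels *_) (trans (∑-const n 1) (*-identityʳ n)))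
        ∑∑-+ : ∀ (F G : Fin levels → Fin n → ℕ) → ∑[ l < levels ] ∑[ x < n ] (F l x + G l x) ≡
               ∑[ l < levels ] ∑[ x < n ] F l x + ∑[ l < levels ] ∑[ x < n ] G l x
        ∑∑-+ F G = trans (sum-cong-≗ {levels} λ l → ∑-distrib-+ {n} (F l) (G l)) (∑-distrib-+ {levels} _ _)
        bound : ∀ l x → 𝟙 (passes S h (x , partner l x)) + 𝟙 (does (em {Bad l x})) ≤
                        1 + (wrong h x + wrong h (partner l x))
        bound l x with S h x ≟ ι (f x) | S h (partner l x) ≟ ι (f (partner l x))
                     | em {Passes S h (x , partner l x)} | em {Bad l x}
        ... | _      | _      | no _  | yes _ = s≤s z≤n
        ... | _      | _      | no _  | no _  = z≤n
        ... | _      | _      | yes _ | no _  = s≤s z≤n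
        ... | no _   | _      | yes _ | yes _ = s≤s (s≤s z≤n)
        ... | yes _  | no _   | yes _ | yes _ = s≤s (s≤s z≤n)
        ... | yes px | yes py | yes (g , pg , gx , gy) | yes bad = contradiction
          (g , pg , ~ι⇒≈ (~-respʳ px gx) , ~ι⇒≈ (~-respʳ (answers-correct time py) gy)) bad

      module _ (m : ℕ) where

        q κ : ℕ
        q = queries m 0
        κ = levels * (2 * q)

        count-outcomes : count S m 0 [] true + count S m 0 [] false ≡ N ^ m
        count-outcomes = begin
          count S m 0 [] true + count S m 0 [] false
            ≡⟨ ∑-distrib-+ {N ^ m} _ _ ⟨
          ∑[ s < N ^ m ] (𝟙 (does (run (rounds m 0 s) S [] Bool.≟ true)) + 𝟙 (does (run (rounds m 0 s) S [] Bool.≟ false)))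
            ≡⟨ sum-cong-≗ (λ s → either (run (rounds m 0 s) S [])) ⟩
          ∑[ s < N ^ m ] 1
            ≡⟨ trans (∑-const (N ^ m) 1) (*-identityʳ (N ^ m)) ⟩
          N ^ m ∎
          where
          open ≡-Reasoning
          either : ∀ b → 𝟙 (does (b Bool.≟ true)) + 𝟙 (does (b Bool.≟ false)) ≡ 1
          either true  = refl
          either false = refl

        rejecting-third : .{{_ : NonZero N}} → P f → 3 * (m * κ) ≤ N → 3 * count S m 0 [] false ≤ N ^ m
        rejecting-third pf small = *-cancelˡ-≤ N (begin
          N * (3 * count S m 0 [] false)  ≡⟨ lemma₁ N (count S m 0 [] false) ⟩
          3 * (N * count S m 0 [] false)  ≤⟨ *-monoʳ-≤ 3 (rejecting≤ S (failing≤ pf) m 0 [] refl (≤-reflexive (+-identityʳ q))) ⟩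
          3 * (m * κ * N ^ m)             ≡⟨ *-assoc 3 (m * κ) (N ^ m) ⟨
          3 * (m * κ) * N ^ m             ≤⟨ *-monoˡ-≤ (N ^ m) small ⟩
          N * N ^ m                       ∎)
          where
          open ≤-Reasoning
          lemma₁ : ∀ a b → a * (3 * b) ≡ 3 * (a * b)
          lemma₁ = solve-∀

        accepting-third : .{{_ : NonZero N}} → ∀ H → H ≤ N → H ≤ badPairs → 2 * κ ≤ H → 4 * N ≤ m * H →
                          3 * count S m 0 [] true ≤ N ^ m
        accepting-third H H≤N H≤bad 2κ≤H 4N≤mH = begin
          3 * count S m 0 [] true
            ≤⟨ *-monoʳ-≤ 3 (accepting≤ S passing≤γ m 0 [] refl (≤-reflexive (+-identityʳ q))) ⟩
          3 * γ ^ m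
            ≤⟨ 3γ^m≤[γ+δ]^m γ δ m 1≤m 2γ≤mδ ⟩
          (γ + δ) ^ m
            ≡⟨ cong (_^ m) γ+δ≡N ⟩
          N ^ m ∎
          where
          open ≤-Reasoning
          -- At least this many pairs fail in each round: `H` bad ones, less those spoiled. It is at
          -- least `H / 2` because `2 * κ ≤ H`.
          δ = H ∸ κ
          γ = N ∸ δ
          κ≤H : κ ≤ H
          κ≤H = ≤-trans (m≤m+n κ _) 2κ≤H
          γ+δ≡N : γ + δ ≡ N
          γ+δ≡N = m∸n+n≡m (≤-trans (m∸n≤m H κ) H≤N)
          1≤m : 1 ≤ m
          1≤m = n≢0⇒n>0 λ { refl → contradiction 4N≤mH (<⇒≱ (<-≤-trans (>-nonZero⁻¹ N) (m≤m+n N _))) }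
          H≤2δ : H ≤ 2 * δ
          H≤2δ = +-cancelʳ-≤ (2 * κ) H (2 * δ) (begin
            H + 2 * κ      ≤⟨ +-monoʳ-≤ H 2κ≤H ⟩
            H + H          ≡⟨ cong₂ _+_ (m∸n+n≡m κ≤H) (m∸n+n≡m κ≤H) ⟨
            δ + κ + (δ + κ) ≡⟨ lemma δ κ ⟩
            2 * δ + 2 * κ  ∎)
            where
            lemma : ∀ a b → a + b + (a + b) ≡ 2 * a + 2 * b
            lemma = solve-∀
          2γ≤mδ : 2 * γ ≤ m * δ
          2γ≤mδ = *-cancelˡ-≤ 2 (begin
            2 * (2 * γ)   ≤⟨ *-monoʳ-≤ 2 (*-monoʳ-≤ 2 (m∸n≤m N δ)) ⟩
            2 * (2 * N)   ≡⟨ *-assoc 2 2 N ⟨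
            4 * N         ≤⟨ 4N≤mH ⟩
            m * H         ≤⟨ *-monoʳ-≤ m H≤2δ ⟩
            m * (2 * δ)   ≡⟨ lemma m δ ⟩
            2 * (m * δ)   ∎)
            where
            lemma : ∀ m d → m * (2 * d) ≡ 2 * (m * d)
            lemma = solve-∀
          passing≤γ : ∀ h → TestTime S q h → passing S h ≤ γ
          passing≤γ h time = +-cancelʳ-≤ H (passing S h) γ (begin
            passing S h + H        ≤⟨ +-monoʳ-≤ (passing S h) H≤bad ⟩
            passing S h + badPairs ≤⟨ passing≤ h time ⟩
            N + κ                  ≡⟨ cong (_+ κ) γ+δ≡N ⟨
            γ + δ + κ              ≡⟨ +-assoc γ δ κ ⟩
            γ + (δ + κ)            ≡⟨ cong (γ +_) (m∸n+n≡m κ≤H) ⟩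
            γ + H                  ∎)

open Sums
open Repairs
open Algorithms

threshold : ∀ {P : Pred ℕ 0ℓ} → Decidable P → ∀ m → ¬ P 0 → P m → ∃[ k ] (¬ P k × P (suc k))
threshold P? zero    ¬p0 pm = contradiction pm ¬p0
threshold P? (suc m) ¬p0 pm with P? m
... | yes p = threshold P? m ¬p0 p
... | no ¬p = m , ¬p , pm

n<2^n : ∀ n → n ℕ.< 2 ℕ.^ n
n<2^n zero    = ℕ.z<s
n<2^n (suc n) = begin-strict
  suc n                      <⟨ ℕ.s<s (n<2^n n) ⟩
  suc (2 ℕ.^ n)              ≤⟨ ℕ.+-monoˡ-≤ (2 ℕ.^ n) (ℕ.m^n>0 2 n) ⟩
  2 ℕ.^ n ℕ.+ 2 ℕ.^ n        ≡⟨ ≡.cong (2 ℕ.^ n ℕ.+_) (ℕ.+-identityʳ _) ⟨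
  2 ℕ.^ suc n                ∎
  where open ℕ.≤-Reasoning

-- Ordered-field arithmetic, logarithms and floors.

module Reals (em : ExcludedMiddle 0ℓ) (ℝ : RealNumbers) where
  open RealNumbers ℝ

  strictTotalOrder : StrictTotalOrder 0ℓ 0ℓ 0ℓ
  strictTotalOrder = record { isStrictTotalOrder = isStrictTotalOrder }

  open StrictTotalOrder strictTotalOrder public
    using (compare; strictPartialOrder) renaming (irrefl to <-irrefl; trans to <-trans)
  open ToNonStrict _≈_ _<_ using (<⇒≤)
  open import Relation.Binary.Properties.StrictTotalOrder strictTotalOrder using ()
    renaming (refl to ≤-refl; trans to ≤-trans; reflexive to ≤-reflexive)
  open import Relation.Binary.Reasoning.StrictPartialOrder strictPartialOrder
  open import Algebra.Solver.Ring.NaturalCoefficients.Default commutativeSemiring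
    using (solve; con; _:+_; _:*_; _:=_)
  import Algebra.Properties.Monoid.Mult +-monoid as Mult
  import Algebra.Properties.Semiring.Mult semiring as Mult*
  import Algebra.Properties.Semiring.Exp semiring as Exp
  import Algebra.Properties.Ring ring as Ring

  ≮⇒≥ : ∀ {x y} → ¬ (x < y) → y ≤ x
  ≮⇒≥ {x} {y} x≮y with compare x y
  ... | tri< x<y _ _ = contradiction x<y x≮y
  ... | tri≈ _ x≈y _ = inj₂ (sym x≈y)
  ... | tri> _ _ y<x = inj₁ y<x

  ≤⇒≯ : ∀ {x y} → x ≤ y → ¬ (y < x)
  ≤⇒≯ x≤y y<x = <-irrefl refl (begin-strict _ ≤⟨ x≤y ⟩ _ <⟨ y<x ⟩ _ ∎)

  ≰⇒> : ∀ {x y} → ¬ (x ≤ y) → y < x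
  ≰⇒> {x} {y} x≰y with compare x y
  ... | tri< x<y _ _ = contradiction (inj₁ x<y) x≰y
  ... | tri≈ _ x≈y _ = contradiction (inj₂ x≈y) x≰y
  ... | tri> _ _ y<x = y<x

  +-monoʳ-≤ : ∀ x {y z} → y ≤ z → x + y ≤ x + z
  +-monoʳ-≤ x (inj₁ y<z) = inj₁ (+-monoʳ-< x y<z)
  +-monoʳ-≤ x (inj₂ y≈z) = inj₂ (+-congˡ y≈z)

  +-monoˡ-≤ : ∀ x {y z} → y ≤ z → y + x ≤ z + x
  +-monoˡ-≤ x {y} {z} y≤z = begin
    y + x ≈⟨ +-comm y x ⟩ x + y ≤⟨ +-monoʳ-≤ x y≤z ⟩ x + z ≈⟨ +-comm x z ⟩ z + x ∎

  +-mono-≤ : ∀ {x y z w} → x ≤ y → z ≤ w → x + z ≤ y + w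
  +-mono-≤ {x} {y} {z} {w} x≤y z≤w = begin x + z ≤⟨ +-monoˡ-≤ z x≤y ⟩ y + z ≤⟨ +-monoʳ-≤ y z≤w ⟩ y + w ∎

  x-y+y≈x : ∀ x y → x - y + y ≈ x
  x-y+y≈x x y = trans (+-assoc x (- y) y) (trans (+-congˡ (-‿inverseˡ y)) (+-identityʳ x))

  x+y-y≈x : ∀ x y → x + y - y ≈ x
  x+y-y≈x x y = trans (+-assoc x y (- y)) (trans (+-congˡ (-‿inverseʳ y)) (+-identityʳ x))

  +-cancelʳ-≤ : ∀ x {y z} → y + x ≤ z + x → y ≤ z
  +-cancelʳ-≤ x {y} {z} y+x≤z+x = begin
    y ≈⟨ x+y-y≈x y x ⟨ y + x - x ≤⟨ +-monoˡ-≤ (- x) y+x≤z+x ⟩ z + x - x ≈⟨ x+y-y≈x z x ⟩ z ∎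

  +-cancelʳ-< : ∀ x {y z} → y + x < z + x → y < z
  +-cancelʳ-< x {y} {z} y+x<z+x = ≰⇒> λ z≤y → ≤⇒≯ (+-monoˡ-≤ x z≤y) y+x<z+x

  0<y-x : ∀ {x y} → x < y → 0# < y - x
  0<y-x {x} {y} x<y = +-cancelʳ-< x (begin-strict
    0# + x ≈⟨ +-identityˡ x ⟩ x <⟨ x<y ⟩ y ≈⟨ x-y+y≈x y x ⟨ y - x + x ∎)

  *-monoʳ-≤ : ∀ {x y z} → 0# ≤ x → y ≤ z → x * y ≤ x * z
  *-monoʳ-≤ {x} {y} {z} (inj₂ 0≈x) _ = inj₂ (trans (*-congʳ (sym 0≈x)) (trans (zeroˡ y) (trans (sym (zeroˡ z)) (*-congʳ 0≈x))))
  *-monoʳ-≤ _ (inj₂ y≈z) = inj₂ (*-congˡ y≈z)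
  *-monoʳ-≤ {x} {y} {z} (inj₁ 0<x) (inj₁ y<z) = begin
    x * y                 ≈⟨ +-identityˡ (x * y) ⟨
    0# + x * y            ≤⟨ +-monoˡ-≤ (x * y) (inj₁ (*-pos 0<x (0<y-x y<z))) ⟩
    x * (z - y) + x * y   ≈⟨ distribˡ x (z - y) y ⟨
    x * (z - y + y)       ≈⟨ *-congˡ (x-y+y≈x z y) ⟩
    x * z                 ∎

  *-monoˡ-≤ : ∀ {x y z} → 0# ≤ x → y ≤ z → y * x ≤ z * x
  *-monoˡ-≤ {x} {y} {z} 0≤x y≤z = begin
    y * x ≈⟨ *-comm y x ⟩ x * y ≤⟨ *-monoʳ-≤ 0≤x y≤z ⟩ x * z ≈⟨ *-comm x z ⟩ z * x ∎

  *-nonneg : ∀ {x y} → 0# ≤ x → 0# ≤ y → 0# ≤ x * y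
  *-nonneg {x} {y} 0≤x 0≤y = begin 0# ≈⟨ zeroʳ x ⟨ x * 0# ≤⟨ *-monoʳ-≤ 0≤x 0≤y ⟩ x * y ∎

  *-mono-≤ : ∀ {x y z w} → 0# ≤ x → 0# ≤ z → x ≤ y → z ≤ w → x * z ≤ y * w
  *-mono-≤ {x} {y} {z} {w} 0≤x 0≤z x≤y z≤w = begin
    x * z ≤⟨ *-monoˡ-≤ 0≤z x≤y ⟩ y * z ≤⟨ *-monoʳ-≤ (≤-trans 0≤x x≤y) z≤w ⟩ y * w ∎

  *-cancelˡ-≤ : ∀ {x y z} → 0# < x → x * y ≤ x * z → y ≤ z
  *-cancelˡ-≤ {x} {y} {z} 0<x xy≤xz = ≮⇒≥ λ z<y → ≤⇒≯ xy≤xz (+-cancelʳ-< (- (x * z)) (begin-strict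
    x * z - x * z   ≈⟨ -‿inverseʳ (x * z) ⟩
    0#              <⟨ *-pos 0<x (0<y-x z<y) ⟩
    x * (y - z)     ≈⟨ distribˡ x y (- z) ⟩
    x * y + x * - z ≈⟨ +-congˡ (Ring.-‿distribʳ-* x z) ⟨
    x * y - x * z   ∎))

  0≤1 : 0# ≤ 1#
  0≤1 = inj₁ 0<1

  fromℕ-+ : ∀ m n → fromℕ (m ℕ.+ n) ≈ fromℕ m + fromℕ n
  fromℕ-+ = Mult.×-homo-+ 1#

  fromℕ-* : ∀ m n → fromℕ (m ℕ.* n) ≈ fromℕ m * fromℕ n
  fromℕ-* = Mult*.×1-homo-*

  fromℕ-1 : fromℕ 1 ≈ 1#
  fromℕ-1 = +-identityʳ 1#

  0≤fromℕ : ∀ n → 0# ≤ fromℕ n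
  0≤fromℕ zero    = ≤-refl
  0≤fromℕ (suc n) = begin 0# ≈⟨ +-identityʳ 0# ⟨ 0# + 0# ≤⟨ +-mono-≤ 0≤1 (0≤fromℕ n) ⟩ 1# + fromℕ n ∎

  fromℕ-mono-≤ : ∀ {m n} → m ℕ.≤ n → fromℕ m ≤ fromℕ n
  fromℕ-mono-≤ {n = n} ℕ.z≤n = 0≤fromℕ n
  fromℕ-mono-≤ (ℕ.s≤s m≤n)   = +-monoʳ-≤ 1# (fromℕ-mono-≤ m≤n)

  x<1+x : ∀ x → x < 1# + x
  x<1+x x = begin-strict
    x ≈⟨ +-identityʳ x ⟨ x + 0# <⟨ +-monoʳ-< x 0<1 ⟩ x + 1# ≈⟨ +-comm x 1# ⟩ 1# + x ∎

  fromℕ-mono-< : ∀ {m n} → m ℕ.< n → fromℕ m < fromℕ n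
  fromℕ-mono-< {m} {n} m<n = begin-strict fromℕ m <⟨ x<1+x (fromℕ m) ⟩ fromℕ (suc m) ≤⟨ fromℕ-mono-≤ m<n ⟩ fromℕ n ∎

  fromℕ-cancel-≤ : ∀ {m n} → fromℕ m ≤ fromℕ n → m ℕ.≤ n
  fromℕ-cancel-≤ m≤n = ℕ.≮⇒≥ λ n<m → ≤⇒≯ m≤n (fromℕ-mono-< n<m)

  fromℕ-cancel-< : ∀ {m n} → fromℕ m < fromℕ n → m ℕ.< n
  fromℕ-cancel-< m<n = ℕ.≰⇒> λ n≤m → ≤⇒≯ (fromℕ-mono-≤ n≤m) m<n

  0<fromℕ : ∀ n .{{_ : ℕ.NonZero n}} → 0# < fromℕ n
  0<fromℕ (suc n) = fromℕ-mono-< {0} {suc n} ℕ.z<s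

  2^≈fromℕ : ∀ k → 2# ^ k ≈ fromℕ (2 ℕ.^ k)
  2^≈fromℕ zero    = sym fromℕ-1
  2^≈fromℕ (suc k) = begin-equality
    2# * 2# ^ k                    ≈⟨ *-cong (+-congˡ (sym (+-identityʳ 1#))) (2^≈fromℕ k) ⟩
    fromℕ 2 * fromℕ (2 ℕ.^ k)      ≈⟨ fromℕ-* 2 (2 ℕ.^ k) ⟨
    fromℕ (2 ℕ.^ suc k)            ∎

  0≤x^n : ∀ {x} n → 0# ≤ x → 0# ≤ x ^ n
  0≤x^n zero    _   = 0≤1
  0≤x^n (suc n) 0≤x = *-nonneg 0≤x (0≤x^n n 0≤x)

  ^-monoˡ-≤ : ∀ {x y} n → 0# ≤ x → x ≤ y → x ^ n ≤ y ^ n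
  ^-monoˡ-≤ zero    _   _   = ≤-refl
  ^-monoˡ-≤ (suc n) 0≤x x≤y = *-mono-≤ 0≤x (0≤x^n n 0≤x) x≤y (^-monoˡ-≤ n 0≤x x≤y)

  bernoulli-ℝ : ∀ {η} n → 0# ≤ η → 1# + fromℕ n * η ≤ (1# + η) ^ n
  bernoulli-ℝ {η} zero    0≤η = inj₂ (trans (+-congˡ (zeroˡ η)) (+-identityʳ 1#))
  bernoulli-ℝ {η} (suc n) 0≤η = begin
    1# + fromℕ (suc n) * η                         ≈⟨ +-identityʳ _ ⟨
    1# + fromℕ (suc n) * η + 0#                    ≤⟨ +-monoʳ-≤ _ (*-nonneg (0≤fromℕ n) (*-nonneg 0≤η 0≤η)) ⟩
    1# + (1# + fromℕ n) * η + fromℕ n * (η * η)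
      ≈⟨ solve 2 (λ n η → con 1 :+ (con 1 :+ n) :* η :+ n :* (η :* η) := (con 1 :+ η) :* (con 1 :+ n :* η))
           refl (fromℕ n) η ⟩
    (1# + η) * (1# + fromℕ n * η)
      ≤⟨ *-monoʳ-≤ (≤-trans 0≤1 (begin 1# ≈⟨ +-identityʳ 1# ⟨ 1# + 0# ≤⟨ +-monoʳ-≤ 1# 0≤η ⟩ 1# + η ∎)) (bernoulli-ℝ n 0≤η) ⟩
    (1# + η) * (1# + η) ^ n                        ∎

  archimedean : ∀ x → ∃[ n ] x < fromℕ n
  archimedean x with em {∃[ n ] x < fromℕ n}
  ... | yes found = found
  ... | no  none  = contradiction (x<1+x (s - 1#)) (≤⇒≯ (begin
      1# + (s - 1#) ≈⟨ +-comm 1# (s - 1#) ⟩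
      s - 1# + 1#   ≈⟨ x-y+y≈x s 1# ⟩
      s             ≤⟨ proj₂ s-lub (s - 1#) below ⟩
      s - 1#        ∎))
    where
    ℕs : Pred Carrier 0ℓ
    ℕs r = ∃[ n ] r ≈ fromℕ n
    s = sup ℕs
    s-lub : IsLub ℕs s
    s-lub = sup-isLub ℕs (0# , 0 , refl)
      (x , λ { r (n , r≈n) → begin r ≈⟨ r≈n ⟩ fromℕ n ≤⟨ ≮⇒≥ (λ x<n → none (n , x<n)) ⟩ x ∎ })
    below : UpperBound ℕs (s - 1#)
    below r (n , r≈n) = +-cancelʳ-≤ 1# (begin
      r + 1#          ≈⟨ +-comm r 1# ⟩
      1# + r          ≈⟨ +-congˡ r≈n ⟩
      fromℕ (suc n)   ≤⟨ proj₁ s-lub _ (suc n , refl) ⟩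
      s               ≈⟨ x-y+y≈x s 1# ⟨
      s - 1# + 1#     ∎)

  -- `U` is the ceiling of `x` and `a` the integer part of its logarithm: 2^a ≤ x keeps `a` below
  -- `log₂ x`, and U ≤ 2^(a+1) gives upper bounds in natural numbers.
  record Rounding (x : Carrier) : Set where
    field
      pred-U a : ℕ
    U : ℕ
    U = suc pred-U
    field
      pred-U<x  : fromℕ pred-U < x
      x≤U       : x ≤ fromℕ U
      2^a≤x     : fromℕ (2 ℕ.^ a) ≤ x
      U≤2^[1+a] : U ℕ.≤ 2 ℕ.^ suc a

    U≤1+x : fromℕ U ≤ 1# + x
    U≤1+x = +-monoʳ-≤ 1# (inj₁ pred-U<x)

  round : ∀ {x} → 1# ≤ x → Rounding x
  round {x} 1≤x with archimedean x
  ... | n , x<n with threshold {λ k → x ≤ fromℕ k} (λ k → em) n (λ x≤0 → ≤⇒≯ (≤-trans 1≤x x≤0) 0<1) (inj₁ x<n)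
                   | threshold {λ k → x < fromℕ (2 ℕ.^ k)} (λ k → em) n
                       (λ x<1 → ≤⇒≯ 1≤x (begin-strict x <⟨ x<1 ⟩ fromℕ 1 ≈⟨ fromℕ-1 ⟩ 1# ∎))
                       (begin-strict x <⟨ x<n ⟩ fromℕ n <⟨ fromℕ-mono-< (n<2^n n) ⟩ fromℕ (2 ℕ.^ n) ∎)
  ... | u , x≰u , x≤1+u | a , x≮2^a , x<2^1+a = record
    { pred-U = u ; a = a ; pred-U<x = ≰⇒> x≰u ; x≤U = x≤1+u ; 2^a≤x = ≮⇒≥ x≮2^a
    ; U≤2^[1+a] = fromℕ-cancel-< (<-trans (≰⇒> x≰u) x<2^1+a) }

  fromℤ-cancel : ∀ {z n} → 2# ^ℤ z ≤ fromℕ (2 ℕ.^ n) → fromℤ z ≤ fromℕ n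
  fromℤ-cancel {ℤ.+ m} {n} 2^m≤2^n = fromℕ-mono-≤ {m} {n} (ℕ.≮⇒≥ λ n<m → ≤⇒≯ 2^m≤2^n (begin-strict
    fromℕ (2 ℕ.^ n) <⟨ fromℕ-mono-< {2 ℕ.^ n} {2 ℕ.^ m} (ℕ.^-monoʳ-< 2 (ℕ.s≤s (ℕ.s≤s ℕ.z≤n)) n<m) ⟩
    fromℕ (2 ℕ.^ m) ≈⟨ 2^≈fromℕ m ⟨
    2# ^ m          ∎))
  fromℤ-cancel { -[1+ m ]} {n} _ = +-cancelʳ-≤ (fromℕ (suc m)) (begin
    - fromℕ (suc m) + fromℕ (suc m) ≈⟨ -‿inverseˡ _ ⟩
    0#                              ≤⟨ 0≤fromℕ (n ℕ.+ suc m) ⟩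
    fromℕ (n ℕ.+ suc m)             ≈⟨ fromℕ-+ n (suc m) ⟩
    fromℕ n + fromℕ (suc m)         ∎)

  0<⇒≉0 : ∀ {x} → 0# < x → ¬ (x ≈ 0#)
  0<⇒≉0 0<x x≈0 = <-irrefl (sym x≈0) 0<x

  -- p/(q+1) belongs to the set whose supremum is the logarithm. The supremum is meaningful because
  -- x < n < 2^n for some `n`, which bounds the set.
  log₂-lower : ∀ {x} p q → 0# ≤ x → fromℕ (2 ℕ.^ p) ≤ x ^ suc q → fromℕ p ≤ fromℕ (suc q) * log₂ x
  log₂-lower {x} p q 0≤x 2^p≤x^[1+q] = begin
    fromℕ p                                 ≈⟨ r*[1+q]≈p ⟨
    r * fromℕ (suc q)                       ≤⟨ *-monoˡ-≤ (0≤fromℕ (suc q)) (proj₁ lub r r∈S) ⟩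
    log₂ x * fromℕ (suc q)                  ≈⟨ *-comm _ _ ⟩
    fromℕ (suc q) * log₂ x                  ∎
    where
    S : Pred Carrier 0ℓ
    S r = Σ[ p ∈ ℤ ] Σ[ q ∈ ℕ ] (r * fromℕ (suc q) ≈ fromℤ p) × (2# ^ℤ p ≤ x ^ suc q)

    r = fromℕ p * fromℕ (suc q) ⁻¹

    r*[1+q]≈p : r * fromℕ (suc q) ≈ fromℕ p
    r*[1+q]≈p = trans (*-assoc _ _ _) (trans (*-congˡ (trans (*-comm _ _)
      (⁻¹-inverseʳ _ (0<⇒≉0 (0<fromℕ (suc q)))))) (*-identityʳ _))

    r∈S : S r
    r∈S = ℤ.+ p , q , r*[1+q]≈p , (begin 2# ^ p ≈⟨ 2^≈fromℕ p ⟩ fromℕ (2 ℕ.^ p) ≤⟨ 2^p≤x^[1+q] ⟩ x ^ suc q ∎)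

    n = proj₁ (archimedean x)

    x≤2^n : x ≤ 2# ^ n
    x≤2^n = begin
      x               <⟨ proj₂ (archimedean x) ⟩
      fromℕ n         <⟨ fromℕ-mono-< (n<2^n n) ⟩
      fromℕ (2 ℕ.^ n) ≈⟨ 2^≈fromℕ n ⟨
      2# ^ n          ∎

    bounded : UpperBound S (fromℕ n)
    bounded s (z , k , s*≈z , 2^z≤) = *-cancelˡ-≤ (0<fromℕ (suc k)) (begin
      fromℕ (suc k) * s        ≈⟨ *-comm _ s ⟩
      s * fromℕ (suc k)        ≈⟨ s*≈z ⟩
      fromℤ z                  ≤⟨ fromℤ-cancel {z} {n ℕ.* suc k} (begin
        2# ^ℤ z                  ≤⟨ 2^z≤ ⟩
        x ^ suc k                ≤⟨ ^-monoˡ-≤ (suc k) 0≤x x≤2^n ⟩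
        (2# ^ n) ^ suc k         ≈⟨ Exp.^-assocʳ 2# n (suc k) ⟩
        2# ^ (n ℕ.* suc k)       ≈⟨ 2^≈fromℕ (n ℕ.* suc k) ⟩
        fromℕ (2 ℕ.^ (n ℕ.* suc k)) ∎) ⟩
      fromℕ (n ℕ.* suc k)      ≈⟨ fromℕ-* n (suc k) ⟩
      fromℕ n * fromℕ (suc k)  ≈⟨ *-comm _ _ ⟩
      fromℕ (suc k) * fromℕ n  ∎)

    lub : IsLub S (log₂ x)
    lub = sup-isLub S (r , r∈S) (fromℕ n , bounded)

  2^k≤x⇒k≤log₂x : ∀ {x} k → fromℕ (2 ℕ.^ k) ≤ x → fromℕ k ≤ log₂ x
  2^k≤x⇒k≤log₂x {x} k 2^k≤x = begin
    fromℕ k           ≤⟨ log₂-lower k 0 (≤-trans (0≤fromℕ (2 ℕ.^ k)) 2^k≤x) (begin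
                            fromℕ (2 ℕ.^ k) ≤⟨ 2^k≤x ⟩ x ≈⟨ *-identityʳ x ⟨ x * 1# ∎) ⟩
    fromℕ 1 * log₂ x  ≈⟨ trans (*-congʳ fromℕ-1) (*-identityˡ _) ⟩
    log₂ x            ∎

  -- Bernoulli's inequality gives (1 + η)^k ≥ 1 + kη ≥ 2.
  1≤k*log₂[1+η] : ∀ {x η k} → x ≈ 1# + η → 0# ≤ η → 1# ≤ fromℕ k * η → 1# ≤ fromℕ k * log₂ x
  1≤k*log₂[1+η] {η = η} {k = zero} _ _ 1≤0*η = contradiction 0<1 (≤⇒≯ (≤-trans 1≤0*η (inj₂ (zeroˡ η))))
  1≤k*log₂[1+η] {x} {η} {k = suc k} x≈1+η 0≤η 1≤kη = begin
    1#      ≈⟨ fromℕ-1 ⟨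
    fromℕ 1 ≤⟨ log₂-lower 1 k (begin
        0#       ≤⟨ 0≤1 ⟩
        1#       ≈⟨ +-identityʳ 1# ⟨
        1# + 0#  ≤⟨ +-monoʳ-≤ 1# 0≤η ⟩
        1# + η   ≈⟨ x≈1+η ⟨
        x        ∎) (begin
        fromℕ 2                  ≈⟨ +-congˡ fromℕ-1 ⟩
        1# + 1#                  ≤⟨ +-monoʳ-≤ 1# 1≤kη ⟩
        1# + fromℕ (suc k) * η   ≤⟨ bernoulli-ℝ (suc k) 0≤η ⟩
        (1# + η) ^ suc k         ≈⟨ Exp.^-congˡ (suc k) x≈1+η ⟨
        x ^ suc k                ∎) ⟩
    fromℕ (suc k) * log₂ x ∎

  ⌊⌋-lub : ∀ {x} → 0# ≤ x → IsLub (λ r → ∃[ z ] (r ≈ fromℤ z) × (fromℤ z ≤ x)) ⌊ x ⌋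
  ⌊⌋-lub {x} 0≤x = sup-isLub _ (0# , ℤ.+ 0 , refl , 0≤x)
    (x , λ { r (z , r≈z , z≤x) → begin r ≈⟨ r≈z ⟩ fromℤ z ≤⟨ z≤x ⟩ x ∎ })

  0≤⌊x⌋ : ∀ {x} → 0# ≤ x → 0# ≤ ⌊ x ⌋
  0≤⌊x⌋ 0≤x = proj₁ (⌊⌋-lub 0≤x) 0# (ℤ.+ 0 , refl , 0≤x)

  ⌊x⌋≤x : ∀ {x} → 0# ≤ x → ⌊ x ⌋ ≤ x
  ⌊x⌋≤x {x} 0≤x = proj₂ (⌊⌋-lub 0≤x) x λ { r (z , r≈z , z≤x) → begin r ≈⟨ r≈z ⟩ fromℤ z ≤⟨ z≤x ⟩ x ∎ }

  -- Any integer z ≤ y with z ≥ k yields the integer z - k ≤ x; smaller `z` are covered by ⌊x⌋ ≥ 0.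
  ⌊⌋-shift : ∀ {x y} k → 0# ≤ x → 0# ≤ y → y ≤ fromℕ k + x → ⌊ y ⌋ ≤ fromℕ k + ⌊ x ⌋
  ⌊⌋-shift {x} {y} k 0≤x 0≤y y≤k+x = proj₂ (⌊⌋-lub 0≤y) _ λ { r (z , r≈z , z≤y) → begin
      r ≈⟨ r≈z ⟩ fromℤ z ≤⟨ bound z z≤y ⟩ fromℕ k + ⌊ x ⌋ ∎ }
    where
    k≤ : fromℕ k ≤ fromℕ k + ⌊ x ⌋
    k≤ = begin fromℕ k ≈⟨ +-identityʳ _ ⟨ fromℕ k + 0# ≤⟨ +-monoʳ-≤ _ (0≤⌊x⌋ 0≤x) ⟩ fromℕ k + ⌊ x ⌋ ∎
    bound : ∀ z → fromℤ z ≤ y → fromℤ z ≤ fromℕ k + ⌊ x ⌋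
    bound -[1+ m ] _ = begin
      - fromℕ (suc m)                      ≈⟨ +-identityʳ _ ⟨
      - fromℕ (suc m) + 0#                 ≤⟨ +-monoʳ-≤ _ (0≤fromℕ (suc m)) ⟩
      - fromℕ (suc m) + fromℕ (suc m)      ≈⟨ -‿inverseˡ _ ⟩
      0#                                   ≤⟨ 0≤fromℕ k ⟩
      fromℕ k                              ≤⟨ k≤ ⟩
      fromℕ k + ⌊ x ⌋                      ∎
    bound (ℤ.+ m) m≤y with ℕ.≤-total k m
    ... | inj₂ m≤k = ≤-trans (fromℕ-mono-≤ m≤k) k≤
    ... | inj₁ k≤m = begin
      fromℕ m                 ≈⟨ m≈ ⟩
      fromℕ k + fromℕ (m ℕ.∸ k) ≤⟨ +-monoʳ-≤ (fromℕ k) (proj₁ (⌊⌋-lub 0≤x) _ (ℤ.+ (m ℕ.∸ k) , refl ,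
          +-cancelʳ-≤ (fromℕ k) (begin
            fromℕ (m ℕ.∸ k) + fromℕ k ≈⟨ +-comm _ _ ⟩
            fromℕ k + fromℕ (m ℕ.∸ k) ≈⟨ m≈ ⟨
            fromℕ m                   ≤⟨ m≤y ⟩
            y                         ≤⟨ y≤k+x ⟩
            fromℕ k + x               ≈⟨ +-comm _ _ ⟩
            x + fromℕ k               ∎))) ⟩
      fromℕ k + ⌊ x ⌋         ∎
      where
      m≈ : fromℕ m ≈ fromℕ k + fromℕ (m ℕ.∸ k)
      m≈ = trans (reflexive (≡.cong fromℕ (≡.sym (ℕ.m+[n∸m]≡n k≤m)))) (fromℕ-+ k (m ℕ.∸ k))

  module Reciprocal {x} (0<x : 0# < x) (x<1 : x < 1#) where

    x⁻¹ : Carrier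
    x⁻¹ = 1# / x

    x*x⁻¹≈1 : x * x⁻¹ ≈ 1#
    x*x⁻¹≈1 = trans (*-congˡ (*-identityˡ _)) (⁻¹-inverseʳ x (0<⇒≉0 0<x))

    1<x⁻¹ : 1# < x⁻¹
    1<x⁻¹ = ≰⇒> λ x⁻¹≤1 → <-irrefl refl (begin-strict
      1#        ≈⟨ x*x⁻¹≈1 ⟨
      x * x⁻¹   ≤⟨ *-monoʳ-≤ (inj₁ 0<x) x⁻¹≤1 ⟩
      x * 1#    ≈⟨ *-identityʳ x ⟩
      x         <⟨ x<1 ⟩
      1#        ∎)

  x≤∣x∣ : ∀ x → x ≤ ∣ x ∣
  x≤∣x∣ x with x <? 0#
  ... | no  _   = ≤-refl
  ... | yes x<0 = +-cancelʳ-≤ x (begin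
    x + x     ≤⟨ +-mono-≤ (inj₁ x<0) (inj₁ x<0) ⟩
    0# + 0#   ≈⟨ +-identityʳ 0# ⟩
    0#        ≈⟨ -‿inverseˡ x ⟨
    - x + x   ∎)

  0≤∣x∣ : ∀ x → 0# ≤ ∣ x ∣
  0≤∣x∣ x with x <? 0#
  ... | no  x≮0 = ≮⇒≥ x≮0
  ... | yes x<0 = +-cancelʳ-≤ x (begin
    0# + x    ≈⟨ +-identityˡ x ⟩
    x         ≤⟨ inj₁ x<0 ⟩
    0#        ≈⟨ -‿inverseˡ x ⟨
    - x + x   ∎)

  x*y≈1⇒x⁻¹≈y : ∀ {x y} → 0# < x → x * y ≈ 1# → x ⁻¹ ≈ y
  x*y≈1⇒x⁻¹≈y {x} {y} 0<x xy≈1 = begin-equality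
    x ⁻¹             ≈⟨ *-identityʳ _ ⟨
    x ⁻¹ * 1#        ≈⟨ *-congˡ xy≈1 ⟨
    x ⁻¹ * (x * y)   ≈⟨ solve 3 (λ a x y → a :* (x :* y) := x :* a :* y) refl (x ⁻¹) x y ⟩
    x * x ⁻¹ * y     ≈⟨ *-congʳ (⁻¹-inverseʳ x (0<⇒≉0 0<x)) ⟩
    1# * y           ≈⟨ *-identityˡ y ⟩
    y                ∎

  -- V t ≤ V − 1, so the floors of V consecutive multiples of t cannot all increase.
  floor-stalls : ∀ {t} V → 0# ≤ t → fromℕ (suc V) * t ≤ fromℕ V → ∀ i →
                 ∃[ w ] w ℕ.< suc V ×
                   ⌊ fromℕ (suc (suc (w ℕ.+ i))) * t ⌋ - ⌊ fromℕ (suc (w ℕ.+ i)) * t ⌋ < 1#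
  floor-stalls {t} V 0≤t Vt≤V-1 i with search (suc V)
    where
    φ : ℕ → Carrier
    φ j = ⌊ fromℕ (suc (j ℕ.+ i)) * t ⌋
    search : ∀ k → (∃[ w ] w ℕ.< k × φ (suc w) - φ w < 1#) ⊎ (fromℕ k + φ 0 ≤ φ k)
    search zero = inj₂ (inj₂ (+-identityˡ _))
    search (suc k) with search k
    ... | inj₁ (w , w<k , stalls) = inj₁ (w , ℕ.m<n⇒m<1+n w<k , stalls)
    ... | inj₂ k≤φ with (φ (suc k) - φ k) <? 1#
    ...   | yes stalls = inj₁ (k , ℕ.≤-refl , stalls)
    ...   | no grows   = inj₂ (begin
      1# + fromℕ k + φ 0           ≈⟨ +-assoc _ _ _ ⟩
      1# + (fromℕ k + φ 0)         ≤⟨ +-mono-≤ (≮⇒≥ grows) k≤φ ⟩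
      φ (suc k) - φ k + φ k        ≈⟨ x-y+y≈x _ _ ⟩
      φ (suc k)                    ∎)
  ... | inj₁ found = found
  ... | inj₂ all-grow = contradiction all-grow (λ grow → ≤⇒≯ grow (begin-strict
    ⌊ fromℕ (suc (suc V ℕ.+ i)) * t ⌋
      ≤⟨ ⌊⌋-shift V (*-nonneg (0≤fromℕ (suc i)) 0≤t) (*-nonneg (0≤fromℕ (suc (suc V ℕ.+ i))) 0≤t) (begin
        fromℕ (suc (suc V ℕ.+ i)) * t           ≈⟨ *-congʳ (reflexive (≡.cong fromℕ (≡.sym (ℕ.+-suc (suc V) i)))) ⟩
        fromℕ (suc V ℕ.+ suc i) * t             ≈⟨ *-congʳ (fromℕ-+ (suc V) (suc i)) ⟩
        (fromℕ (suc V) + fromℕ (suc i)) * t     ≈⟨ distribʳ t _ _ ⟩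
        fromℕ (suc V) * t + fromℕ (suc i) * t   ≤⟨ +-monoˡ-≤ _ Vt≤V-1 ⟩
        fromℕ V + fromℕ (suc i) * t             ∎) ⟩
    fromℕ V + ⌊ fromℕ (suc i) * t ⌋         <⟨ x<1+x _ ⟩
    1# + (fromℕ V + ⌊ fromℕ (suc i) * t ⌋)  ≈⟨ +-assoc _ _ _ ⟨
    fromℕ (suc V) + ⌊ fromℕ (suc i) * t ⌋   ∎))

-- Choosing the largest dyadic length, and the numerical conditions of the analysis.

module Scale (c d₀ : ℕ) (2≤d₀ : 2 ℕ.≤ d₀)
             (growth : ∀ d → d₀ ℕ.≤ d → 4 ℕ.* c ℕ.* (suc d ℕ.* suc d) ℕ.≤ 2 ℕ.^ d) where
  open import Data.Nat.Base
  open import Data.Nat.Properties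

  private
    m≤m*n′ : ∀ m {n} → 1 ≤ n → m ≤ m * n
    m≤m*n′ m {suc n} _ = m≤m*n m (suc n)

    square-+ : ∀ x y → (x + y) * (x + y) ≤ 2 * (x * x) + 2 * (y * y)
    square-+ x y with ≤-total x y
    ... | inj₁ x≤y with z , ≡.refl ← m≤n⇒∃[o]m+o≡n x≤y = ≤-trans (m≤m+n _ (z * z)) (≤-reflexive (lemma x z))
      where
      lemma : ∀ x z → (x + (x + z)) * (x + (x + z)) + z * z ≡ 2 * (x * x) + 2 * ((x + z) * (x + z))
      lemma = solve-∀
    ... | inj₂ y≤x with z , ≡.refl ← m≤n⇒∃[o]m+o≡n y≤x = ≤-trans (m≤m+n _ (z * z)) (≤-reflexive (lemma y z))
      where
      lemma : ∀ y z → ((y + z) + y) * ((y + z) + y) + z * z ≡ 2 * ((y + z) * (y + z)) + 2 * (y * y)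
      lemma = solve-∀

  2^[2+k]*x≡4*[2^k*x] : ∀ k x → 2 ^ (2 + k) * x ≡ 4 * (2 ^ k * x)
  2^[2+k]*x≡4*[2^k*x] k x = lemma (2 ^ k) x
    where
    lemma : ∀ p x → (p + (p + 0) + (p + (p + 0) + 0)) * x ≡ 4 * (p * x)
    lemma = solve-∀

  -- U and V stand for 1/ε and 1/(1-t), and 2 ^ L for the largest power of two below n / (4 U).  The
  -- exponent d of n / U²V then satisfies L ≤ a + b + d, and 2 ^ d dominates (d + 1)².
  scale : ∀ {n U V a b} .{{_ : NonZero U}} .{{_ : NonZero V}} → U ≤ 2 ^ suc a → V ≤ 2 ^ suc b →
          4 * c * ((a + b) * (a + b)) * (U * U * V) ≤ n → 2 ^ d₀ * (U * U * V) ≤ n →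
          ∃[ L ] 4 * (2 ^ L * U) ≤ n × n ≤ 8 * (2 ^ L * U) × c * (suc L * suc L) * (U * U * V) ≤ n
  scale {n} {U} {V} {a} {b} U≤ V≤ hyp large = result
    where
    open ≤-Reasoning
    A = U * U * V

    1≤U : 1 ≤ U
    1≤U = >-nonZero⁻¹ U
    1≤V : 1 ≤ V
    1≤V = >-nonZero⁻¹ V
    instance
      A≢0 : NonZero A
      A≢0 = m*n≢0 (U * U) V {{m*n≢0 U U}}

    U≤A : U ≤ A
    U≤A = ≤-trans (m≤m*n′ U 1≤U) (m≤m*n′ (U * U) 1≤V)

    n<2^n*A : n < 4 * (2 ^ n * U)
    n<2^n*A = begin-strict
      n                ≤⟨ m≤m*n′ n 1≤U ⟩
      n * U            <⟨ *-monoˡ-< U (n<2^n n) ⟩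
      2 ^ n * U        ≤⟨ m≤m+n _ _ ⟩
      4 * (2 ^ n * U)  ∎

    4U≤n : 4 * (2 ^ 0 * U) ≤ n
    4U≤n = begin
      4 * (1 * U)   ≡⟨ ≡.cong (4 *_) (*-identityˡ U) ⟩
      4 * U         ≤⟨ *-mono-≤ (^-monoʳ-≤ 2 2≤d₀) U≤A ⟩
      2 ^ d₀ * A    ≤⟨ large ⟩
      n             ∎

    n<2^[d₀+n]*A : n < 2 ^ (n + d₀) * A
    n<2^[d₀+n]*A = begin-strict
      n                 <⟨ n<2^n n ⟩
      2 ^ n             ≤⟨ ^-monoʳ-≤ 2 (m≤m+n n d₀) ⟩
      2 ^ (n + d₀)      ≤⟨ m≤m*n (2 ^ (n + d₀)) A ⟩
      2 ^ (n + d₀) * A  ∎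

    result : ∃[ L ] 4 * (2 ^ L * U) ≤ n × n ≤ 8 * (2 ^ L * U) × c * (suc L * suc L) * A ≤ n
    result with threshold (λ k → n <? 4 * (2 ^ k * U)) n (≤⇒≯ 4U≤n) n<2^n*A
              | threshold (λ k → n <? 2 ^ (k + d₀) * A) n (≤⇒≯ large) n<2^[d₀+n]*A
    ... | L , n≮ , n< | e , n≮′ , n<′ = L , ≮⇒≥ n≮ , n≤ , *-cancelˡ-≤ 2 (begin
        -- After doubling, (a+b+d+1)² ≤ 2(a+b)² + 2(d+1)² leaves two terms of at most `n` each: one
        -- by the hypothesis on the logarithms, one by `growth`.
        2 * (c * (suc L * suc L) * A)
          ≤⟨ *-monoʳ-≤ 2 (*-monoˡ-≤ A (*-monoʳ-≤ c (≤-trans (*-mono-≤ L+1≤ L+1≤) (square-+ (a + b) (suc d))))) ⟩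
        2 * (c * (2 * ((a + b) * (a + b)) + 2 * (suc d * suc d)) * A)
          ≡⟨ lemma₁ c ((a + b) * (a + b)) (suc d * suc d) A ⟩
        4 * c * ((a + b) * (a + b)) * A + 4 * c * (suc d * suc d) * A
          ≤⟨ +-mono-≤ hyp (≤-trans (*-monoˡ-≤ A (growth d (m≤n+m d₀ e))) (≮⇒≥ n≮′)) ⟩
        n + n
          ≡⟨ ≡.cong (n +_) (+-identityʳ n) ⟨
        2 * n ∎)
      where
      d = e + d₀
      lemma₁ : ∀ c s t A → 2 * (c * (2 * s + 2 * t) * A) ≡ 4 * c * s * A + 4 * c * t * A
      lemma₁ = solve-∀
      n≤ : n ≤ 8 * (2 ^ L * U)
      n≤ = ≤-trans (<⇒≤ n<) (≤-reflexive (lemma (2 ^ L) U))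
        where
        lemma : ∀ p U → 4 * ((p + (p + 0)) * U) ≡ 8 * (p * U)
        lemma = solve-∀
      -- Powers of two are compared in 4·2^L·U ≤ n < 2^(d+1)·U²V, with UV ≤ 2^(a+b+2).
      L+1≤ : suc L ≤ a + b + suc d
      L+1≤ = ≤-pred (≤-pred (2^-cancel-< (*-cancelʳ-< U _ _ (begin-strict
        2 ^ (2 + L) * U                         ≡⟨ 2^[2+k]*x≡4*[2^k*x] L U ⟩
        4 * (2 ^ L * U)                         ≤⟨ ≮⇒≥ n≮ ⟩
        n                                       <⟨ n<′ ⟩
        2 ^ suc d * (U * U * V)                 ≡⟨ lemma₂ (2 ^ suc d) U V ⟩
        2 ^ suc d * (U * V) * U                 ≤⟨ *-monoˡ-≤ U (*-monoʳ-≤ (2 ^ suc d) (*-mono-≤ U≤ V≤)) ⟩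
        2 ^ suc d * (2 ^ suc a * 2 ^ suc b) * U ≡⟨ ≡.cong (_* U) powers ⟩
        2 ^ suc (suc (a + b + suc d)) * U       ∎))))
        where
        lemma₂ : ∀ p U V → p * (U * U * V) ≡ p * (U * V) * U
        lemma₂ = solve-∀
        sum≡ : ∀ d a b → suc d + (suc a + suc b) ≡ suc (suc (a + b + suc d))
        sum≡ = solve-∀
        powers : 2 ^ suc d * (2 ^ suc a * 2 ^ suc b) ≡ 2 ^ suc (suc (a + b + suc d))
        powers = ≡.trans (≡.cong (2 ^ suc d *_) (≡.sym (^-distribˡ-+-* 2 (suc a) (suc b))))
          (≡.trans (≡.sym (^-distribˡ-+-* 2 (suc d) (suc a + suc b))) (≡.cong (2 ^_) (sum≡ d a b)))
        2^-cancel-< : ∀ {m n} → 2 ^ m < 2 ^ n → m < n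
        2^-cancel-< {m} {n} 2^m<2^n = ≰⇒> λ n≤m → ≤⇒≯ (^-monoʳ-≤ 2 n≤m) 2^m<2^n

  -- U and V stand for 1/ε and 1/(1-t); m is the number of rounds, and 12288 = 6 * 32 * 64.
  module Conditions {n U V L q} .{{_ : NonZero U}} .{{_ : NonZero V}} (12288≤c : 12288 ≤ c)
                    (n≤8HU : n ≤ 8 * (2 ^ L * U)) (4HU≤n : 4 * (2 ^ L * U) ≤ n)
                    (large : c * (suc L * suc L) * (U * U * V) ≤ n)
                    (q≤ : q ≤ 32 * (suc L * U) * suc V) where
    open ≤-Reasoning
    H m ℓ : ℕ
    H = 2 ^ L
    m = 32 * (suc L * U)
    ℓ = suc L

    q≤64ℓUV : q ≤ 64 * (ℓ * U * V)
    q≤64ℓUV = begin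
      q                          ≤⟨ q≤ ⟩
      32 * (ℓ * U) * suc V       ≤⟨ *-monoʳ-≤ (32 * (ℓ * U)) (+-monoˡ-≤ V (>-nonZero⁻¹ V)) ⟩
      32 * (ℓ * U) * (V + V)     ≡⟨ lemma ℓ U V ⟩
      64 * (ℓ * U * V)           ∎
      where
      lemma : ∀ ℓ U V → 32 * (ℓ * U) * (V + V) ≡ 64 * (ℓ * U * V)
      lemma = solve-∀

    large′ : 12288 * (ℓ * ℓ * (U * U * V)) ≤ n
    large′ = begin
      12288 * (ℓ * ℓ * (U * U * V)) ≤⟨ *-monoˡ-≤ (ℓ * ℓ * (U * U * V)) 12288≤c ⟩
      c * (ℓ * ℓ * (U * U * V))     ≡⟨ *-assoc c (ℓ * ℓ) (U * U * V) ⟨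
      c * (ℓ * ℓ) * (U * U * V)     ≤⟨ large ⟩
      n                             ∎

    -- Spoiled pairs are at most half of the bad ones. This consumes only 8·2·2·64 = 2048; the
    -- summand 10240 fills up to the constant that the union bound dictates.
    4ℓq≤H : 2 * (ℓ * (2 * q)) ≤ H
    4ℓq≤H = *-cancelˡ-≤ (8 * U) {{m*n≢0 8 U}} (begin
      8 * U * (2 * (ℓ * (2 * q)))                   ≤⟨ *-monoʳ-≤ (8 * U) (*-monoʳ-≤ 2 (*-monoʳ-≤ ℓ (*-monoʳ-≤ 2 q≤64ℓUV))) ⟩
      8 * U * (2 * (ℓ * (2 * (64 * (ℓ * U * V)))))  ≤⟨ m≤m+n _ (10240 * (ℓ * ℓ * (U * U * V))) ⟩
      8 * U * (2 * (ℓ * (2 * (64 * (ℓ * U * V))))) + 10240 * (ℓ * ℓ * (U * U * V)) ≡⟨ lemma ℓ U V ⟩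
      12288 * (ℓ * ℓ * (U * U * V))                 ≤⟨ large′ ⟩
      n                                             ≤⟨ n≤8HU ⟩
      8 * (H * U)                                   ≡⟨ lemma′ H U ⟩
      8 * U * H                                     ∎)
      where
      lemma : ∀ ℓ U V → 8 * U * (2 * (ℓ * (2 * (64 * (ℓ * U * V))))) + 10240 * (ℓ * ℓ * (U * U * V)) ≡ 12288 * (ℓ * ℓ * (U * U * V))
      lemma = solve-∀
      lemma′ : ∀ H U → 8 * (H * U) ≡ 8 * U * H
      lemma′ = solve-∀

    -- Makes the union bound over the rounds at most 1/3. It is the condition that forces n to
    -- exceed log²(εn)/(ε²(1-t)).
    6mℓq≤ℓn : 3 * (m * (ℓ * (2 * q))) ≤ ℓ * n
    6mℓq≤ℓn = begin
      3 * (m * (ℓ * (2 * q)))                             ≤⟨ *-monoʳ-≤ 3 (*-monoʳ-≤ m (*-monoʳ-≤ ℓ (*-monoʳ-≤ 2 q≤64ℓUV))) ⟩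
      3 * (32 * (ℓ * U) * (ℓ * (2 * (64 * (ℓ * U * V))))) ≡⟨ lemma ℓ U V ⟩
      ℓ * (12288 * (ℓ * ℓ * (U * U * V)))                 ≤⟨ *-monoʳ-≤ ℓ large′ ⟩
      ℓ * n                                               ∎
      where
      lemma : ∀ ℓ U V → 3 * (32 * (ℓ * U) * (ℓ * (2 * (64 * (ℓ * U * V))))) ≡ ℓ * (12288 * (ℓ * ℓ * (U * U * V)))
      lemma = solve-∀

    -- Fixes the number of rounds: a pair is bad with probability at least H/(ℓn) ≥ 1/(8ℓU), and
    -- amplification asks for four times the reciprocal.
    4ℓn≤mH : 4 * (ℓ * n) ≤ m * H
    4ℓn≤mH = begin
      4 * (ℓ * n)                 ≤⟨ *-monoʳ-≤ 4 (*-monoʳ-≤ ℓ n≤8HU) ⟩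
      4 * (ℓ * (8 * (H * U)))     ≡⟨ lemma ℓ H U ⟩
      32 * (ℓ * U) * H            ∎
      where
      lemma : ∀ ℓ H U → 4 * (ℓ * (8 * (H * U))) ≡ 32 * (ℓ * U) * H
      lemma = solve-∀

    4H≤n : 4 * H ≤ n
    4H≤n = ≤-trans (*-monoʳ-≤ 4 (m≤m*n H U)) 4HU≤n

    H≤n : H ≤ n
    H≤n = ≤-trans (m≤m+n H _) 4H≤n

    2H≤n : 2 * H ≤ n
    2H≤n = ≤-trans (*-monoˡ-≤ H {2} {4} (s≤s (s≤s z≤n))) 4H≤n

-- Constants, and assembly of the testers.

module Main (c d₀ : ℕ) (12288≤c : 12288 ℕ.≤ c) (2≤d₀ : 2 ℕ.≤ d₀)
            (growth : ∀ d → d₀ ℕ.≤ d → 4 ℕ.* c ℕ.* (suc d ℕ.* suc d) ℕ.≤ 2 ℕ.^ d)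
            (em : ExcludedMiddle 0ℓ) (ℝ : RealNumbers) where
  open RealNumbers ℝ
  open PropertyTesting ℝ
  open Reals em ℝ
  open import Relation.Binary.Properties.StrictTotalOrder strictTotalOrder using ()
    renaming (refl to ≤-refl; trans to ≤-trans)
  open import Relation.Binary.Reasoning.StrictPartialOrder strictPartialOrder
  open import Algebra.Solver.Ring.NaturalCoefficients.Default commutativeSemiring
    using (solve; con; _:+_; _:*_; _:=_)

  -- Rounding 1/ε and 1/(1-t) up costs the factor 8 in Cℕ; the term k₀³ forces both of them below
  -- 1 + 1/k₀ when n < 2 ^ d₀ U²V, so that n < k₀, t < 1/n and the input can be read before the oracle first changes.
  k₀ Cℕ Kℕ : ℕ
  k₀ = 8 ℕ.* 2 ℕ.^ d₀
  Cℕ = 8 ℕ.* (4 ℕ.* c) ℕ.+ k₀ ℕ.* (k₀ ℕ.* k₀)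
  Kℕ = 256 ℕ.+ 2 ℕ.* k₀

  3≤k₀ : 3 ℕ.≤ k₀
  3≤k₀ = ℕ.≤-trans (s≤s (s≤s (s≤s z≤n))) (ℕ.*-monoʳ-≤ 8 (ℕ.m^n>0 2 d₀))

  1≤Cℕ : 1 ℕ.≤ Cℕ
  1≤Cℕ = ℕ.≤-trans (ℕ.*-mono-≤ 1≤k₀ (ℕ.*-mono-≤ 1≤k₀ 1≤k₀)) (ℕ.m≤n+m _ (8 ℕ.* (4 ℕ.* c)))
    where
    1≤k₀ : 1 ℕ.≤ k₀
    1≤k₀ = ℕ.≤-trans (s≤s z≤n) 3≤k₀

  module Observation (A : DecSetoid 0ℓ 0ℓ) (reading : Reading realDecSetoid A) {n : ℕ} where
    open OnlineModel A n public
    open DecSetoid A using () renaming (_≈_ to _≈ₐ_)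
    open Reading reading public

    2/3 : ℚᵘ.ℚᵘ
    2/3 = ℤ.+ 2 ℚᵘ./ 3

    Decides : Carrier → Property n → ∀ {q} → RandomizedAlgorithm q → Sequence n → Strategy → Set
    Decides ε P T f S = (P f → 2/3 ℚᵘ.≤ Pr[outcome≡_] T S true) × (Far ε P f → 2/3 ℚᵘ.≤ Pr[outcome≡_] T S false)

    -- The last component yields one-sidedness, as an erasure adversary only gives answers compatible
    -- with the input.
    Tester : Carrier → Carrier → Property n → Carrier → Set
    Tester ε t P bound = Σ[ q ∈ ℕ ] (fromℕ q ≤ bound) × (Σ[ T ∈ RandomizedAlgorithm q ]
      (∀ f S → StartsWith (ι ∘ f) S → FixedRate A t S → Decides ε P T f S) ×
      (∀ f S → P f → (∀ h x → f x ~ S h x) → ∀ s → outcome T S s ≡ true))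

    module _ {q} (T : RandomizedAlgorithm q) (S : Strategy) where
      open RandomizedAlgorithm T

      certain : .{{_ : NonZero n}} → ∀ b → (∀ s → outcome T S s ≡ b) → 2/3 ℚᵘ.≤ Pr[outcome≡_] T S b
      certain b always = Testers.2/3≤ em reading {n} (λ _ → ⊤) seeds {b = 0}
        (≡.trans (ℕ.+-identityʳ _) (≡.trans (countFin≡∑ (λ s → outcome T S s Bool.≟ b))
          (≡.trans (sum-cong-≗ (λ s → 𝟙-yes (outcome T S s Bool.≟ b) (always s)))
            (≡.trans (∑-const seeds 1) (ℕ.*-identityʳ seeds)))))
        z≤n

  -- The real parameters and what the hypothesis on n says about them.

  module Scales (ε t : Carrier) (0<ε : 0# < ε) (ε<1 : ε < 1#) (0<t : 0# < t) (t<1 : t < 1#) where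

    s = 1# - t

    0<s : 0# < s
    0<s = 0<y-x t<1

    s+t≈1 : s + t ≈ 1#
    s+t≈1 = x-y+y≈x 1# t

    s<1 : s < 1#
    s<1 = begin-strict
      s ≈⟨ +-identityʳ s ⟨ s + 0# <⟨ +-monoʳ-< s 0<t ⟩ s + t ≈⟨ s+t≈1 ⟩ 1# ∎

    open Reciprocal 0<ε ε<1 public using () renaming (x⁻¹ to u; x*x⁻¹≈1 to εu≈1; 1<x⁻¹ to 1<u)
    open Reciprocal 0<s s<1 public using () renaming (x⁻¹ to v; x*x⁻¹≈1 to sv≈1; 1<x⁻¹ to 1<v)

    0≤ε : 0# ≤ ε
    0≤ε = inj₁ 0<ε
    0≤t : 0# ≤ t
    0≤t = inj₁ 0<t
    0≤u : 0# ≤ u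
    0≤u = ≤-trans 0≤1 (inj₁ 1<u)
    0≤v : 0# ≤ v
    0≤v = ≤-trans 0≤1 (inj₁ 1<v)

    ru : Rounding u
    ru = round (inj₁ 1<u)
    rv : Rounding v
    rv = round (inj₁ 1<v)

    open Rounding ru public using (U; a)
    open Rounding rv public using () renaming (U to V; pred-U to V-1; a to b)

    U≤2u : fromℕ U ≤ u + u
    U≤2u = ≤-trans (Rounding.U≤1+x ru) (+-monoˡ-≤ u (inj₁ 1<u))

    V≤2v : fromℕ V ≤ v + v
    V≤2v = ≤-trans (Rounding.U≤1+x rv) (+-monoˡ-≤ v (inj₁ 1<v))

    [εs]⁻¹≈uv : (ε * s) ⁻¹ ≈ u * v
    [εs]⁻¹≈uv = x*y≈1⇒x⁻¹≈y (*-pos 0<ε 0<s) (begin-equality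
      ε * s * (u * v)   ≈⟨ solve 4 (λ ε s u v → ε :* s :* (u :* v) := (ε :* u) :* (s :* v)) refl ε s u v ⟩
      ε * u * (s * v)   ≈⟨ *-cong εu≈1 sv≈1 ⟩
      1# * 1#           ≈⟨ *-identityʳ 1# ⟩
      1#                ∎)

    Λ W : Carrier
    Λ = log₂ u + log₂ v
    W = u * u * v

    0≤W : 0# ≤ W
    0≤W = *-nonneg (*-nonneg 0≤u 0≤u) 0≤v

    1≤W : 1# ≤ W
    1≤W = begin
      1#             ≈⟨ trans (*-identityʳ _) (*-identityʳ 1#) ⟨
      1# * 1# * 1#   ≤⟨ *-mono-≤ (*-nonneg 0≤1 0≤1) 0≤1 (*-mono-≤ 0≤1 0≤1 (inj₁ 1<u) (inj₁ 1<u)) (inj₁ 1<v) ⟩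
      W              ∎

    cleared : ∀ {C y} → (C * Λ ^ 2) / (ε ^ 2 * s) ≤ y → C * (Λ * Λ) * W ≤ y
    cleared {C} {y} hyp = begin
      C * (Λ * Λ) * W          ≈⟨ *-cong (*-congˡ (*-congˡ (*-identityʳ Λ))) (x*y≈1⇒x⁻¹≈y 0<D D*W≈1) ⟨
      (C * Λ ^ 2) / (ε ^ 2 * s) ≤⟨ hyp ⟩
      y                        ∎
      where
      0<D : 0# < ε ^ 2 * s
      0<D = *-pos (*-pos 0<ε (*-pos 0<ε 0<1)) 0<s
      D*W≈1 : ε ^ 2 * s * W ≈ 1#
      D*W≈1 = begin-equality
        ε * (ε * 1#) * s * (u * u * v)
          ≈⟨ solve 4 (λ ε s u v → ε :* (ε :* con 1) :* s :* (u :* u :* v) := (ε :* u) :* (ε :* u) :* (s :* v)) refl ε s u v ⟩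
        (ε * u) * (ε * u) * (s * v)  ≈⟨ *-cong (*-cong εu≈1 εu≈1) sv≈1 ⟩
        1# * 1# * 1#                 ≈⟨ trans (*-identityʳ _) (*-identityʳ 1#) ⟩
        1#                           ∎

    UUV≤8W : fromℕ (U ℕ.* U ℕ.* V) ≤ fromℕ 8 * W
    UUV≤8W = begin
      fromℕ (U ℕ.* U ℕ.* V)               ≈⟨ trans (fromℕ-* (U ℕ.* U) V) (*-congʳ (fromℕ-* U U)) ⟩
      fromℕ U * fromℕ U * fromℕ V         ≤⟨ *-mono-≤ (*-nonneg (0≤fromℕ U) (0≤fromℕ U)) (0≤fromℕ V)
                                               (*-mono-≤ (0≤fromℕ U) (0≤fromℕ U) U≤2u U≤2u) V≤2v ⟩
      (u + u) * (u + u) * (v + v)         ≈⟨ solve 2 (λ u v → (u :+ u) :* (u :+ u) :* (v :+ v) :=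
                                               (con 1 :+ (con 1 :+ (con 1 :+ (con 1 :+ (con 1 :+ (con 1 :+ (con 1 :+ (con 1 :+ con 0)))))))) :* (u :* u :* v)) refl u v ⟩
      fromℕ 8 * W                         ∎

    0≤log₂ : ∀ {x} → 1# < x → 0# ≤ log₂ x
    0≤log₂ {x} 1<x = 2^k≤x⇒k≤log₂x 0 (begin fromℕ 1 ≈⟨ fromℕ-1 ⟩ 1# <⟨ 1<x ⟩ x ∎)

    log₂u≤Λ : log₂ u ≤ Λ
    log₂u≤Λ = begin log₂ u ≈⟨ +-identityʳ _ ⟨ log₂ u + 0# ≤⟨ +-monoʳ-≤ _ (0≤log₂ 1<v) ⟩ Λ ∎

    log₂v≤Λ : log₂ v ≤ Λ
    log₂v≤Λ = begin log₂ v ≈⟨ +-identityˡ _ ⟨ 0# + log₂ v ≤⟨ +-monoˡ-≤ _ (0≤log₂ 1<u) ⟩ Λ ∎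

    0≤Λ : 0# ≤ Λ
    0≤Λ = ≤-trans (0≤log₂ 1<u) log₂u≤Λ

    a+b≤Λ : fromℕ (a ℕ.+ b) ≤ Λ
    a+b≤Λ = begin
      fromℕ (a ℕ.+ b)     ≈⟨ fromℕ-+ a b ⟩
      fromℕ a + fromℕ b   ≤⟨ +-mono-≤ (2^k≤x⇒k≤log₂x a (Rounding.2^a≤x ru)) (2^k≤x⇒k≤log₂x b (Rounding.2^a≤x rv)) ⟩
      Λ                   ∎

    1≤kΛ : ∀ k {x} → 1# < x → log₂ x ≤ Λ → 1# ≤ fromℕ k * (x - 1#) → 1# ≤ fromℕ k * Λ
    1≤kΛ k {x} 1<x log₂x≤Λ 1≤k[x-1] = begin
      1#               ≤⟨ 1≤k*log₂[1+η] {x} {x - 1#} {k} (trans (sym (x-y+y≈x x 1#)) (+-comm _ _)) (inj₁ (0<y-x 1<x)) 1≤k[x-1] ⟩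
      fromℕ k * log₂ x ≤⟨ *-monoʳ-≤ (0≤fromℕ k) log₂x≤Λ ⟩
      fromℕ k * Λ      ∎

    -- Once the logarithms are known to be at least 1/k, the hypothesis on n bounds `W` at the price
    -- of k².
    W≤k²Λ²W : ∀ k → 1# ≤ fromℕ k * Λ → W ≤ fromℕ (k ℕ.* k) * (Λ * Λ * W)
    W≤k²Λ²W k 1≤kΛ = begin
      W                                       ≈⟨ trans (*-congʳ (*-identityʳ 1#)) (*-identityˡ W) ⟨
      1# * 1# * W                             ≤⟨ *-monoˡ-≤ 0≤W (*-mono-≤ 0≤1 0≤1 1≤kΛ 1≤kΛ) ⟩
      (fromℕ k * Λ) * (fromℕ k * Λ) * W
        ≈⟨ solve 3 (λ k l w → (k :* l) :* (k :* l) :* w := (k :* k) :* (l :* l :* w)) refl (fromℕ k) Λ W ⟩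
      fromℕ k * fromℕ k * (Λ * Λ * W)         ≈⟨ *-congʳ (fromℕ-* k k) ⟨
      fromℕ (k ℕ.* k) * (Λ * Λ * W)           ∎

    0≤Λ²W : 0# ≤ Λ * Λ * W
    0≤Λ²W = *-nonneg (*-nonneg 0≤Λ 0≤Λ) 0≤W

    -- The logarithms have no uniform positive lower bound, but for the given ε < 1 some `k`, chosen
    -- above 1/(u-1), makes `k Λ` at least 1.
    0<Λ²W : 0# < Λ * Λ * W
    0<Λ²W = ≰⇒> λ Λ²W≤0 → ≤⇒≯ (begin
      1#                                ≤⟨ 1≤W ⟩
      W                                 ≤⟨ W≤k²Λ²W k (1≤kΛ k 1<u log₂u≤Λ 1≤k[u-1]) ⟩
      fromℕ (k ℕ.* k) * (Λ * Λ * W)     ≤⟨ *-monoʳ-≤ (0≤fromℕ (k ℕ.* k)) Λ²W≤0 ⟩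
      fromℕ (k ℕ.* k) * 0#              ≈⟨ zeroʳ _ ⟩
      0#                                ∎) 0<1
      where
      η = u - 1#
      0<η : 0# < η
      0<η = 0<y-x 1<u
      k = proj₁ (archimedean (η ⁻¹))
      1≤k[u-1] : 1# ≤ fromℕ k * η
      1≤k[u-1] = begin
        1#             ≈⟨ ⁻¹-inverseʳ η (0<⇒≉0 0<η) ⟨
        η * η ⁻¹       ≤⟨ *-monoʳ-≤ (inj₁ 0<η) (inj₁ (proj₂ (archimedean (η ⁻¹)))) ⟩
        η * fromℕ k    ≈⟨ *-comm _ _ ⟩
        fromℕ k * η    ∎

    module _ {n : ℕ} (large : fromℕ Cℕ * (Λ * Λ) * W ≤ fromℕ n) where

      M*Λ²W≤n : ∀ {M} → M ℕ.≤ Cℕ → fromℕ M * (Λ * Λ * W) ≤ fromℕ n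
      M*Λ²W≤n {M} M≤C = begin
        fromℕ M * (Λ * Λ * W)    ≤⟨ *-monoˡ-≤ 0≤Λ²W (fromℕ-mono-≤ M≤C) ⟩
        fromℕ Cℕ * (Λ * Λ * W)   ≈⟨ *-assoc _ _ _ ⟨
        fromℕ Cℕ * (Λ * Λ) * W   ≤⟨ large ⟩
        fromℕ n                  ∎

      n≢0 : ¬ (n ≡ 0)
      n≢0 ≡.refl = ≤⇒≯ (M*Λ²W≤n {1} 1≤Cℕ) (*-pos (0<fromℕ 1) 0<Λ²W)

      4c[a+b]²UUV≤n : 4 ℕ.* c ℕ.* ((a ℕ.+ b) ℕ.* (a ℕ.+ b)) ℕ.* (U ℕ.* U ℕ.* V) ℕ.≤ n
      4c[a+b]²UUV≤n = fromℕ-cancel-≤ (begin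
        fromℕ (4 ℕ.* c ℕ.* ((a ℕ.+ b) ℕ.* (a ℕ.+ b)) ℕ.* (U ℕ.* U ℕ.* V))
          ≈⟨ trans (fromℕ-* (4 ℕ.* c ℕ.* ((a ℕ.+ b) ℕ.* (a ℕ.+ b))) (U ℕ.* U ℕ.* V))
               (*-congʳ (trans (fromℕ-* (4 ℕ.* c) ((a ℕ.+ b) ℕ.* (a ℕ.+ b))) (*-congˡ (fromℕ-* (a ℕ.+ b) (a ℕ.+ b))))) ⟩
        fromℕ (4 ℕ.* c) * (fromℕ (a ℕ.+ b) * fromℕ (a ℕ.+ b)) * fromℕ (U ℕ.* U ℕ.* V)
          ≤⟨ *-mono-≤ (*-nonneg (0≤fromℕ (4 ℕ.* c)) (*-nonneg (0≤fromℕ (a ℕ.+ b)) (0≤fromℕ (a ℕ.+ b)))) (0≤fromℕ (U ℕ.* U ℕ.* V))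
               (*-monoʳ-≤ (0≤fromℕ (4 ℕ.* c)) (*-mono-≤ (0≤fromℕ (a ℕ.+ b)) (0≤fromℕ (a ℕ.+ b)) a+b≤Λ a+b≤Λ)) UUV≤8W ⟩
        fromℕ (4 ℕ.* c) * (Λ * Λ) * (fromℕ 8 * W)
          ≈⟨ solve 4 (λ c l e w → c :* (l :* l) :* (e :* w) := (e :* c) :* (l :* l :* w)) refl (fromℕ (4 ℕ.* c)) Λ (fromℕ 8) W ⟩
        fromℕ 8 * fromℕ (4 ℕ.* c) * (Λ * Λ * W)
          ≈⟨ *-congʳ (fromℕ-* 8 (4 ℕ.* c)) ⟨
        fromℕ (8 ℕ.* (4 ℕ.* c)) * (Λ * Λ * W)
          ≤⟨ M*Λ²W≤n (ℕ.m≤m+n (8 ℕ.* (4 ℕ.* c)) _) ⟩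
        fromℕ n ∎)

      -- Short inputs, where ε is near 1 and t near 0.

      module Small (small : n ℕ.< 2 ℕ.^ d₀ ℕ.* (U ℕ.* U ℕ.* V)) where

        n<k₀W : fromℕ n < fromℕ k₀ * W
        n<k₀W = begin-strict
          fromℕ n                                     <⟨ fromℕ-mono-< small ⟩
          fromℕ (2 ℕ.^ d₀ ℕ.* (U ℕ.* U ℕ.* V))        ≈⟨ fromℕ-* (2 ℕ.^ d₀) (U ℕ.* U ℕ.* V) ⟩
          fromℕ (2 ℕ.^ d₀) * fromℕ (U ℕ.* U ℕ.* V)    ≤⟨ *-monoʳ-≤ (0≤fromℕ (2 ℕ.^ d₀)) UUV≤8W ⟩
          fromℕ (2 ℕ.^ d₀) * (fromℕ 8 * W)
            ≈⟨ solve 3 (λ p e w → p :* (e :* w) := (e :* p) :* w) refl (fromℕ (2 ℕ.^ d₀)) (fromℕ 8) W ⟩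
          fromℕ 8 * fromℕ (2 ℕ.^ d₀) * W              ≈⟨ *-congʳ (fromℕ-* 8 (2 ℕ.^ d₀)) ⟨
          fromℕ k₀ * W                                ∎

        -- Otherwise `k₀ Λ` would be at least 1, and the summand k₀³ of `Cℕ` would push `n` up to
        -- `k₀ W`.
        near-1 : ∀ {x} → 1# < x → log₂ x ≤ Λ → fromℕ k₀ * (x - 1#) < 1#
        near-1 {x} 1<x log₂x≤Λ = ≰⇒> λ 1≤k₀[x-1] → ≤⇒≯ (begin
          fromℕ k₀ * W                                   ≤⟨ *-monoʳ-≤ (0≤fromℕ k₀) (W≤k²Λ²W k₀ (1≤kΛ k₀ 1<x log₂x≤Λ 1≤k₀[x-1])) ⟩
          fromℕ k₀ * (fromℕ (k₀ ℕ.* k₀) * (Λ * Λ * W))   ≈⟨ *-assoc _ _ _ ⟨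
          fromℕ k₀ * fromℕ (k₀ ℕ.* k₀) * (Λ * Λ * W)     ≈⟨ *-congʳ (fromℕ-* k₀ (k₀ ℕ.* k₀)) ⟨
          fromℕ (k₀ ℕ.* (k₀ ℕ.* k₀)) * (Λ * Λ * W)       ≤⟨ M*Λ²W≤n (ℕ.m≤n+m (k₀ ℕ.* (k₀ ℕ.* k₀)) (8 ℕ.* (4 ℕ.* c))) ⟩
          fromℕ n                                        ∎) n<k₀W

        M[x-1]<1 : ∀ {M x} → M ℕ.≤ k₀ → 1# < x → log₂ x ≤ Λ → fromℕ M * (x - 1#) < 1#
        M[x-1]<1 {M} {x} M≤k₀ 1<x log₂x≤Λ = begin-strict
          fromℕ M * (x - 1#)   ≤⟨ *-monoˡ-≤ (inj₁ (0<y-x 1<x)) (fromℕ-mono-≤ M≤k₀) ⟩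
          fromℕ k₀ * (x - 1#)  <⟨ near-1 1<x log₂x≤Λ ⟩
          1#                   ∎

        rounding≤2 : ∀ {x} (r : Rounding x) → 1# < x → log₂ x ≤ Λ → Rounding.U r ℕ.≤ 2
        rounding≤2 {x} r 1<x log₂x≤Λ = fromℕ-cancel-< (begin-strict
          fromℕ (Rounding.pred-U r)      <⟨ Rounding.pred-U<x r ⟩
          x                              ≈⟨ x-y+y≈x x 1# ⟨
          x - 1# + 1#                    ≈⟨ +-comm _ _ ⟩
          1# + (x - 1#)                  ≈⟨ +-congˡ (trans (*-congʳ fromℕ-1) (*-identityˡ _)) ⟨
          1# + fromℕ 1 * (x - 1#)        <⟨ +-monoʳ-< 1# (M[x-1]<1 {1} (ℕ.≤-trans (s≤s z≤n) 3≤k₀) 1<x log₂x≤Λ) ⟩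
          1# + 1#                        ≈⟨ +-congˡ fromℕ-1 ⟨
          fromℕ 2                        ∎)

        n<k₀ : n ℕ.< k₀
        n<k₀ = ℕ.<-≤-trans small (ℕ.≤-trans
          (ℕ.*-monoʳ-≤ (2 ℕ.^ d₀) (ℕ.*-mono-≤ (ℕ.*-mono-≤ U≤2 U≤2) (rounding≤2 rv 1<v log₂v≤Λ)))
          (ℕ.≤-reflexive (ℕ.*-comm (2 ℕ.^ d₀) 8)))
          where
          U≤2 : U ℕ.≤ 2
          U≤2 = rounding≤2 ru 1<u log₂u≤Λ

        -- Indeed v - 1 = t/(1-t).
        t≤v-1 : t ≤ v - 1#
        t≤v-1 = +-cancelʳ-≤ 1# (begin
          t + 1#             ≈⟨ +-cong (*-identityˡ t) sv≈1 ⟨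
          1# * t + s * v     ≤⟨ +-monoˡ-≤ (s * v) (*-monoˡ-≤ 0≤t (inj₁ 1<v)) ⟩
          v * t + s * v      ≈⟨ solve 3 (λ v t s → v :* t :+ s :* v := v :* (s :+ t)) refl v t s ⟩
          v * (s + t)        ≈⟨ trans (*-congˡ s+t≈1) (*-identityʳ v) ⟩
          v                  ≈⟨ x-y+y≈x v 1# ⟨
          v - 1# + 1#        ∎)

        nt<1 : fromℕ n * t < 1#
        nt<1 = begin-strict
          fromℕ n * t         ≤⟨ *-monoʳ-≤ (0≤fromℕ n) t≤v-1 ⟩
          fromℕ n * (v - 1#)  <⟨ M[x-1]<1 (ℕ.<⇒≤ n<k₀) 1<v log₂v≤Λ ⟩
          1#                  ∎

        3≤4ε : fromℕ 3 ≤ fromℕ 4 * ε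
        3≤4ε = begin
          fromℕ 3               ≈⟨ *-identityʳ _ ⟨
          fromℕ 3 * 1#          ≈⟨ *-congˡ εu≈1 ⟨
          fromℕ 3 * (ε * u)     ≈⟨ solve 3 (λ k ε u → k :* (ε :* u) := ε :* (k :* u)) refl (fromℕ 3) ε u ⟩
          ε * (fromℕ 3 * u)     ≤⟨ *-monoʳ-≤ 0≤ε (begin
            fromℕ 3 * u                        ≈⟨ *-congˡ (x-y+y≈x u 1#) ⟨
            fromℕ 3 * (u - 1# + 1#)            ≈⟨ trans (distribˡ _ _ _) (+-congˡ (*-identityʳ _)) ⟩
            fromℕ 3 * (u - 1#) + fromℕ 3       ≤⟨ +-monoˡ-≤ _ (inj₁ (M[x-1]<1 {3} 3≤k₀ 1<u log₂u≤Λ)) ⟩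
            fromℕ 4                            ∎) ⟩
          ε * fromℕ 4           ≈⟨ *-comm _ _ ⟩
          fromℕ 4 * ε           ∎

        -- From ε ≥ 3/4 and n ≥ 2 follows εn ≥ 3/2. This keeps the query bound away from 0, so that
        -- boundedly many queries fit into it.
        1≤2log₂[εn] : 2 ℕ.≤ n → 1# ≤ fromℕ 2 * log₂ (ε * fromℕ n)
        1≤2log₂[εn] 2≤n = 1≤k*log₂[1+η] {ε * fromℕ n} {η} {2} (trans (sym (x-y+y≈x _ 1#)) (+-comm _ _))
          (≮⇒≥ λ η<0 → ≤⇒≯ 1≤2η (begin-strict
            fromℕ 2 * η  ≤⟨ *-monoʳ-≤ (0≤fromℕ 2) (inj₁ η<0) ⟩
            fromℕ 2 * 0# ≈⟨ zeroʳ _ ⟩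
            0#           <⟨ 0<1 ⟩
            1#           ∎)) 1≤2η
          where
          η = ε * fromℕ n - 1#
          1≤2η : 1# ≤ fromℕ 2 * η
          1≤2η = +-cancelʳ-≤ (fromℕ 2) (begin
            1# + fromℕ 2                     ≤⟨ 3≤4ε ⟩
            fromℕ 4 * ε                      ≈⟨ *-congʳ (fromℕ-* 2 2) ⟩
            fromℕ 2 * fromℕ 2 * ε            ≈⟨ trans (*-assoc _ _ _) (*-congˡ (*-comm _ _)) ⟩
            fromℕ 2 * (ε * fromℕ 2)          ≤⟨ *-monoʳ-≤ (0≤fromℕ 2) (*-monoʳ-≤ 0≤ε (fromℕ-mono-≤ 2≤n)) ⟩
            fromℕ 2 * (ε * fromℕ n)          ≈⟨ *-congˡ (x-y+y≈x _ 1#) ⟨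
            fromℕ 2 * (η + 1#)               ≈⟨ trans (distribˡ _ _ _) (+-congˡ (*-identityʳ _)) ⟩
            fromℕ 2 * η + fromℕ 2            ∎)

  -- Testers for one nonempty input length and one local property.

  module Instance (ℓ : ℕ) (ε t : Carrier) (0<ε : 0# < ε) (ε<1 : ε < 1#) (0<t : 0# < t) (t<1 : t < 1#)
                  (P : Property (suc ℓ)) (local : IsLocal P) where

    n : ℕ
    n = suc ℓ

    open Scales ε t 0<ε ε<1 0<t t<1

    bound : Carrier
    bound = fromℕ Kℕ * ∣ log₂ (ε * fromℕ n) / (ε * s) ∣

    ≤bound : ∀ {y} → y ≤ log₂ (ε * fromℕ n) → fromℕ Kℕ * (y * (u * v)) ≤ bound
    ≤bound {y} y≤log = *-monoʳ-≤ (0≤fromℕ Kℕ) (begin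
      y * (u * v)                      ≤⟨ *-monoˡ-≤ (*-nonneg 0≤u 0≤v) y≤log ⟩
      log₂ (ε * fromℕ n) * (u * v)     ≈⟨ *-congˡ [εs]⁻¹≈uv ⟨
      log₂ (ε * fromℕ n) / (ε * s)     ≤⟨ x≤∣x∣ _ ⟩
      ∣ log₂ (ε * fromℕ n) / (ε * s) ∣ ∎)

    M*U≤n⇒M≤εn : ∀ {M} → M ℕ.* U ℕ.≤ n → fromℕ M ≤ ε * fromℕ n
    M*U≤n⇒M≤εn {M} MU≤n = begin
      fromℕ M                   ≈⟨ *-identityʳ _ ⟨
      fromℕ M * 1#              ≈⟨ *-congˡ εu≈1 ⟨
      fromℕ M * (ε * u)         ≤⟨ *-monoʳ-≤ (0≤fromℕ M) (*-monoʳ-≤ 0≤ε (Rounding.x≤U ru)) ⟩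
      fromℕ M * (ε * fromℕ U)   ≈⟨ solve 3 (λ M ε U → M :* (ε :* U) := ε :* (M :* U)) refl (fromℕ M) ε (fromℕ U) ⟩
      ε * (fromℕ M * fromℕ U)   ≈⟨ *-congˡ (fromℕ-* M U) ⟨
      ε * fromℕ (M ℕ.* U)       ≤⟨ *-monoʳ-≤ 0≤ε (fromℕ-mono-≤ MU≤n) ⟩
      ε * fromℕ n               ∎

    F      = proj₁ local
    F-resp = proj₁ (proj₂ local)
    P⇔     = proj₂ (proj₂ local)

    ¬F-resp : (λ x y → ¬ F x y) Respects₂ _≈_
    ¬F-resp = (λ y≈y′ ¬F Fxy′ → ¬F (proj₁ F-resp (sym y≈y′) Fxy′)) , (λ x≈x′ ¬F Fx′y → ¬F (proj₂ F-resp (sym x≈x′) Fx′y))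

    P-resp : ∀ {f g} → (∀ x → f x ≈ g x) → P f → P g
    P-resp {f} {g} f≈g pf = Equivalence.from (P⇔ g) λ i j j≡ Fgg →
      Equivalence.to (P⇔ f) pf i j j≡ (proj₁ F-resp (sym (f≈g j)) (proj₂ F-resp (sym (f≈g i)) Fgg))

    Far⇒¬P : ∀ {f} → Far ε P f → ¬ P f
    Far⇒¬P {f} far pf = <-irrefl refl (begin-strict
      0#                ≈⟨ zeroʳ ε ⟨
      ε * 0#            <⟨ *-pos′ ⟩
      ε * fromℕ n       ≤⟨ far f pf ⟩
      fromℕ (OnlineModel.Dist realDecSetoid n f f)  ≈⟨ reflexive (≡.cong fromℕ self) ⟩
      0#                ∎)
      where
      *-pos′ : ε * 0# < ε * fromℕ n
      *-pos′ = begin-strict ε * 0# ≈⟨ zeroʳ ε ⟩ 0# <⟨ *-pos 0<ε (0<fromℕ n) ⟩ ε * fromℕ n ∎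
      self : OnlineModel.Dist realDecSetoid n f f ≡ 0
      self = ≡.trans (countFin≡∑ (λ x → ¬? (f x ≟ f x)))
        (≡.trans (sum-cong-≗ {n} (λ x → 𝟙-no (¬? (f x ≟ f x)) (λ ne → ne refl))) (≡.trans (∑-const n 0) (ℕ.*-zeroʳ n)))

    module _ (A : DecSetoid 0ℓ 0ℓ) (reading : Reading realDecSetoid A) where
      open Observation A reading {n}
      open Testers em reading {n} P

      step≤1 : ∀ {S} → FixedRate A t S → ∀ h x → Dist (S h) (S (x ∷ h)) ℕ.≤ 1
      step≤1 {S} rate h x = fromℕ-cancel-≤ (begin
        fromℕ (Dist (S h) (S (x ∷ h)))                  ≤⟨ rate h x ⟩
        ⌊ fromℕ (suc i) * t ⌋ - ⌊ fromℕ i * t ⌋         ≤⟨ +-cancelʳ-≤ ⌊ fromℕ i * t ⌋ (begin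
          ⌊ fromℕ (suc i) * t ⌋ - ⌊ fromℕ i * t ⌋ + ⌊ fromℕ i * t ⌋ ≈⟨ x-y+y≈x _ _ ⟩
          ⌊ fromℕ (suc i) * t ⌋
            ≤⟨ ⌊⌋-shift 1 (*-nonneg (0≤fromℕ i) 0≤t) (*-nonneg (0≤fromℕ (suc i)) 0≤t) (begin
              (1# + fromℕ i) * t     ≈⟨ distribʳ t 1# (fromℕ i) ⟩
              1# * t + fromℕ i * t   ≤⟨ +-monoˡ-≤ _ (begin 1# * t ≈⟨ *-identityˡ t ⟩ t <⟨ t<1 ⟩ 1# ≈⟨ fromℕ-1 ⟨ fromℕ 1 ∎) ⟩
              fromℕ 1 + fromℕ i * t  ∎) ⟩
          fromℕ 1 + ⌊ fromℕ i * t ⌋ ∎) ⟩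
        fromℕ 1                                         ∎)
        where i = suc (length h)

      <1⇒≡0 : ∀ {k} → fromℕ k < 1# → k ≡ 0
      <1⇒≡0 {k} k<1 = ℕ.n<1⇒n≡0 (fromℕ-cancel-< (begin-strict fromℕ k <⟨ k<1 ⟩ 1# ≈⟨ fromℕ-1 ⟨ fromℕ 1 ∎))

      exhaustive-tester : fromℕ n ≤ bound → fromℕ n * t < 1# → Tester ε t P bound
      exhaustive-tester n≤bound nt<1 = n , n≤bound , T , decides , one-sided
        where
        positions = Vec.allFin n

        T : RandomizedAlgorithm n
        T = record
          { seeds = 1 ; tree = λ _ → exhaust positions (λ _ → ⊤)
          ; extensional = λ _ → exhaust-≋ positions (λ _ → record { to = id ; from = id ; to-cong = λ { ≡.refl → ≡.refl } ; from-cong = λ { ≡.refl → ≡.refl } }) }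

        one-sided : ∀ f S → P f → (∀ h x → f x ~ S h x) → ∀ s → outcome T S s ≡ true
        one-sided f S pf f~S s = exhaust-complete S pf (λ h x _ → f~S h x) positions [] ℕ.≤-refl tt

        decides : ∀ f S → StartsWith (ι ∘ f) S → FixedRate A t S → Decides ε P T f S
        decides f S start rate =
          (λ pf → certain T S true λ s → exhaust-complete S pf
            (λ h x h<n → ~-respʳ (A.sym (unchanged h h<n x)) (~-ι (f x))) positions [] ℕ.≤-refl tt) ,
          (λ far → certain T S false λ s → Bool.¬-not λ accepted →
            let g , pg , _ , g≈f = exhaust-sound S {f} (λ h x h<n v~ → ~ι⇒≈ (~-respʳ (unchanged h h<n x) v~)) positions [] ℕ.≤-refl accepted
            in Far⇒¬P far (P-resp (λ x → All.lookup g≈f (∈-allFin⁺ x)) pg))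
          where
          module A = DecSetoid A
          -- During the first `n` queries each allowance is at most ⌊(i+1)t⌋ ≤ nt < 1, and a
          -- distance, being a natural number, is then 0.
          unchanged : ∀ h → length h ℕ.< n → ∀ x → S h x A.≈ ι (f x)
          unchanged []      _   = start
          unchanged (y ∷ h) h<n x = A.trans (A.sym (Dist≡0⇒≈ (<1⇒≡0 (begin-strict
              fromℕ (Dist (S h) (S (y ∷ h)))            ≤⟨ rate h y ⟩
              ⌊ fromℕ (suc i) * t ⌋ - ⌊ fromℕ i * t ⌋
                ≤⟨ +-cancelʳ-≤ ⌊ fromℕ i * t ⌋ (begin
                  ⌊ fromℕ (suc i) * t ⌋ - ⌊ fromℕ i * t ⌋ + ⌊ fromℕ i * t ⌋ ≈⟨ x-y+y≈x _ _ ⟩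
                  ⌊ fromℕ (suc i) * t ⌋                   ≈⟨ +-identityʳ _ ⟨
                  ⌊ fromℕ (suc i) * t ⌋ + 0#              ≤⟨ +-monoʳ-≤ _ (0≤⌊x⌋ (*-nonneg (0≤fromℕ i) 0≤t)) ⟩
                  ⌊ fromℕ (suc i) * t ⌋ + ⌊ fromℕ i * t ⌋ ∎) ⟩
              ⌊ fromℕ (suc i) * t ⌋                     ≤⟨ ⌊x⌋≤x (*-nonneg (0≤fromℕ (suc i)) 0≤t) ⟩
              fromℕ (suc i) * t                         ≤⟨ *-monoˡ-≤ 0≤t (fromℕ-mono-≤ h<n) ⟩
              fromℕ n * t                               <⟨ nt<1 ⟩
              1#                                        ∎)) x))
            (unchanged h (ℕ.<-trans (ℕ.n<1+n _) h<n) x)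
            where i = suc (length h)

      accepting-tester : 0# ≤ bound → (∀ f → P f) → Tester ε t P bound
      accepting-tester 0≤bound all-P = 0 , 0≤bound , T ,
        (λ f S _ _ → (λ _ → certain T S true λ _ → ≡.refl) , (λ far → contradiction (all-P f) (Far⇒¬P far))) ,
        λ _ _ _ _ _ → ≡.refl
        where
        T : RandomizedAlgorithm 0
        T = record { seeds = 1 ; tree = λ _ → output true ; extensional = λ _ → output true }

      module LargeCase (L : ℕ) (4HU≤n : 4 ℕ.* (2 ℕ.^ L ℕ.* U) ℕ.≤ n) (n≤8HU : n ℕ.≤ 8 ℕ.* (2 ℕ.^ L ℕ.* U))
                       (large : c ℕ.* (suc L ℕ.* suc L) ℕ.* (U ℕ.* U ℕ.* V) ℕ.≤ n) where

        Vt≤V-1 : fromℕ V * t ≤ fromℕ V-1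
        Vt≤V-1 = +-cancelʳ-≤ 1# (begin
          fromℕ V * t + 1#             ≈⟨ +-congˡ sv≈1 ⟨
          fromℕ V * t + s * v          ≤⟨ +-monoʳ-≤ _ (*-monoʳ-≤ (inj₁ 0<s) (Rounding.x≤U rv)) ⟩
          fromℕ V * t + s * fromℕ V    ≈⟨ solve 3 (λ V t s → V :* t :+ s :* V := V :* (s :+ t)) refl (fromℕ V) t s ⟩
          fromℕ V * (s + t)            ≈⟨ trans (*-congˡ s+t≈1) (*-identityʳ _) ⟩
          1# + fromℕ V-1               ≈⟨ +-comm _ _ ⟩
          fromℕ V-1 + 1#               ∎)

        stall : ∀ i → ∃[ w ] w ℕ.< V ×
                  ⌊ fromℕ (suc (suc (w ℕ.+ i))) * t ⌋ - ⌊ fromℕ (suc (w ℕ.+ i)) * t ⌋ < 1#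
        stall = floor-stalls V-1 0≤t Vt≤V-1

        w : ℕ → ℕ
        w i = proj₁ (stall i)

        levels m q : ℕ
        levels = suc L
        open Rounds levels w
        m = 32 ℕ.* (levels ℕ.* U)
        q = queries m 0

        open Scale c d₀ 2≤d₀ growth using (module Conditions; 2^[2+k]*x≡4*[2^k*x])
        open Conditions {n} {U} {V} {L} {q} 12288≤c n≤8HU 4HU≤n large
          (queries≤ V (λ i → proj₁ (proj₂ (stall i))) m 0)
          using (H; q≤64ℓUV; 4ℓq≤H; 6mℓq≤ℓn; 4ℓn≤mH; H≤n; 2H≤n)

        instance
          N≢0 : NonZero N
          N≢0 = _
          N^m≢0 : NonZero (N ℕ.^ m)
          N^m≢0 = ℕ.m^n≢0 N m

        L+2≤log : fromℕ (2 ℕ.+ L) ≤ log₂ (ε * fromℕ n)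
        L+2≤log = 2^k≤x⇒k≤log₂x (2 ℕ.+ L) (M*U≤n⇒M≤εn {2 ℕ.^ (2 ℕ.+ L)}
          (ℕ.≤-trans (ℕ.≤-reflexive (2^[2+k]*x≡4*[2^k*x] L U)) 4HU≤n))

        -- The 256 in `Kℕ` is 64 from the query count times 4 from rounding 1/ε and 1/(1-t) up. The
        -- number of levels is below log(εn) because 2^(L+2)·U ≤ n.
        q≤bound : fromℕ q ≤ bound
        q≤bound = begin
          fromℕ q                                        ≤⟨ fromℕ-mono-≤ {q} {64 ℕ.* (levels ℕ.* U ℕ.* V)} q≤64ℓUV ⟩
          fromℕ (64 ℕ.* (levels ℕ.* U ℕ.* V))            ≈⟨ fromℕ-* 64 (levels ℕ.* U ℕ.* V) ⟩
          fromℕ 64 * fromℕ (levels ℕ.* U ℕ.* V)          ≈⟨ *-congˡ (trans (fromℕ-* (levels ℕ.* U) V) (*-congʳ (fromℕ-* levels U))) ⟩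
          fromℕ 64 * (fromℕ levels * fromℕ U * fromℕ V)
            ≤⟨ *-monoʳ-≤ (0≤fromℕ 64) (*-mono-≤ (*-nonneg (0≤fromℕ levels) (0≤fromℕ U)) (0≤fromℕ V)
                 (*-mono-≤ (0≤fromℕ levels) (0≤fromℕ U) (fromℕ-mono-≤ {levels} {2 ℕ.+ L} (ℕ.n≤1+n levels)) U≤2u) V≤2v) ⟩
          fromℕ 64 * (fromℕ (2 ℕ.+ L) * (u + u) * (v + v))
            ≈⟨ solve 4 (λ k l u v → k :* (l :* (u :+ u) :* (v :+ v)) := (k :* con 4) :* (l :* (u :* v)))
                 refl (fromℕ 64) (fromℕ (2 ℕ.+ L)) u v ⟩
          fromℕ 64 * _ * (fromℕ (2 ℕ.+ L) * (u * v))     ≈⟨ *-congʳ (*-congˡ four) ⟩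
          fromℕ 64 * fromℕ 4 * (fromℕ (2 ℕ.+ L) * (u * v)) ≈⟨ *-congʳ (fromℕ-* 64 4) ⟨
          fromℕ 256 * (fromℕ (2 ℕ.+ L) * (u * v))
            ≤⟨ *-monoˡ-≤ (*-nonneg (0≤fromℕ (2 ℕ.+ L)) (*-nonneg 0≤u 0≤v)) (fromℕ-mono-≤ {256} {Kℕ} (ℕ.m≤m+n 256 _)) ⟩
          fromℕ Kℕ * (fromℕ (2 ℕ.+ L) * (u * v))         ≤⟨ ≤bound L+2≤log ⟩
          bound ∎
          where
          four : 1# + 1# + 1# + 1# ≈ fromℕ 4
          four = solve 0 (con 1 :+ con 1 :+ con 1 :+ con 1 := con 1 :+ (con 1 :+ (con 1 :+ (con 1 :+ con 0)))) refl

        T : RandomizedAlgorithm q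
        T = record { seeds = N ℕ.^ m ; tree = rounds m 0 ; extensional = rounds-≋ m 0 }

        2^≤n : ∀ {l} → l ℕ.< levels → 2 ℕ.^ l ℕ.≤ n
        2^≤n l<levels = ℕ.≤-trans (ℕ.^-monoʳ-≤ 2 (ℕ.≤-pred l<levels)) H≤n

        module Against {f : Sequence n} {S : Strategy} (start : StartsWith (ι ∘ f) S) (rate : FixedRate A t S) where

          still : ∀ i h x → length h ≡ w i ℕ.+ i → Dist (S h) (S (x ∷ h)) ≡ 0
          still i h x h≡ = <1⇒≡0 (begin-strict
            fromℕ (Dist (S h) (S (x ∷ h))) ≤⟨ rate h x ⟩
            ⌊ fromℕ (suc (suc (length h))) * t ⌋ - ⌊ fromℕ (suc (length h)) * t ⌋
              ≡⟨ ≡.cong (λ j → ⌊ fromℕ (suc (suc j)) * t ⌋ - ⌊ fromℕ (suc j) * t ⌋) h≡ ⟩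
            ⌊ fromℕ (suc (suc (w i ℕ.+ i))) * t ⌋ - ⌊ fromℕ (suc (w i ℕ.+ i)) * t ⌋
              <⟨ proj₂ (proj₂ (stall i)) ⟩
            1# ∎)

          slow : Slow f S
          slow = record { start = start ; step = step≤1 rate }

          open RoundsAnalysis levels w 2^≤n {f} {S} slow still

          open Repair em (DecSetoid.isDecEquivalence realDecSetoid) (λ x y → ¬ F x y) ¬F-resp ℓ (λ i → f (i mod n))

          P⇒Valid : ∀ {g} → P g → Valid 0 ℓ (λ i → g (i mod n))
          P⇒Valid {g} pg i _ i<ℓ = Equivalence.to (P⇔ g) pg (i mod n) (suc i mod n)
            (≡.trans (toℕ-mod-< (s≤s i<ℓ)) (≡.cong suc (≡.sym (toℕ-mod-< (ℕ.m<n⇒m<1+n i<ℓ)))))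
            where
            toℕ-mod-< : ∀ {i} → i ℕ.< n → toℕ (i mod n) ≡ i
            toℕ-mod-< i<n = ≡.trans (toℕ-fromℕ< _) (m<n⇒m%n≡m i<n)

          Valid⇒P : ∀ {g} → Valid 0 ℓ g → P (g ∘ toℕ)
          Valid⇒P {g} vg = Equivalence.from (P⇔ (g ∘ toℕ)) λ i j j≡ →
            ≡.subst (λ k → ¬ F (g (toℕ i)) (g k)) (≡.sym j≡)
              (vg (toℕ i) z≤n (ℕ.≤-pred (≡.subst (ℕ._< n) j≡ (toℕ<n j))))

          -- An interval that fits does not wrap, so its right end is the partner of its left end;
          -- wrapped pairs can only add to `badPairs`.
          defect≤bad : ∀ l x → defect l (toℕ x) ℕ.≤ 𝟙 (does (em {Bad l x}))
          defect≤bad l x with em {toℕ x ℕ.+ 2 ℕ.^ l ℕ.≤ ℓ × ¬ Good (toℕ x) (toℕ x ℕ.+ 2 ℕ.^ l)} | em {Bad l x}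
          ... | no _       | _      = z≤n
          ... | yes _      | yes _  = ℕ.≤-refl
          ... | yes (_ , ¬good) | no ¬bad = contradiction
            (λ { (g , pg , gx , gy) → ¬good ((λ i → g (i mod n)) , P⇒Valid pg ,
                   gx′ g gx , gy) }) ¬bad
            where
            gx′ : ∀ g → g x ≈ f x → g (toℕ x mod n) ≈ f (toℕ x mod n)
            gx′ g = ≡.subst (λ y → g y ≈ f y) (≡.sym (toℕ-mod x))

          Dist-cost : ∀ g → OnlineModel.Dist realDecSetoid n f (g ∘ toℕ) ≡ cost 0 n g
          Dist-cost g = ≡.trans (countFin≡∑ (λ x → ¬? (f x ≟ g (toℕ x))))
            (sum-cong-≗ {n} λ x → ≡.cong (λ y → 𝟙 (does (¬? (f y ≟ g (toℕ x))))) (≡.sym (toℕ-mod x)))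

          defects≤badPairs : ∑[ l < levels ] defects (toℕ l) ℕ.≤ badPairs
          defects≤badPairs = ∑-mono {levels} {λ l → defects (toℕ l)} {λ l → ∑[ x < n ] 𝟙 (does (em {Bad (toℕ l) x}))} λ l →
            ∑-mono {n} {λ x → defect (toℕ l) (toℕ x)} {λ x → 𝟙 (does (em {Bad (toℕ l) x}))} λ x → defect≤bad (toℕ l) x

          -- `L` was chosen with 4HU ≤ n, and U ≥ 1/ε turns this into 4H ≤ εn.
          Far⇒4H≤cost : Far ε P f → ∀ {g} → Valid 0 ℓ g → 4 ℕ.* H ℕ.≤ cost 0 n g
          Far⇒4H≤cost far {g} vg = ≡.subst (4 ℕ.* H ℕ.≤_) (Dist-cost g)
            (fromℕ-cancel-≤ {4 ℕ.* H} {OnlineModel.Dist realDecSetoid n f (g ∘ toℕ)} (begin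
              fromℕ (4 ℕ.* H)    ≤⟨ M*U≤n⇒M≤εn {4 ℕ.* H} (≡.subst (ℕ._≤ n) (≡.sym (ℕ.*-assoc 4 H U)) 4HU≤n) ⟩
              ε * fromℕ n        ≤⟨ far (g ∘ toℕ) (Valid⇒P vg) ⟩
              fromℕ (OnlineModel.Dist realDecSetoid n f (g ∘ toℕ)) ∎))

          bad-pairs : Far ε P f → H ℕ.≤ badPairs
          bad-pairs far = ℕ.≮⇒≥ λ few → irreparable (repair L 2H≤n (ℕ.≤-<-trans defects≤badPairs few))
            where
            irreparable : ¬ (∃[ g ] Valid 0 ℓ g × cost 0 n g ℕ.< 4 ℕ.* H)
            irreparable (g , vg , cost<4H) = ℕ.<⇒≱ cost<4H (Far⇒4H≤cost far vg)

          decides : Decides ε P T f S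
          decides =
            (λ pf → probability true false (count-outcomes m) (rejecting-third m pf 6mℓq≤ℓn)) ,
            (λ far → probability false true (≡.trans (ℕ.+-comm (count S m 0 [] false) _) (count-outcomes m))
              (accepting-third m H (ℕ.≤-trans H≤n (ℕ.m≤m+n n _)) (bad-pairs far) 4ℓq≤H 4ℓn≤mH))
            where
            probability : ∀ b b′ → count S m 0 [] b ℕ.+ count S m 0 [] b′ ≡ N ℕ.^ m →
                          3 ℕ.* count S m 0 [] b′ ℕ.≤ N ℕ.^ m → 2/3 ℚᵘ.≤ Pr[outcome≡_] T S b
            probability b b′ total third = 2/3≤ (N ℕ.^ m)
              (≡.trans (≡.cong (ℕ._+ count S m 0 [] b′) (countFin≡∑ (λ s → run (rounds m 0 s) S [] Bool.≟ b))) total) third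

        rounds-tester : Tester ε t P bound
        rounds-tester = q , q≤bound , T , (λ f S start rate → Against.decides start rate) ,
          λ f S pf f~S s → run-rounds-true S pf f~S m 0 s []

      0≤bound : 0# ≤ bound
      0≤bound = *-nonneg (0≤fromℕ Kℕ) (0≤∣x∣ _)

      tester : fromℕ Cℕ * (Λ * Λ) * W ≤ fromℕ n → Tester ε t P bound
      tester hyp with 2 ℕ.≤? n | n ℕ.<? 2 ℕ.^ d₀ ℕ.* (U ℕ.* U ℕ.* V)
      -- A single position has no neighbour, so nothing is forbidden.
      ... | no n<2 | _ = accepting-tester 0≤bound λ f → Equivalence.from (P⇔ f) λ i j j≡ →
        contradiction (ℕ.≤-trans (s≤s (s≤s z≤n)) (≡.subst (ℕ._< n) j≡ (toℕ<n j))) n<2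
      -- As n < k₀ and log(εn) ≥ 1/2, the summand `2 * k₀` of `Kℕ` pays for `n` queries.
      ... | yes 2≤n | yes small = exhaustive-tester (begin
          fromℕ n                                  ≤⟨ fromℕ-mono-≤ (ℕ.<⇒≤ n<k₀) ⟩
          fromℕ k₀                                 ≈⟨ *-identityʳ _ ⟨
          fromℕ k₀ * 1#                            ≤⟨ *-monoʳ-≤ (0≤fromℕ k₀) (1≤2log₂[εn] 2≤n) ⟩
          fromℕ k₀ * (fromℕ 2 * y)                 ≈⟨ solve 3 (λ k e y → k :* (e :* y) := (e :* k) :* y) refl (fromℕ k₀) (fromℕ 2) y ⟩
          fromℕ 2 * fromℕ k₀ * y                   ≈⟨ *-congʳ (fromℕ-* 2 k₀) ⟨
          fromℕ (2 ℕ.* k₀) * y                     ≤⟨ *-monoˡ-≤ 0≤y (fromℕ-mono-≤ {2 ℕ.* k₀} {Kℕ} (ℕ.m≤n+m _ 256)) ⟩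
          fromℕ Kℕ * y                             ≈⟨ *-congˡ (*-identityʳ y) ⟨
          fromℕ Kℕ * (y * 1#)                      ≤⟨ *-monoʳ-≤ (0≤fromℕ Kℕ) (*-monoʳ-≤ 0≤y 1≤uv) ⟩
          fromℕ Kℕ * (y * (u * v))                 ≤⟨ ≤bound ≤-refl ⟩
          bound ∎) nt<1
        where
        open Small {n} hyp small
        y = log₂ (ε * fromℕ n)
        0≤y : 0# ≤ y
        0≤y = *-cancelˡ-≤ (0<fromℕ 2) (begin fromℕ 2 * 0# ≈⟨ zeroʳ _ ⟩ 0# ≤⟨ 0≤1 ⟩ 1# ≤⟨ 1≤2log₂[εn] 2≤n ⟩ fromℕ 2 * y ∎)
        1≤uv : 1# ≤ u * v
        1≤uv = begin 1# ≈⟨ *-identityʳ 1# ⟨ 1# * 1# ≤⟨ *-mono-≤ 0≤1 0≤1 (inj₁ 1<u) (inj₁ 1<v) ⟩ u * v ∎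
      ... | yes _ | no n≮ = LargeCase.rounds-tester L 4HU≤n n≤8HU large
        where
        open Scale c d₀ 2≤d₀ growth using (scale)
        scaled : ∃[ L ] 4 ℕ.* (2 ℕ.^ L ℕ.* U) ℕ.≤ n × n ℕ.≤ 8 ℕ.* (2 ℕ.^ L ℕ.* U) ×
                        c ℕ.* (suc L ℕ.* suc L) ℕ.* (U ℕ.* U ℕ.* V) ℕ.≤ n
        scaled = scale {n} {U} {V} {a} {b} (Rounding.U≤2^[1+a] ru) (Rounding.U≤2^[1+a] rv)
          (4c[a+b]²UUV≤n {n} hyp) (ℕ.≮⇒≥ n≮)
        L = proj₁ scaled
        4HU≤n = proj₁ (proj₂ scaled)
        n≤8HU = proj₁ (proj₂ (proj₂ scaled))
        large = proj₂ (proj₂ (proj₂ scaled))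

  -- The two kinds of adversaries.

  -- An erased answer is compatible with every value, so it cannot cause a rejection by itself.
  erasureReading : Reading realDecSetoid erasable
  erasureReading = record
    { ι       = just
    ; _~_     = λ v a → (a E.≈ nothing) ⊎ (a E.≈ just v)
    ; ~-respʳ = λ { a≈b (inj₁ a≈⊥) → inj₁ (E.trans (E.sym a≈b) a≈⊥)
                  ; a≈b (inj₂ a≈v) → inj₂ (E.trans (E.sym a≈b) a≈v) }
    ; ~-ι     = λ v → inj₂ E.refl
    ; ~ι⇒≈    = λ { (inj₁ ()) ; (inj₂ (just w≈v)) → sym w≈v }
    }
    where module E = DecSetoid erasable

  corruptionReading : Reading realDecSetoid realDecSetoid
  corruptionReading = record
    { ι = id ; _~_ = _≈_ ; ~-respʳ = λ a≈b v≈a → trans v≈a a≈b ; ~-ι = λ _ → refl ; ~ι⇒≈ = id }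

  erased-compatible : ∀ {t n f S} → AdversaryType.Allowed (fixedRateErasure t n) f S →
                      ∀ h x → Reading._~_ erasureReading (f x) (S h x)
  erased-compatible (start , _ , _) [] x = inj₂ (start x)
  erased-compatible {S = S} allowed@(_ , _ , erases) (y ∷ h) x with erases h y x
  ... | inj₁ same   = Reading.~-respʳ erasureReading {_} {S h x} (DecSetoid.sym erasable same) (erased-compatible allowed h x)
  ... | inj₂ erased = inj₁ erased

  Testable : Carrier → Carrier → Set₁
  Testable C K = ∀ (n : ℕ) (ε t : Carrier) → 0# < ε → ε < 1# → 0# < t → t < 1# →
    (P : Property n) → IsLocal P →
    (C * (log₂ (1# / ε) + log₂ (1# / (1# - t))) ^ 2) / (ε ^ 2 * (1# - t)) ≤ fromℕ n →
    let bound = K * ∣ log₂ (ε * fromℕ n) / (ε * (1# - t)) ∣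
        erasure = fixedRateErasure t n
        corruption = fixedRateCorruption t n
    in
    (Σ[ q ∈ ℕ ] (fromℕ q ≤ bound) ×
     (Σ[ T ∈ Algorithm erasure q ] IsTester erasure ε P T × OneSided erasure P T)) ×
    (Σ[ q ∈ ℕ ] (fromℕ q ≤ bound) ×
     (Σ[ T ∈ Algorithm corruption q ] IsTester corruption ε P T))

  testable : Testable (fromℕ Cℕ) (fromℕ Kℕ)
  testable zero ε t 0<ε ε<1 0<t t<1 P local hyp = contradiction ≡.refl (n≢0 {0} (cleared {fromℕ Cℕ} hyp))
    where open Scales ε t 0<ε ε<1 0<t t<1
  testable (suc ℓ) ε t 0<ε ε<1 0<t t<1 P local hyp =
    (let q , q≤ , T , decides , one-sided = tester erasable erasureReading hyp′ in
     q , q≤ , T ,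
     (λ f S (start , rate , _) → decides f S start rate) ,
     (λ f S allowed pf → one-sided f S pf (erased-compatible {t} {suc ℓ} {f} {S} allowed))) ,
    (let q , q≤ , T , decides , _ = tester realDecSetoid corruptionReading hyp′ in
     q , q≤ , T , (λ f S (start , rate) → decides f S start rate))
    where
    open Scales ε t 0<ε ε<1 0<t t<1
    open Instance ℓ ε t 0<ε ε<1 0<t t<1 P local using (tester)
    hyp′ = cleared {fromℕ Cℕ} hyp

  testers : Σ[ C ∈ Carrier ] Σ[ K ∈ Carrier ] (0# < C) × (0# < K) × Testable C K
  testers = fromℕ Cℕ , fromℕ Kℕ , fromℕ-mono-< {0} {Cℕ} 1≤Cℕ , fromℕ-mono-< {0} {Kℕ} (s≤s z≤n) , testable

-- For d ≥ 2 the step from d to d+1 at most doubles the left side: with d = 2 + e, 2(3+e)² exceeds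
-- (4+e)² by 2 + 4e + e².
quadratic≤exponential : ∀ k d₀ → 2 ℕ.≤ d₀ → k ℕ.* (suc d₀ ℕ.* suc d₀) ℕ.≤ 2 ℕ.^ d₀ →
                        ∀ d → d₀ ℕ.≤ d → k ℕ.* (suc d ℕ.* suc d) ℕ.≤ 2 ℕ.^ d
quadratic≤exponential k d₀ 2≤d₀ base d d₀≤d = go (ℕ.≤⇒≤′ d₀≤d)
  where
  open import Data.Nat.Base
  open ℕ.≤-Reasoning
  go : ∀ {d} → d₀ ≤′ d → k * (suc d * suc d) ≤ 2 ^ d
  go ≤′-refl = base
  go {suc d} (≤′-step d₀≤′d) with e , ≡.refl ← ℕ.m≤n⇒∃[o]m+o≡n (ℕ.≤-trans 2≤d₀ (ℕ.≤′⇒≤ d₀≤′d)) = begin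
    k * ((4 + e) * (4 + e))                ≤⟨ ℕ.*-monoʳ-≤ k (ℕ.m≤m+n _ (2 + 4 * e + e * e)) ⟩
    k * ((4 + e) * (4 + e) + (2 + 4 * e + e * e)) ≡⟨ lemma k e ⟩
    2 * (k * ((3 + e) * (3 + e)))          ≤⟨ ℕ.*-monoʳ-≤ 2 (go d₀≤′d) ⟩
    2 * 2 ^ (2 + e)                        ∎
    where
    lemma : ∀ k e → k * ((4 + e) * (4 + e) + (2 + 4 * e + e * e)) ≡ 2 * (k * ((3 + e) * (3 + e)))
    lemma = solve-∀

proposition6p5 : ExcludedMiddle 0ℓ → (ℝ : RealNumbers) →
    let open RealNumbers ℝ
        open PropertyTesting ℝ
    in
    Σ[ C ∈ Carrier ] Σ[ K ∈ Carrier ] (0# < C) × (0# < K) ×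
    (∀ (n : ℕ) (ε t : Carrier) → 0# < ε → ε < 1# → 0# < t → t < 1# →
     (P : Property n) → IsLocal P →
     (C * (log₂ (1# / ε) + log₂ (1# / (1# - t))) ^ 2) / (ε ^ 2 * (1# - t)) ≤ fromℕ n →
     let bound = K * ∣ log₂ (ε * fromℕ n) / (ε * (1# - t)) ∣
         erasure = fixedRateErasure t n
         corruption = fixedRateCorruption t n
     in
     (Σ[ q ∈ ℕ ] (fromℕ q ≤ bound) ×
      (Σ[ T ∈ Algorithm erasure q ] IsTester erasure ε P T × OneSided erasure P T)) ×
     (Σ[ q ∈ ℕ ] (fromℕ q ≤ bound) ×
      (Σ[ T ∈ Algorithm corruption q ] IsTester corruption ε P T)))
-- With d₀ = 26 the base case reads 4·12288·27² = 35831808 ≤ 2^26 = 67108864.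
proposition6p5 = Main.testers 12288 26 ℕ.≤-refl (s≤s (s≤s z≤n))
  (quadratic≤exponential (4 ℕ.* 12288) 26 (s≤s (s≤s z≤n)) (ℕ.≤ᵇ⇒≤ _ _ tt))
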